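{- For all integers $n\ge 1$ and $k$ with $0\le 2k\le n$, the polynomial $F_{2^k1^{n-2k}}(z)$ is log-concave. In other words, for every involution $\pi\in\mathfrak{S}_n$ (i.e. $\pi^2=\mathrm{id}$, fixed points allowed), the polynomial $F_\pi(z)$ is log-concave.
   Context: For a positive integer $m$, $\mathfrak{S}_m$ is the symmetric group on $\{1,\dots,m\}$, $Q_m\subseteq\mathfrak{S}_m$ is the set of $m$-cycles, and $c(\eta)$ denotes the number of cycles (including fixed points) of a permutation $\eta$. Permutations are multiplied from left to right. For $\pi\in\mathfrak{S}_m$ the IO-polynomial is \[ F_\pi(z)=\sum_{\zeta\in Q_m} z^{\lfloor (c(\zeta\pi)-1)/2\rfloor}. \] A permutation has type $\lambda$ (a partition of $m$) if the multiset of its cycle lengths is $\lambda$; $F_\pi$ depends only on the type of $\pi$, and $F_\lambda:=F_\pi$ for $\pi$ of type $\lambda$. The partition $2^k1^{n-2k}$ has $k$ parts equal to $2$ and $n-2k$ parts equal to $1$. A polynomial $\sum_k a_kz^k$ with nonnegative coefficients is log-concave if $a_k^2\ge a_{k-1}a_{k+1}$ for all $k$. -}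

module Defs where

open import Data.Nat using (ℕ; zero; suc; _≤_; _/_; _∸_; _≟_)
open import Data.Fin using (Fin; toℕ) renaming (zero to fzero)
open import Data.Fin.Properties as FinP using ()
open import Data.List using (List; []; _∷_; map; concatMap; length; filter; upTo; allFin)
open import Data.List.Relation.Unary.All using (All)
open import Data.List.Relation.Unary.All.Properties using ()
open import Data.List.Relation.Unary.AllPairs using (AllPairs)
open import Data.Vec using (Vec; []; _∷_; lookup)
open import Relation.Binary.PropositionalEquality using (_≡_; _≢_)
open import Relation.Nullary using (Dec; ¬_)
open import Relation.Nullary.Decidable using (_×-dec_)
open import Data.Product using (_×_)
open import Relation.Nullary.Decidable using (¬?)
import Data.List.Relation.Unary.All as All
import Data.List.Relation.Unary.AllPairs as AllPairs

Map : ℕ → Set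
Map n = Fin n → Fin n

iter : ∀ {n} → Map n → ℕ → Fin n → Fin n
iter η zero    x = x
iter η (suc j) x = η (iter η j x)

_·_ : ∀ {n} → Map n → Map n → Map n
(ζ · π) x = π (ζ x)

allVecs : (n m : ℕ) → List (Vec (Fin n) m)
allVecs n zero    = [] ∷ []
allVecs n (suc m) = concatMap (λ x → map (x ∷_) (allVecs n m)) (allFin n)

allMaps : (n : ℕ) → List (Map n)
allMaps n = map lookup (allVecs n n)

-- ζ : Fin (suc m) → Fin (suc m) is an (m+1)-cycle iff the orbit
-- 0, ζ 0, ζ² 0, …, ζ^m 0 consists of m+1 pairwise distinct points
-- and ζ^{m+1} 0 = 0
-- (this forces ζ to be a bijection consisting of one single cycle).
IsFullCycle : ∀ {m} → Map (suc m) → Set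
IsFullCycle {m} ζ = AllPairs _≢_ (map (λ i → iter ζ i fzero) (upTo (suc m)))
                  × iter ζ (suc m) fzero ≡ fzero

isFullCycle? : ∀ {m} (ζ : Map (suc m)) → Dec (IsFullCycle ζ)
isFullCycle? {m} ζ = AllPairs.allPairs? (λ x y → ¬? (x FinP.≟ y)) _
                     ×-dec (iter ζ (suc m) fzero FinP.≟ fzero)

IsCycleMin : ∀ {n} → Map n → Fin n → Set
IsCycleMin {n} η x = All (λ j → toℕ x ≤ toℕ (iter η j x)) (upTo n)

isCycleMin? : ∀ {n} (η : Map n) (x : Fin n) → Dec (IsCycleMin η x)
isCycleMin? {n} η x = All.all? (λ j → toℕ x Data.Nat.≤? toℕ (iter η j x)) (upTo n)

-- number of cycles (fixed points included) of a permutation η: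
-- the number of points that are the minimum of their cycle
cycles : ∀ {n} → Map n → ℕ
cycles {n} η = length (filter (isCycleMin? η) (allFin n))

expo : ∀ {n} → Map n → Map n → ℕ
expo ζ π = (cycles (ζ · π) ∸ 1) / 2

fullCycles : (m : ℕ) → List (Map (suc m))
fullCycles m = filter isFullCycle? (allMaps (suc m))

-- coefficient of z^j in F_π(z) = Σ_{ζ ∈ Q_n} z^{⌊(c(ζπ)-1)/2⌋}
F-coeff : ∀ {m} → Map (suc m) → ℕ → ℕ
F-coeff {m} π j = length (filter (λ ζ → expo ζ π ≟ j) (fullCycles m))

-- log-concavity of a coefficient sequence a : ℕ → ℕ (a_{-1} = 0, so only
-- k ≥ 1 is nontrivial): a_k² ≥ a_{k-1} a_{k+1}
LogConcave : (ℕ → ℕ) → Set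
LogConcave a = ∀ k → a k Data.Nat.* a (suc (suc k)) ≤ a (suc k) Data.Nat.* a (suc k)

{-# OPTIONS --safe #-}
module Submission where

-- For q colours, q^c(ζπ) counts the colourings f with f(π(ζ x)) = f(x).  For
-- fixed f these ζ are the Eulerian tours of the digraph whose edges are
-- f(π x) → f(x).  Let P_π(q) = Σ_ζ q^c(ζπ), let π fix a ≠ b, let π′ = (a b) π,
-- and let B(q) count the pairs (ζ , f) for π with f(a) = f(b).
--   * Exactly one of ζπ, ζπ′ has a and b on one cycle, so
--     P_π′(q) + P_π(q) = (q + 1) B(q).
--   * Passing from π to π′ replaces two loops at u = f(a) and v = f(b) by two
--     opposite edges between u and v.  As for spanning trees in the BEST theorem,
--     this changes the number of tours by a multiple of the number of tours with
--     u and v identified, and summing over f gives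
--     P_π′(q + 1) = P_π(q + 1) + (q + 1) B(q).
-- Hence P_π′(q + 1) - P_π′(q) = P_π(q + 1) + P_π(q).  For an involution with k
-- transpositions it follows that (k + 1)! P_π is a multiple of w_k, where
-- w_(k+2) = 2 q w_(k+1) + (k + 2) (k + 1) w_k; this is the Harer–Zagier
-- recurrence.  The coefficients of consecutive w_k interlace, which propagates
-- log-concavity along the recurrence.

open import Defs
open import Data.Nat using (ℕ; suc)
open import Data.Fin using (Fin)
open import Relation.Binary.PropositionalEquality using (_≡_)
open import Data.Bool using (Bool; true; false; if_then_else_)
open import Data.Empty using (⊥-elim)
open import Data.Fin using (zero; suc; toℕ; punchIn)
open import Data.Fin.Permutation.Components using (transpose)
open import Data.Fin.Properties using (_≟_; all?; toℕ-injective; pigeonhole; toℕ≤pred[n]; punchIn-injective; punchInᵢ≢i)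
open import Data.List using (List; []; _∷_; _++_; map; concatMap; filter; length; allFin; upTo; applyUpTo; replicate)
import Data.List as List
open import Data.List.Membership.Propositional using (_∈_; _∉_; find; lose)
open import Data.List.Membership.Propositional.Properties using (∈-++⁺ˡ; ∈-++⁺ʳ; ∈-map⁺; ∈-map⁻; ∈-concatMap⁺; ∈-concatMap⁻; ∈-filter⁺; ∈-filter⁻; ∈-allFin; ∈-upTo⁺; ∈-∃++)
open import Data.List.Properties using (map-++; map-cong; map-∘; length-map; length-filter; map-tabulate; tabulate-cong; length-tabulate; map-applyUpTo; ++-conicalʳ; ++-identityʳ; ∷-injectiveˡ; ∷-injectiveʳ)
open import Data.List.Relation.Binary.Permutation.Propositional using (_↭_; prep; swap; ↭-refl; ↭-sym; ↭-trans)
import Data.List.Relation.Binary.Permutation.Propositional as ↭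
import Data.List.Relation.Binary.Permutation.Propositional.Properties as Perm
open import Data.List.Relation.Unary.All using (All; []; _∷_)
import Data.List.Relation.Unary.All as All
open import Data.List.Relation.Unary.All.Properties using (¬All⇒Any¬)
open import Data.List.Relation.Unary.AllPairs using ([]; _∷_)
open import Data.List.Relation.Unary.Any using (here; there)
open import Data.List.Relation.Unary.Unique.Propositional using (Unique)
import Data.List.Relation.Unary.Unique.Propositional.Properties as Uniq
open import Data.Nat using (zero; _+_; _*_; _^_; _∸_; _/_; _%_; _!; _≤_; _<_; z≤n; s≤s; NonZero)
import Data.Nat as ℕ
open import Data.Nat.DivMod using (m≡m%n+[m/n]*n; m%n<n; [m+kn]%n≡m%n; m<n⇒m%n≡m)
open import Data.Nat.Induction using (<-wellFounded)
open import Data.Nat.ListAction using (sum)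
open import Data.Nat.ListAction.Properties using (sum-++; sum-↭)
open import Data.Nat.Properties hiding (_≟_)
open import Data.Nat.Tactic.RingSolver using (solve-∀)
open import Data.Product using (∃; _×_; _,_; proj₁; proj₂)
open import Data.Sum using (_⊎_; inj₁; inj₂)
open import Data.Vec using (Vec; []; _∷_; lookup; fromList; _[_]≔_)
import Data.Vec as Vec
open import Data.Vec.Properties using (lookup-map; lookup∘tabulate; tabulate∘lookup; lookup∘update; lookup∘update′; ≡-dec)
import Data.Vec.Properties as VecP
open import Function using (_∘_; id; mk⇔)
open import Induction.WellFounded using (Acc; acc)
open import Relation.Binary.PropositionalEquality
open import Relation.Nullary using (Dec; does; yes; no; ¬_)
open import Relation.Nullary.Decidable using (_×-dec_; _⊎-dec_; does-⇔; dec-true; dec-false)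
open import Relation.Unary using (Decidable)
open ≡-Reasoning

-- The identification of u and v carries the weight i! j! / (i + j + 1)!: the vertices u and v have
-- degrees i + 1 and j + 1 and contribute i! j! to the number of tours, while the merged vertex has
-- degree i + j + 2 and contributes (i + j + 1)!. This weight depends on f. It disappears only in
-- the sum over all f with the same contraction, whose weights add up to 1 by a Pólya urn; until
-- then the equations over ℕ are kept with cleared denominators. The factor q + 1 of the second
-- relation counts the colours v that can be merged into another one. The merge leaves q colours,
-- which is why B is again taken at q. Sums of log-concave sequences need not be log-concave, so
-- log-concavity alone does not pass along the recurrence. It is replaced by a relation a ≼ b
-- between two sequences that is linear in each argument and says for b = shift a that a is
-- log-concave. The remaining obstacle is transitivity, which fails at zero coefficients; the
-- supports are therefore part of the invariant.

private variable
  A B P P′ : Set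
  k m n q : ℕ

-- Finite sums

∑ : List A → (A → ℕ) → ℕ
∑ xs φ = sum (map φ xs)

syntax ∑ xs (λ x → e) = ∑[ x ∈ xs ] e
infix 5 ∑

𝟙 : Dec P → ℕ
𝟙 d = if does d then 1 else 0

𝟙-yes : (d : Dec P) → P → 𝟙 d ≡ 1
𝟙-yes (yes _) p = refl
𝟙-yes (no ¬p) p = ⊥-elim (¬p p)

𝟙-no : (d : Dec P) → ¬ P → 𝟙 d ≡ 0
𝟙-no (yes p) ¬p = ⊥-elim (¬p p)
𝟙-no (no _)  ¬p = refl

𝟙-cong : (d : Dec P) (e : Dec P′) → (P → P′) → (P′ → P) → 𝟙 d ≡ 𝟙 e
𝟙-cong (yes p) e f g = sym (𝟙-yes e (f p))
𝟙-cong (no ¬p) e f g = sym (𝟙-no e (¬p ∘ g))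

𝟙-×-dec : (d : Dec P) (e : Dec P′) → 𝟙 (d ×-dec e) ≡ 𝟙 d * 𝟙 e
𝟙-×-dec (yes p) (yes q) = refl
𝟙-×-dec (yes p) (no ¬q) = refl
𝟙-×-dec (no ¬p) e       = refl

𝟙-guard : (d : Dec P) {a b : ℕ} → (P → a ≡ b) → 𝟙 d * a ≡ 𝟙 d * b
𝟙-guard (yes p) h = cong (1 *_) (h p)
𝟙-guard (no ¬p) h = refl

∑-cong : (xs : List A) {φ ψ : A → ℕ} → (∀ x → φ x ≡ ψ x) → ∑ xs φ ≡ ∑ xs ψ
∑-cong xs h = cong sum (map-cong h xs)

∑-cong-∈ : (xs : List A) {φ ψ : A → ℕ} → (∀ {x} → x ∈ xs → φ x ≡ ψ x) → ∑ xs φ ≡ ∑ xs ψ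
∑-cong-∈ []       h = refl
∑-cong-∈ (x ∷ xs) h = cong₂ _+_ (h (here refl)) (∑-cong-∈ xs (h ∘ there))

∑-++ : (xs ys : List A) (φ : A → ℕ) → ∑ (xs ++ ys) φ ≡ ∑ xs φ + ∑ ys φ
∑-++ xs ys φ = trans (cong sum (map-++ φ xs ys)) (sum-++ (map φ xs) (map φ ys))

∑-map : (f : A → B) (xs : List A) (φ : B → ℕ) → ∑ (map f xs) φ ≡ ∑ xs (φ ∘ f)
∑-map f xs φ = cong sum (sym (map-∘ xs))

∑-concatMap : (f : A → List B) (xs : List A) (φ : B → ℕ) →
  ∑ (concatMap f xs) φ ≡ ∑[ x ∈ xs ] ∑ (f x) φ
∑-concatMap f []       φ = refl
∑-concatMap f (x ∷ xs) φ =
  trans (∑-++ (f x) (concatMap f xs) φ) (cong (∑ (f x) φ +_) (∑-concatMap f xs φ))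

+-interchange : ∀ a b c d → (a + b) + (c + d) ≡ (a + c) + (b + d)
+-interchange = solve-∀

∑-+ : (xs : List A) (φ ψ : A → ℕ) → ∑[ x ∈ xs ] (φ x + ψ x) ≡ ∑ xs φ + ∑ xs ψ
∑-+ []       φ ψ = refl
∑-+ (x ∷ xs) φ ψ =
  trans (cong (φ x + ψ x +_) (∑-+ xs φ ψ)) (+-interchange (φ x) (ψ x) (∑ xs φ) (∑ xs ψ))

∑-*ˡ : (xs : List A) (c : ℕ) (φ : A → ℕ) → ∑[ x ∈ xs ] (c * φ x) ≡ c * ∑ xs φ
∑-*ˡ []       c φ = sym (*-zeroʳ c)
∑-*ˡ (x ∷ xs) c φ =
  trans (cong (c * φ x +_) (∑-*ˡ xs c φ)) (sym (*-distribˡ-+ c (φ x) (∑ xs φ)))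

∑-*ʳ : (xs : List A) (c : ℕ) (φ : A → ℕ) → ∑[ x ∈ xs ] (φ x * c) ≡ ∑ xs φ * c
∑-*ʳ xs c φ = trans (∑-cong xs (λ x → *-comm (φ x) c)) (trans (∑-*ˡ xs c φ) (*-comm c (∑ xs φ)))

∑-const : (xs : List A) (c : ℕ) → ∑[ _ ∈ xs ] c ≡ length xs * c
∑-const []       c = refl
∑-const (x ∷ xs) c = cong (c +_) (∑-const xs c)

∑-zero : (xs : List A) {φ : A → ℕ} → (∀ {x} → x ∈ xs → φ x ≡ 0) → ∑ xs φ ≡ 0
∑-zero xs h = trans (∑-cong-∈ xs h) (trans (∑-const xs 0) (*-zeroʳ (length xs)))

∑-swap : (xs : List A) (ys : List B) (φ : A → B → ℕ) →
  ∑[ x ∈ xs ] (∑[ y ∈ ys ] φ x y) ≡ ∑[ y ∈ ys ] (∑[ x ∈ xs ] φ x y)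
∑-swap []       ys φ = sym (∑-zero ys (λ _ → refl))
∑-swap (x ∷ xs) ys φ = begin
  ∑ ys (φ x) + ∑ xs (λ x → ∑ ys (φ x))             ≡⟨ cong (∑ ys (φ x) +_) (∑-swap xs ys φ) ⟩
  ∑ ys (φ x) + (∑[ y ∈ ys ] ∑[ x ∈ xs ] φ x y)     ≡⟨ ∑-+ ys (φ x) _ ⟨
  ∑[ y ∈ ys ] (φ x y + (∑[ x ∈ xs ] φ x y))        ∎

∑-↭ : {xs ys : List A} (φ : A → ℕ) → xs ↭ ys → ∑ xs φ ≡ ∑ ys φ
∑-↭ φ p = sum-↭ (Perm.map⁺ φ p)

∑-filter : {P : A → Set} (P? : Decidable P) (xs : List A) (φ : A → ℕ) →
  ∑ (filter P? xs) φ ≡ ∑[ x ∈ xs ] (𝟙 (P? x) * φ x)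
∑-filter P? []       φ = refl
∑-filter P? (x ∷ xs) φ with does (P? x)
... | true  = cong₂ _+_ (sym (*-identityˡ (φ x))) (∑-filter P? xs φ)
... | false = ∑-filter P? xs φ

length-filter-∑ : {P : A → Set} (P? : Decidable P) (xs : List A) →
  length (filter P? xs) ≡ ∑[ x ∈ xs ] 𝟙 (P? x)
length-filter-∑ P? xs = begin
  length (filter P? xs)                ≡⟨ *-identityʳ _ ⟨
  length (filter P? xs) * 1            ≡⟨ ∑-const (filter P? xs) 1 ⟨
  ∑[ _ ∈ filter P? xs ] 1              ≡⟨ ∑-filter P? xs (λ _ → 1) ⟩
  ∑[ x ∈ xs ] (𝟙 (P? x) * 1)           ≡⟨ ∑-cong xs (λ x → *-identityʳ _) ⟩
  ∑[ x ∈ xs ] 𝟙 (P? x)                 ∎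

-- The tool of the double counts: two statements of the form "exactly one", each an instance of this
-- lemma, replace an explicit bijection.
∑-unique : {xs : List A} {x : A} (φ : A → ℕ) → Unique xs → x ∈ xs →
  (∀ {y} → y ∈ xs → y ≢ x → φ y ≡ 0) → ∑ xs φ ≡ φ x
∑-unique {xs = x ∷ xs} φ (x∉ ∷ u) (here refl) h =
  trans (cong (φ x +_) (∑-zero xs (λ y∈ → h (there y∈) (λ { refl → All.lookup x∉ y∈ refl }))))
        (+-identityʳ (φ x))
∑-unique {xs = y ∷ xs} φ (y∉ ∷ u) (there x∈) h =
  cong₂ _+_ (h (here refl) (All.lookup y∉ x∈)) (∑-unique φ u x∈ (h ∘ there))

∈-remove : {x : A} {xs : List A} → x ∈ xs → ∃ λ ys → xs ↭ x ∷ ys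
∈-remove x∈ with ys , zs , refl ← ∈-∃++ x∈ = ys ++ zs , Perm.shift _ ys zs

∈-tail : {x y : A} {ys : List A} → y ≢ x → y ∈ x ∷ ys → y ∈ ys
∈-tail y≢x (here y≡x) = ⊥-elim (y≢x y≡x)
∈-tail y≢x (there p)  = p

-- Pigeonhole for lists: the entries of `xs` are removed from `ys` one by one, and the length bound
-- leaves nothing over.
unique-⊆⇒↭ : {xs ys : List A} → Unique xs → (∀ {x} → x ∈ xs → x ∈ ys) →
  length ys ≤ length xs → xs ↭ ys
unique-⊆⇒↭ {xs = []} {[]}      u s l = ↭-refl
unique-⊆⇒↭ {xs = x ∷ xs} {ys} (x∉ ∷ u) s l with zs , p ← ∈-remove (s (here refl)) =
  ↭-trans (prep x (unique-⊆⇒↭ u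
    (λ y∈ → ∈-tail (λ { refl → All.lookup x∉ y∈ refl }) (Perm.∈-resp-↭ p (s (there y∈))))
    (≤-pred (subst (_≤ suc (length xs)) (Perm.↭-length p) l))))
  (↭-sym p)

injective⇒map-↭ : {xs : List A} (f : A → A) → Unique xs → (∀ x → x ∈ xs) →
  (∀ {x y} → f x ≡ f y → x ≡ y) → map f xs ↭ xs
injective⇒map-↭ {xs = xs} f u c inj =
  unique-⊆⇒↭ (Uniq.map⁺ inj u) (λ {x} _ → c x) (≤-reflexive (sym (length-map f xs)))

∑-reindex : {xs : List A} (f : A → A) → Unique xs → (∀ x → x ∈ xs) →
  (∀ {x y} → f x ≡ f y → x ≡ y) → (φ : A → ℕ) → ∑ xs (φ ∘ f) ≡ ∑ xs φ
∑-reindex {xs = xs} f u c inj φ = trans (sym (∑-map f xs φ)) (∑-↭ φ (injective⇒map-↭ f u c inj))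

∈-allVecs : ∀ {n m} (v : Vec (Fin n) m) → v ∈ allVecs n m
∈-allVecs []      = here refl
∈-allVecs {n} {suc m} (x ∷ v) = go (∈-allFin x)
  where
  go : ∀ {xs} → x ∈ xs → (x ∷ v) ∈ concatMap (λ x → map (x ∷_) (allVecs n m)) xs
  go (here refl) = ∈-++⁺ˡ (∈-map⁺ (x ∷_) (∈-allVecs v))
  go (there {y} p) = ∈-++⁺ʳ (map (y ∷_) (allVecs n m)) (go p)

concatMap-unique : (f : A → List B) {xs : List A} → Unique xs → (∀ {x} → x ∈ xs → Unique (f x)) →
  (∀ {x y z} → x ∈ xs → y ∈ xs → z ∈ f x → z ∈ f y → x ≡ y) → Unique (concatMap f xs)
concatMap-unique f {[]}     u v d = []
concatMap-unique f {x ∷ xs} (x∉ ∷ u) v d =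
  Uniq.++⁺ (v (here refl)) (concatMap-unique f u (v ∘ there) (λ p q → d (there p) (there q)))
    (λ (z∈ , z∈′) → let (y , y∈ , z∈fy) = find (∈-concatMap⁻ f {xs = xs} z∈′) in
       All.lookup x∉ y∈ (d (here refl) (there y∈) z∈ z∈fy))

allVecs-unique : ∀ n m → Unique (allVecs n m)
allVecs-unique n zero    = [] ∷ []
allVecs-unique n (suc m) = concatMap-unique _ (Uniq.allFin⁺ n)
  (λ _ → Uniq.map⁺ VecP.∷-injectiveʳ (allVecs-unique n m))
  (λ _ _ p q → let (_ , _ , e) = ∈-map⁻ _ p ; (_ , _ , e′) = ∈-map⁻ _ q in
     VecP.∷-injectiveˡ (trans (sym e) e′))

∑-allVecs-∷ : ∀ n m (φ : Vec (Fin n) (suc m) → ℕ) →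
  ∑ (allVecs n (suc m)) φ ≡ ∑[ x ∈ allFin n ] (∑[ v ∈ allVecs n m ] φ (x ∷ v))
∑-allVecs-∷ n m φ = trans (∑-concatMap _ (allFin n) φ)
  (∑-cong (allFin n) (λ x → ∑-map (x ∷_) (allVecs n m) φ))

-- Eulerian tours

-- Entries are picked by position, so parallel edges stay distinguishable, as are the points that
-- they come from.
picks : List A → List (A × List A)
picks []       = []
picks (x ∷ xs) = (x , xs) ∷ map (λ (y , ys) → y , x ∷ ys) (picks xs)

∑-picks-∷ : (x : A) (xs : List A) (φ : A × List A → ℕ) →
  ∑ (picks (x ∷ xs)) φ ≡ φ (x , xs) + ∑ (picks xs) (λ (y , ys) → φ (y , x ∷ ys))
∑-picks-∷ x xs φ = cong (φ (x , xs) +_) (∑-map _ (picks xs) φ)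

picks-↭ : {L : List A} {y : A} {L′ : List A} → (y , L′) ∈ picks L → L ↭ y ∷ L′
picks-↭ {L = x ∷ xs} (here refl) = ↭-refl
picks-↭ {L = x ∷ xs} (there p) with _ , p′ , refl ← ∈-map⁻ _ p =
  ↭-trans (prep x (picks-↭ p′)) (swap _ _ ↭-refl)

∑-picks-cong : (L : List A) {φ ψ : A × List A → ℕ} →
  (∀ y L′ → L ↭ y ∷ L′ → φ (y , L′) ≡ ψ (y , L′)) → ∑ (picks L) φ ≡ ∑ (picks L) ψ
∑-picks-cong L h = ∑-cong-∈ (picks L) (λ p → h _ _ (picks-↭ p))

∑-picks-proj₁ : (L : List A) (φ : A → ℕ) → ∑ (picks L) (φ ∘ proj₁) ≡ ∑ L φ
∑-picks-proj₁ []      φ = refl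
∑-picks-proj₁ (x ∷ L) φ =
  trans (∑-picks-∷ x L (φ ∘ proj₁)) (cong (φ x +_) (∑-picks-proj₁ L φ))

∑-picks-map : (f : A → B) (L : List A) (φ : B × List B → ℕ) →
  ∑ (picks (map f L)) φ ≡ ∑ (picks L) (λ (y , L′) → φ (f y , map f L′))
∑-picks-map f []      φ = refl
∑-picks-map f (x ∷ L) φ = begin
  ∑ (picks (map f (x ∷ L))) φ
    ≡⟨ ∑-picks-∷ (f x) (map f L) φ ⟩
  φ (f x , map f L) + ∑ (picks (map f L)) (λ (y , l) → φ (y , f x ∷ l))
    ≡⟨ cong (φ (f x , map f L) +_) (∑-picks-map f L _) ⟩
  φ (f x , map f L) + ∑ (picks L) (λ (y , l) → φ (f y , f x ∷ map f l))
    ≡⟨ ∑-picks-∷ x L _ ⟨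
  ∑ (picks (x ∷ L)) (λ (y , l) → φ (f y , map f l)) ∎

∑-picks-++ : (L M : List A) (φ : A × List A → ℕ) →
  ∑ (picks (L ++ M)) φ ≡
  ∑ (picks L) (λ (y , l) → φ (y , l ++ M)) + ∑ (picks M) (λ (y , m) → φ (y , L ++ m))
∑-picks-++ []      M φ = refl
∑-picks-++ (x ∷ L) M φ = begin
  ∑ (picks (x ∷ L ++ M)) φ
    ≡⟨ ∑-picks-∷ x (L ++ M) φ ⟩
  φ (x , L ++ M) + ∑ (picks (L ++ M)) (λ (y , l) → φ (y , x ∷ l))
    ≡⟨ cong (φ (x , L ++ M) +_) (∑-picks-++ L M _) ⟩
  φ (x , L ++ M) + (∑ (picks L) (λ (y , l) → φ (y , x ∷ l ++ M)) + ∑ (picks M) (λ (y , m) → φ (y , x ∷ L ++ m)))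
    ≡⟨ +-assoc (φ (x , L ++ M)) _ _ ⟨
  φ (x , L ++ M) + ∑ (picks L) (λ (y , l) → φ (y , x ∷ l ++ M)) + ∑ (picks M) (λ (y , m) → φ (y , x ∷ L ++ m))
    ≡⟨ cong (_+ ∑ (picks M) (λ (y , m) → φ (y , x ∷ L ++ m))) (∑-picks-∷ x L _) ⟨
  ∑ (picks (x ∷ L)) (λ (y , l) → φ (y , l ++ M)) + ∑ (picks M) (λ (y , m) → φ (y , x ∷ L ++ m)) ∎

∑-picks-replicate : (r : ℕ) (x : A) (φ : A × List A → ℕ) →
  ∑ (picks (replicate (suc r) x)) φ ≡ suc r * φ (x , replicate r x)
∑-picks-replicate zero    x φ = refl
∑-picks-replicate (suc r) x φ = trans (∑-picks-∷ x (replicate (suc r) x) φ)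
  (cong (φ (x , replicate (suc r) x) +_) (∑-picks-replicate r x _))

∑-picks-↭ : {L M : List A} (φ : A × List A → ℕ) → (∀ y {l m} → l ↭ m → φ (y , l) ≡ φ (y , m)) →
  L ↭ M → ∑ (picks L) φ ≡ ∑ (picks M) φ
∑-picks-↭ φ h ↭.refl = refl
∑-picks-↭ {L = x ∷ L} {M = x ∷ M} φ h (prep x p) = begin
  ∑ (picks (x ∷ L)) φ                                   ≡⟨ ∑-picks-∷ x L φ ⟩
  φ (x , L) + ∑ (picks L) (λ (y , l) → φ (y , x ∷ l))   ≡⟨ cong₂ _+_ (h x p) (∑-picks-↭ _ (λ y r → h y (prep x r)) p) ⟩
  φ (x , M) + ∑ (picks M) (λ (y , l) → φ (y , x ∷ l))   ≡⟨ ∑-picks-∷ x M φ ⟨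
  ∑ (picks (x ∷ M)) φ                                   ∎
∑-picks-↭ {L = x ∷ y ∷ L} {M = y ∷ x ∷ M} φ h (swap x y p) = begin
  ∑ (picks (x ∷ y ∷ L)) φ
    ≡⟨ expand x y L ⟩
  φ (x , y ∷ L) + (φ (y , x ∷ L) + ∑ (picks L) (λ (z , l) → φ (z , x ∷ y ∷ l)))
    ≡⟨ cong₂ _+_ (h x (prep y p)) (cong₂ _+_ (h y (prep x p))
         (trans (∑-cong (picks L) (λ (z , l) → h z (swap x y ↭-refl)))
            (∑-picks-↭ _ (λ z r → h z (prep y (prep x r))) p))) ⟩
  φ (x , y ∷ M) + (φ (y , x ∷ M) + ∑ (picks M) (λ (z , l) → φ (z , y ∷ x ∷ l)))
    ≡⟨ +-exchange (φ (x , y ∷ M)) (φ (y , x ∷ M)) _ ⟩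
  φ (y , x ∷ M) + (φ (x , y ∷ M) + ∑ (picks M) (λ (z , l) → φ (z , y ∷ x ∷ l)))
    ≡⟨ expand y x M ⟨
  ∑ (picks (y ∷ x ∷ M)) φ ∎
  where
  expand : ∀ x y L → ∑ (picks (x ∷ y ∷ L)) φ ≡
    φ (x , y ∷ L) + (φ (y , x ∷ L) + ∑ (picks L) (λ (z , l) → φ (z , x ∷ y ∷ l)))
  expand x y L = trans (∑-picks-∷ x (y ∷ L) φ) (cong (φ (x , y ∷ L) +_) (∑-picks-∷ y L _))
  +-exchange : ∀ a b c → a + (b + c) ≡ b + (a + c)
  +-exchange = solve-∀
∑-picks-↭ φ h (↭.trans p r) = trans (∑-picks-↭ φ h p) (∑-picks-↭ φ h r)

-- For a walk with one marked edge, the edges used before and after the mark form such a pair.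
splits : List A → List (List A × List A)
splits []       = ([] , []) ∷ []
splits (x ∷ xs) = map (λ (l , r) → x ∷ l , r) (splits xs) ++ map (λ (l , r) → l , x ∷ r) (splits xs)

∑-splits-∷ : (x : A) (xs : List A) (φ : List A × List A → ℕ) →
  ∑ (splits (x ∷ xs)) φ ≡
  ∑ (splits xs) (λ (l , r) → φ (x ∷ l , r)) + ∑ (splits xs) (λ (l , r) → φ (l , x ∷ r))
∑-splits-∷ x xs φ = trans (∑-++ (map _ (splits xs)) (map _ (splits xs)) φ)
  (cong₂ _+_ (∑-map _ (splits xs) φ) (∑-map _ (splits xs) φ))

∑-splits-swap : (L : List A) (φ : List A → List A → ℕ) →
  ∑ (splits L) (λ (l , r) → φ l r) ≡ ∑ (splits L) (λ (l , r) → φ r l)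
∑-splits-swap []      φ = refl
∑-splits-swap (x ∷ L) φ = begin
  ∑ (splits (x ∷ L)) (λ (l , r) → φ l r)
    ≡⟨ ∑-splits-∷ x L _ ⟩
  ∑ (splits L) (λ (l , r) → φ (x ∷ l) r) + ∑ (splits L) (λ (l , r) → φ l (x ∷ r))
    ≡⟨ cong₂ _+_ (∑-splits-swap L (λ l r → φ (x ∷ l) r)) (∑-splits-swap L (λ l r → φ l (x ∷ r))) ⟩
  ∑ (splits L) (λ (l , r) → φ (x ∷ r) l) + ∑ (splits L) (λ (l , r) → φ r (x ∷ l))
    ≡⟨ +-comm (∑ (splits L) (λ (l , r) → φ (x ∷ r) l)) _ ⟩
  ∑ (splits L) (λ (l , r) → φ r (x ∷ l)) + ∑ (splits L) (λ (l , r) → φ (x ∷ r) l)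
    ≡⟨ ∑-splits-∷ x L _ ⟨
  ∑ (splits (x ∷ L)) (λ (l , r) → φ r l) ∎

-- An element of the left part can be singled out before or after the division.
∑-splits-picks : (L : List A) (φ : A → List A → List A → ℕ) →
  ∑ (splits L) (λ (l , r) → ∑ (picks l) (λ (y , l′) → φ y l′ r)) ≡
  ∑ (picks L) (λ (y , L′) → ∑ (splits L′) (λ (l , r) → φ y l r))
∑-splits-picks []      φ = refl
∑-splits-picks (x ∷ L) φ = begin
  ∑ (splits (x ∷ L)) (λ (l , r) → ∑ (picks l) (λ (y , l′) → φ y l′ r))
    ≡⟨ ∑-splits-∷ x L _ ⟩
  ∑ (splits L) (λ (l , r) → ∑ (picks (x ∷ l)) (λ (y , l′) → φ y l′ r))
    + ∑ (splits L) (λ (l , r) → ∑ (picks l) (λ (y , l′) → φ y l′ (x ∷ r)))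
    ≡⟨ cong₂ _+_
         (trans (∑-cong (splits L) (λ (l , r) → ∑-picks-∷ x l (λ (y , l′) → φ y l′ r)))
           (∑-+ (splits L) (λ (l , r) → φ x l r) _))
         (∑-splits-picks L (λ y l r → φ y l (x ∷ r))) ⟩
  (∑ (splits L) (λ (l , r) → φ x l r)
    + ∑ (splits L) (λ (l , r) → ∑ (picks l) (λ (y , l′) → φ y (x ∷ l′) r)))
    + ∑ (picks L) (λ (y , L′) → ∑ (splits L′) (λ (l , r) → φ y l (x ∷ r)))
    ≡⟨ cong (λ z → (∑ (splits L) (λ (l , r) → φ x l r) + z)
          + ∑ (picks L) (λ (y , L′) → ∑ (splits L′) (λ (l , r) → φ y l (x ∷ r))))
         (∑-splits-picks L (λ y l r → φ y (x ∷ l) r)) ⟩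
  (∑ (splits L) (λ (l , r) → φ x l r)
    + ∑ (picks L) (λ (y , L′) → ∑ (splits L′) (λ (l , r) → φ y (x ∷ l) r)))
    + ∑ (picks L) (λ (y , L′) → ∑ (splits L′) (λ (l , r) → φ y l (x ∷ r)))
    ≡⟨ +-assoc (∑ (splits L) (λ (l , r) → φ x l r)) _ _ ⟩
  ∑ (splits L) (λ (l , r) → φ x l r)
    + (∑ (picks L) (λ (y , L′) → ∑ (splits L′) (λ (l , r) → φ y (x ∷ l) r))
    + ∑ (picks L) (λ (y , L′) → ∑ (splits L′) (λ (l , r) → φ y l (x ∷ r))))
    ≡⟨ cong (∑ (splits L) (λ (l , r) → φ x l r) +_) (∑-+ (picks L) _ _) ⟨
  ∑ (splits L) (λ (l , r) → φ x l r)
    + ∑ (picks L) (λ (y , L′) → ∑ (splits L′) (λ (l , r) → φ y (x ∷ l) r)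
                              + ∑ (splits L′) (λ (l , r) → φ y l (x ∷ r)))
    ≡⟨ cong (∑ (splits L) (λ (l , r) → φ x l r) +_)
         (∑-cong (picks L) (λ (y , L′) → ∑-splits-∷ x L′ (λ (l , r) → φ y l r))) ⟨
  ∑ (splits L) (λ (l , r) → φ x l r)
    + ∑ (picks L) (λ (y , L′) → ∑ (splits (x ∷ L′)) (λ (l , r) → φ y l r))
    ≡⟨ ∑-picks-∷ x L _ ⟨
  ∑ (picks (x ∷ L)) (λ (y , L′) → ∑ (splits L′) (λ (l , r) → φ y l r)) ∎

nil? : List A → ℕ
nil? []      = 1
nil? (_ ∷ _) = 0

∑-splits-nil : (L : List A) (φ : List A → ℕ) → ∑ (splits L) (λ (l , r) → nil? l * φ r) ≡ φ L
∑-splits-nil []      φ = trans (+-identityʳ _) (+-identityʳ _)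
∑-splits-nil (x ∷ L) φ = trans (∑-splits-∷ x L _)
  (cong₂ _+_ (∑-zero (splits L) (λ _ → refl)) (∑-splits-nil L (φ ∘ (x ∷_))))

-- A directed edge is the pair of its tail and its head.
Edge : ℕ → Set
Edge q = Fin q × Fin q

-- The fuel `k` stands for the length of `L`, which drops with each pick, though not structurally.
walksₖ : ℕ → Fin q → Fin q → List (Edge q) → ℕ
walksₖ zero    s t L = 𝟙 (s ≟ t)
walksₖ (suc k) s t L = ∑ (picks L) (λ (y , L′) → 𝟙 (s ≟ proj₁ y) * walksₖ k (proj₂ y) t L′)

walks : Fin q → Fin q → List (Edge q) → ℕ
walks s t L = walksₖ (length L) s t L

-- The number of cyclic orders of the edges in which each head is the next tail;
-- the value at [] is junk.
tours : List (Edge q) → ℕ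
tours []            = 0
tours ((a , b) ∷ L) = walks b a L

walks-step : (s t : Fin q) (x : Edge q) (L : List (Edge q)) →
  walks s t (x ∷ L) ≡ ∑ (picks (x ∷ L)) (λ (y , L′) → 𝟙 (s ≟ proj₁ y) * walks (proj₂ y) t L′)
walks-step s t x L = ∑-picks-cong (x ∷ L) (λ y L′ p →
  cong (λ k → 𝟙 (s ≟ proj₁ y) * walksₖ k (proj₂ y) t L′) (suc-injective (Perm.↭-length p)))

-- One recursion for empty and nonempty lists, as needed for the part of a walk before a marked
-- edge, which may be empty.
walks-nil? : (s t : Fin q) (L : List (Edge q)) →
  walks s t L ≡ nil? L * 𝟙 (s ≟ t) + ∑ (picks L) (λ (y , L′) → 𝟙 (s ≟ proj₁ y) * walks (proj₂ y) t L′)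
walks-nil? s t []      = sym (trans (+-identityʳ _) (+-identityʳ _))
walks-nil? s t (x ∷ L) = walks-step s t x L

walks-↭ : (s t : Fin q) {L M : List (Edge q)} → L ↭ M → walks s t L ≡ walks s t M
walks-↭ s t {L} {M} p = trans (go (length L) s p) (cong (λ k → walksₖ k s t M) (Perm.↭-length p))
  where
  go : ∀ k s {L M} → L ↭ M → walksₖ k s t L ≡ walksₖ k s t M
  go zero    s p = refl
  go (suc k) s p = ∑-picks-↭ _ (λ y r → cong (𝟙 (s ≟ proj₁ y) *_) (go k (proj₂ y) r)) p

-- The walk is cut at `e`. Its first edge is either `e` itself, which leaves the left part empty, or
-- an edge of the left part, which `∑-splits-picks` moves in front of the division.
walks-through : (s t : Fin q) (e : Edge q) (L : List (Edge q)) →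
  walks s t (e ∷ L) ≡ ∑ (splits L) (λ (l , r) → walks s (proj₁ e) l * walks (proj₂ e) t r)
walks-through {q} s t e@(a , b) L = go (length L) s L ≤-refl
  where
  go : ∀ k s L → length L ≤ k →
    walks s t (e ∷ L) ≡ ∑ (splits L) (λ (l , r) → walks s a l * walks b t r)
  rest : ∀ k s L → length L ≤ k →
    ∑ (picks L) (λ (y , L′) → 𝟙 (s ≟ proj₁ y) * walks (proj₂ y) t (e ∷ L′)) ≡
    ∑ (splits L) (λ (l , r) → ∑ (picks l) (λ (y , l′) → 𝟙 (s ≟ proj₁ y) * walks (proj₂ y) a l′ * walks b t r))

  go k s L L≤k = begin
    walks s t (e ∷ L)
      ≡⟨ walks-step s t e L ⟩
    ∑ (picks (e ∷ L)) (λ (y , L′) → 𝟙 (s ≟ proj₁ y) * walks (proj₂ y) t L′)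
      ≡⟨ ∑-picks-∷ e L _ ⟩
    𝟙 (s ≟ a) * walks b t L + ∑ (picks L) (λ (y , L′) → 𝟙 (s ≟ proj₁ y) * walks (proj₂ y) t (e ∷ L′))
      ≡⟨ cong₂ _+_ (sym (∑-splits-nil L (λ r → 𝟙 (s ≟ a) * walks b t r))) (rest k s L L≤k) ⟩
    ∑ (splits L) (λ (l , r) → nil? l * (𝟙 (s ≟ a) * walks b t r))
      + ∑ (splits L) (λ (l , r) → ∑ (picks l) (λ (y , l′) → 𝟙 (s ≟ proj₁ y) * walks (proj₂ y) a l′ * walks b t r))
      ≡⟨ ∑-+ (splits L) _ _ ⟨
    ∑ (splits L) (λ (l , r) → nil? l * (𝟙 (s ≟ a) * walks b t r)
      + ∑ (picks l) (λ (y , l′) → 𝟙 (s ≟ proj₁ y) * walks (proj₂ y) a l′ * walks b t r))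
      ≡⟨ ∑-cong (splits L) (λ (l , r) → begin
           nil? l * (𝟙 (s ≟ a) * walks b t r)
             + ∑ (picks l) (λ (y , l′) → 𝟙 (s ≟ proj₁ y) * walks (proj₂ y) a l′ * walks b t r)
             ≡⟨ cong₂ _+_ (sym (*-assoc (nil? l) _ _)) (∑-*ʳ (picks l) (walks b t r) _) ⟩
           nil? l * 𝟙 (s ≟ a) * walks b t r
             + ∑ (picks l) (λ (y , l′) → 𝟙 (s ≟ proj₁ y) * walks (proj₂ y) a l′) * walks b t r
             ≡⟨ *-distribʳ-+ (walks b t r) (nil? l * 𝟙 (s ≟ a)) _ ⟨
           (nil? l * 𝟙 (s ≟ a) + ∑ (picks l) (λ (y , l′) → 𝟙 (s ≟ proj₁ y) * walks (proj₂ y) a l′)) * walks b t r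
             ≡⟨ cong (_* walks b t r) (walks-nil? s a l) ⟨
           walks s a l * walks b t r ∎) ⟩
    ∑ (splits L) (λ (l , r) → walks s a l * walks b t r) ∎

  rest k       s []         _   = refl
  rest (suc k) s L@(_ ∷ _)  L≤k = begin
    ∑ (picks L) (λ (y , L′) → 𝟙 (s ≟ proj₁ y) * walks (proj₂ y) t (e ∷ L′))
      ≡⟨ ∑-picks-cong L (λ y L′ p → begin
           𝟙 (s ≟ proj₁ y) * walks (proj₂ y) t (e ∷ L′)
             ≡⟨ cong (𝟙 (s ≟ proj₁ y) *_) (go k (proj₂ y) L′ (≤-pred (subst (_≤ suc k) (Perm.↭-length p) L≤k))) ⟩
           𝟙 (s ≟ proj₁ y) * ∑ (splits L′) (λ (l , r) → walks (proj₂ y) a l * walks b t r)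
             ≡⟨ ∑-*ˡ (splits L′) (𝟙 (s ≟ proj₁ y)) _ ⟨
           ∑ (splits L′) (λ (l , r) → 𝟙 (s ≟ proj₁ y) * (walks (proj₂ y) a l * walks b t r))
             ≡⟨ ∑-cong (splits L′) (λ (l , r) → *-assoc (𝟙 (s ≟ proj₁ y)) _ _) ⟨
           ∑ (splits L′) (λ (l , r) → 𝟙 (s ≟ proj₁ y) * walks (proj₂ y) a l * walks b t r) ∎) ⟩
    ∑ (picks L) (λ (y , L′) → ∑ (splits L′) (λ (l , r) → 𝟙 (s ≟ proj₁ y) * walks (proj₂ y) a l * walks b t r))
      ≡⟨ ∑-splits-picks L (λ y l r → 𝟙 (s ≟ proj₁ y) * walks (proj₂ y) a l * walks b t r) ⟨
    ∑ (splits L) (λ (l , r) → ∑ (picks l) (λ (y , l′) → 𝟙 (s ≟ proj₁ y) * walks (proj₂ y) a l′ * walks b t r)) ∎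

-- Cutting a tour at `e` and `f` leaves two walks that share out the edges of `L`, a description
-- symmetric in `e` and `f`. This makes `tours` independent of the edge at which the cyclic order is
-- opened.
tours-swap : (e f : Edge q) (L : List (Edge q)) → tours (e ∷ f ∷ L) ≡ tours (f ∷ e ∷ L)
tours-swap e@(a , b) f@(c , d) L = begin
  walks b a (f ∷ L)                                          ≡⟨ walks-through b a f L ⟩
  ∑ (splits L) (λ (l , r) → walks b c l * walks d a r)       ≡⟨ ∑-splits-swap L (λ l r → walks b c l * walks d a r) ⟩
  ∑ (splits L) (λ (l , r) → walks b c r * walks d a l)       ≡⟨ ∑-cong (splits L) (λ (l , r) → *-comm (walks b c r) (walks d a l)) ⟩
  ∑ (splits L) (λ (l , r) → walks d a l * walks b c r)       ≡⟨ walks-through d c e L ⟨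
  walks d c (e ∷ L)                                          ∎

tours-↭ : {L M : List (Edge q)} → L ↭ M → tours L ≡ tours M
tours-↭ ↭.refl       = refl
tours-↭ (prep x p)   = walks-↭ _ _ p
tours-↭ {M = y ∷ x ∷ M} (swap x y p) = trans (walks-↭ (proj₂ x) (proj₁ x) (prep y p)) (tours-swap x y M)
tours-↭ (↭.trans p r) = trans (tours-↭ p) (tours-↭ r)

-- The edge that follows (a , b) is fused with it. Each use shortens the list by one edge, which
-- drives the inductions on tours below.
tours-merge : (a b : Fin q) (x : Edge q) (L : List (Edge q)) →
  tours ((a , b) ∷ x ∷ L) ≡
  ∑ (picks (x ∷ L)) (λ (y , L′) → 𝟙 (b ≟ proj₁ y) * tours ((a , proj₂ y) ∷ L′))
tours-merge a b x L = walks-step b a x L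

mapEdge : ∀ {p} → (Fin q → Fin p) → Edge q → Edge p
mapEdge ι (a , b) = ι a , ι b

tours-relabel : ∀ {p} (ι : Fin q → Fin p) → (∀ {x y} → ι x ≡ ι y → x ≡ y) →
  (L : List (Edge q)) → tours (map (mapEdge ι) L) ≡ tours L
tours-relabel ι inj []            = refl
tours-relabel {q} ι inj ((a , b) ∷ L) =
  trans (cong (λ k → walksₖ k (ι b) (ι a) (map (mapEdge ι) L)) (length-map (mapEdge ι) L)) (go (length L) b L)
  where
  ≟-relabel : ∀ x y → 𝟙 (ι x ≟ ι y) ≡ 𝟙 (x ≟ y)
  ≟-relabel x y = 𝟙-cong (ι x ≟ ι y) (x ≟ y) inj (cong ι)
  go : ∀ k b L → walksₖ k (ι b) (ι a) (map (mapEdge ι) L) ≡ walksₖ k b a L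
  go zero    b L = ≟-relabel b a
  go (suc k) b L = trans (∑-picks-map (mapEdge ι) L _)
    (∑-cong (picks L) (λ (y , L′) → cong₂ _*_ (≟-relabel b (proj₁ y)) (go k (proj₂ y) L′)))

outdeg indeg : Fin q → List (Edge q) → ℕ
outdeg u L = ∑[ e ∈ L ] 𝟙 (u ≟ proj₁ e)
indeg  u L = ∑[ e ∈ L ] 𝟙 (u ≟ proj₂ e)

-- Fusing the loop with its successor gives that successor back, so the loop can be inserted in
-- front of each edge that leaves `u`.
tours-loop : (u : Fin q) (L : List (Edge q)) → L ≢ [] → tours ((u , u) ∷ L) ≡ outdeg u L * tours L
tours-loop u []      L≢[] = ⊥-elim (L≢[] refl)
tours-loop u (x ∷ L) _    = begin
  tours ((u , u) ∷ x ∷ L)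
    ≡⟨ tours-merge u u x L ⟩
  ∑ (picks (x ∷ L)) (λ (y , L′) → 𝟙 (u ≟ proj₁ y) * tours ((u , proj₂ y) ∷ L′))
    ≡⟨ ∑-picks-cong (x ∷ L) (λ y L′ p → 𝟙-guard (u ≟ proj₁ y)
         (λ { refl → tours-↭ (↭-sym p) })) ⟩
  ∑ (picks (x ∷ L)) (λ (y , L′) → 𝟙 (u ≟ proj₁ y) * tours (x ∷ L))
    ≡⟨ ∑-picks-proj₁ (x ∷ L) (λ y → 𝟙 (u ≟ proj₁ y) * tours (x ∷ L)) ⟩
  ∑[ y ∈ x ∷ L ] (𝟙 (u ≟ proj₁ y) * tours (x ∷ L))
    ≡⟨ ∑-*ʳ (x ∷ L) (tours (x ∷ L)) (λ y → 𝟙 (u ≟ proj₁ y)) ⟩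
  outdeg u (x ∷ L) * tours (x ∷ L) ∎

outdeg-replicate : (u : Fin q) (n : ℕ) (e : Edge q) → outdeg u (replicate n e) ≡ n * 𝟙 (u ≟ proj₁ e)
outdeg-replicate u zero    e = refl
outdeg-replicate u (suc n) e = cong (𝟙 (u ≟ proj₁ e) +_) (outdeg-replicate u n e)

𝟙-refl : (u : Fin q) → 𝟙 (u ≟ u) ≡ 1
𝟙-refl u = 𝟙-yes (u ≟ u) refl

tours-loops : (u : Fin q) (n : ℕ) → tours (replicate (suc n) (u , u)) ≡ n !
tours-loops u zero    = 𝟙-refl u
tours-loops u (suc n) = trans (tours-loop u (replicate (suc n) (u , u)) (λ ()))
  (cong₂ _*_ (trans (outdeg-replicate u (suc n) (u , u)) (trans (cong (suc n *_) (𝟙-refl u)) (*-identityʳ (suc n))))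
             (tours-loops u n))

-- Each loop raises the out-degree by one, so the factors contributed are d + 1, ..., d + n.
tours-add-loops : (u : Fin q) (n d : ℕ) (L : List (Edge q)) → L ≢ [] → outdeg u L ≡ suc d →
  d ! * tours (replicate n (u , u) ++ L) ≡ (n + d) ! * tours L
tours-add-loops u zero    d L L≢[] h = refl
tours-add-loops u (suc n) d L L≢[] h = begin
  d ! * tours ((u , u) ∷ replicate n (u , u) ++ L)
    ≡⟨ cong (d ! *_) (tours-loop u (replicate n (u , u) ++ L) (L≢[] ∘ ++-conicalʳ (replicate n (u , u)) L)) ⟩
  d ! * (outdeg u (replicate n (u , u) ++ L) * tours (replicate n (u , u) ++ L))
    ≡⟨ cong (λ z → d ! * (z * tours (replicate n (u , u) ++ L))) deg ⟩
  d ! * (suc (n + d) * tours (replicate n (u , u) ++ L))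
    ≡⟨ rearrange (d !) (suc (n + d)) _ ⟩
  suc (n + d) * (d ! * tours (replicate n (u , u) ++ L))
    ≡⟨ cong (suc (n + d) *_) (tours-add-loops u n d L L≢[] h) ⟩
  suc (n + d) * ((n + d) ! * tours L)
    ≡⟨ *-assoc (suc (n + d)) ((n + d) !) (tours L) ⟨
  (suc n + d) ! * tours L ∎
  where
  rearrange : ∀ a b c → a * (b * c) ≡ b * (a * c)
  rearrange = solve-∀
  deg : outdeg u (replicate n (u , u) ++ L) ≡ suc (n + d)
  deg = begin
    outdeg u (replicate n (u , u) ++ L)            ≡⟨ ∑-++ (replicate n (u , u)) L _ ⟩
    outdeg u (replicate n (u , u)) + outdeg u L    ≡⟨ cong₂ _+_ (outdeg-replicate u n (u , u)) h ⟩
    n * 𝟙 (u ≟ u) + suc d                          ≡⟨ cong (λ z → n * z + suc d) (𝟙-refl u) ⟩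
    n * 1 + suc d                                  ≡⟨ cong (_+ suc d) (*-identityʳ n) ⟩
    n + suc d                                      ≡⟨ +-suc n d ⟩
    suc (n + d)                                    ∎

*-factorial-cancelˡ : ∀ r {a b} → r ! * a ≡ r ! * b → a ≡ b
*-factorial-cancelˡ r {a} {b} = *-cancelˡ-≡ a b (r !) {{r !≢0}}

outdeg-↭ indeg-↭ : (u : Fin q) {L M : List (Edge q)} → L ↭ M → _
outdeg-↭ u {L} {M} p = ∑-↭ {xs = L} {M} (λ e → 𝟙 (u ≟ proj₁ e)) p
indeg-↭  u {L} {M} p = ∑-↭ {xs = L} {M} (λ e → 𝟙 (u ≟ proj₂ e)) p

-- Identifying two vertices of a digraph

contract : Fin q → Fin q → Fin q → Fin q
contract u v x = if does (x ≟ v) then u else x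

module Contraction {q : ℕ} (u v : Fin q) (u≢v : u ≢ v) where

  uu uv vu vv : Edge q
  uu = u , u
  uv = u , v
  vu = v , u
  vv = v , v

  u≟u : 𝟙 (u ≟ u) ≡ 1
  u≟u = 𝟙-refl u
  v≟v : 𝟙 (v ≟ v) ≡ 1
  v≟v = 𝟙-refl v
  u≟v : 𝟙 (u ≟ v) ≡ 0
  u≟v = 𝟙-no (u ≟ v) u≢v
  v≟u : 𝟙 (v ≟ u) ≡ 0
  v≟u = 𝟙-no (v ≟ u) (u≢v ∘ sym)

  alternating : ℕ → ℕ → List (Edge q)
  alternating r r′ = replicate r uv ++ replicate r′ vu

  twoVertex : ℕ → ℕ → ℕ → ℕ → List (Edge q)
  twoVertex p s r r′ = replicate p uu ++ replicate s vv ++ alternating r r′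

  ∑-twoVertex : ∀ p s r r′ (φ : Edge q → ℕ) →
    ∑ (twoVertex p s r r′) φ ≡ p * φ uu + (s * φ vv + (r * φ uv + r′ * φ vu))
  ∑-twoVertex p s r r′ φ =
    trans (∑-++ (replicate p uu) _ φ) (cong₂ _+_ (rep p uu)
      (trans (∑-++ (replicate s vv) _ φ) (cong₂ _+_ (rep s vv)
        (trans (∑-++ (replicate r uv) _ φ) (cong₂ _+_ (rep r uv) (rep r′ vu))))))
    where
    rep : ∀ n e → ∑ (replicate n e) φ ≡ n * φ e
    rep zero    e = refl
    rep (suc n) e = cong (φ e +_) (rep n e)

  outdeg-u : ∀ p s r r′ → outdeg u (twoVertex p s r r′) ≡ p + r
  outdeg-u p s r r′ = trans (∑-twoVertex p s r r′ _)
    (trans (cong₂ (λ a b → p * a + (s * b + (r * a + r′ * b))) u≟u u≟v) (eq p s r r′))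
    where
    eq : ∀ p s r r′ → p * 1 + (s * 0 + (r * 1 + r′ * 0)) ≡ p + r
    eq = solve-∀

  outdeg-v : ∀ p s r r′ → outdeg v (twoVertex p s r r′) ≡ s + r′
  outdeg-v p s r r′ = trans (∑-twoVertex p s r r′ _)
    (trans (cong₂ (λ a b → p * a + (s * b + (r * a + r′ * b))) v≟u v≟v) (eq p s r r′))
    where
    eq : ∀ p s r r′ → p * 0 + (s * 1 + (r * 0 + r′ * 1)) ≡ s + r′
    eq = solve-∀

  indeg-u : ∀ p s r r′ → indeg u (twoVertex p s r r′) ≡ p + r′
  indeg-u p s r r′ = trans (∑-twoVertex p s r r′ _)
    (trans (cong₂ (λ a b → p * a + (s * b + (r * b + r′ * a))) u≟u u≟v) (eq p s r r′))
    where
    eq : ∀ p s r r′ → p * 1 + (s * 0 + (r * 0 + r′ * 1)) ≡ p + r′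
    eq = solve-∀

  -- In the induction step the leading `uv` is fused with one of the 2 + r edges `vu`. The result is
  -- a loop at `u`, worth the out-degree r + 1 of the remaining digraph.
  tours-alternating : ∀ r → tours (alternating (suc r) (suc r)) ≡ suc r ! * r !
  tours-alternating zero = begin
    𝟙 (v ≟ v) * 𝟙 (u ≟ u) + 0   ≡⟨ cong₂ (λ a b → a * b + 0) v≟v u≟u ⟩
    1                           ∎
  tours-alternating (suc r) = begin
    tours (uv ∷ M ++ replicate (2 + r) vu)
      ≡⟨ tours-merge u v uv (replicate r uv ++ replicate (2 + r) vu) ⟩
    ∑ (picks (M ++ replicate (2 + r) vu)) φ
      ≡⟨ ∑-picks-++ M (replicate (2 + r) vu) φ ⟩
    ∑ (picks M) (λ (y , l) → φ (y , l ++ replicate (2 + r) vu))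
      + ∑ (picks (replicate (2 + r) vu)) (λ (y , l) → φ (y , M ++ l))
      ≡⟨ cong₂ _+_ (∑-picks-replicate r uv (λ (y , l) → φ (y , l ++ replicate (2 + r) vu)))
                   (∑-picks-replicate (suc r) vu (λ (y , l) → φ (y , M ++ l))) ⟩
    suc r * (𝟙 (v ≟ u) * tours (uv ∷ replicate r uv ++ replicate (2 + r) vu))
      + (2 + r) * (𝟙 (v ≟ v) * tours (uu ∷ alternating (suc r) (suc r)))
      ≡⟨ cong₂ (λ a b → suc r * (a * tours (uv ∷ replicate r uv ++ replicate (2 + r) vu))
             + (2 + r) * (b * tours (uu ∷ alternating (suc r) (suc r)))) v≟u v≟v ⟩
    suc r * 0 + (2 + r) * (1 * tours (uu ∷ alternating (suc r) (suc r)))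
      ≡⟨ cong₂ _+_ (*-zeroʳ (suc r)) (cong ((2 + r) *_) (*-identityˡ (tours (uu ∷ alternating (suc r) (suc r))))) ⟩
    (2 + r) * tours (uu ∷ alternating (suc r) (suc r))
      ≡⟨ cong ((2 + r) *_) (tours-loop u (alternating (suc r) (suc r)) (λ ())) ⟩
    (2 + r) * (outdeg u (alternating (suc r) (suc r)) * tours (alternating (suc r) (suc r)))
      ≡⟨ cong₂ (λ a b → (2 + r) * (a * b)) (outdeg-u 0 0 (suc r) (suc r)) (tours-alternating r) ⟩
    (2 + r) * (suc r * (suc r ! * r !))
      ≡⟨ rearrange (2 + r) (suc r) (suc r !) (r !) ⟩
    (2 + r) ! * suc r ! ∎
    where
    M = replicate (suc r) uv
    φ : Edge q × List (Edge q) → ℕ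
    φ (y , L′) = 𝟙 (v ≟ proj₁ y) * tours ((u , proj₂ y) ∷ L′)
    rearrange : ∀ a b c d → a * (b * (c * d)) ≡ (a * c) * (b * d)
    rearrange = solve-∀

  -- In the terms of the BEST theorem there are r + 1 spanning trees, and the degrees are p + r + 1
  -- and s + r + 1. The loops at `u` and at `v` are added to the alternating digraph in turn, each
  -- time at the price of a denominator r !.
  tours-twoVertex : ∀ p s r → tours (twoVertex p s (suc r) (suc r)) ≡ suc r * ((p + r) ! * (s + r) !)
  tours-twoVertex p s r = *-factorial-cancelˡ r (*-factorial-cancelˡ r (begin
    r ! * (r ! * tours (twoVertex p s (suc r) (suc r)))
      ≡⟨ cong (r ! *_) (tours-add-loops u p r Y Y≢[] (outdeg-u 0 s (suc r) (suc r))) ⟩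
    r ! * ((p + r) ! * tours Y)
      ≡⟨ rearrange₁ (r !) ((p + r) !) (tours Y) ⟩
    (p + r) ! * (r ! * tours Y)
      ≡⟨ cong ((p + r) ! *_) (tours-add-loops v s r X (λ ()) (outdeg-v 0 0 (suc r) (suc r))) ⟩
    (p + r) ! * ((s + r) ! * tours X)
      ≡⟨ cong (λ z → (p + r) ! * ((s + r) ! * z)) (tours-alternating r) ⟩
    (p + r) ! * ((s + r) ! * (suc r * r ! * r !))
      ≡⟨ rearrange₂ ((p + r) !) ((s + r) !) (suc r) (r !) ⟩
    r ! * (r ! * (suc r * ((p + r) ! * (s + r) !))) ∎))
    where
    X = alternating (suc r) (suc r)
    Y = replicate s vv ++ X
    Y≢[] : Y ≢ []
    Y≢[] e with () ← ++-conicalʳ (replicate s vv) X e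
    rearrange₁ : ∀ a b c → a * (b * c) ≡ b * (a * c)
    rearrange₁ = solve-∀
    rearrange₂ : ∀ a b c d → a * (b * (c * d * d)) ≡ d * (d * (c * (a * b)))
    rearrange₂ = solve-∀

  -- The case of no edges between the two vertices: a loop at `v` joins a digraph that no edge
  -- leaves from `v`, so its factor is 0.
  tours-twoVertex-disconnected : ∀ p s → tours (twoVertex (suc p) (suc s) 0 0) ≡ 0
  tours-twoVertex-disconnected p s = begin
    tours (twoVertex (suc p) (suc s) 0 0)
      ≡⟨ tours-↭ (Perm.++-comm (replicate (suc p) uu) (replicate (suc s) vv ++ [])) ⟩
    tours ((replicate (suc s) vv ++ []) ++ replicate (suc p) uu)
      ≡⟨ cong (λ z → tours (z ++ replicate (suc p) uu)) (++-identityʳ (replicate (suc s) vv)) ⟩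
    tours (vv ∷ replicate s vv ++ replicate (suc p) uu)
      ≡⟨ tours-↭ (prep vv (Perm.++-comm (replicate s vv) (replicate (suc p) uu))) ⟩
    tours (vv ∷ replicate (suc p) uu ++ replicate s vv)
      ≡⟨ tours-↭ (Perm.++-comm (vv ∷ replicate (suc p) uu) (replicate s vv)) ⟩
    tours (replicate s vv ++ vv ∷ replicate (suc p) uu)
      ≡⟨ go s ⟩
    0 ∎
    where
    step : tours (vv ∷ replicate (suc p) uu) ≡ 0
    step = trans (tours-loop v (replicate (suc p) uu) (λ ())) (cong (_* tours (replicate (suc p) uu))
      (trans (outdeg-replicate v (suc p) uu) (trans (cong (suc p *_) v≟u) (*-zeroʳ (suc p)))))
    go : ∀ s → tours (replicate s vv ++ vv ∷ replicate (suc p) uu) ≡ 0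
    go zero    = step
    go (suc s) = trans (tours-loop v (replicate s vv ++ vv ∷ replicate (suc p) uu)
        (λ e → case-[] (++-conicalʳ (replicate s vv) _ e)))
      (trans (cong (outdeg v (replicate s vv ++ vv ∷ replicate (suc p) uu) *_) (go s)) (*-zeroʳ (outdeg v (replicate s vv ++ vv ∷ replicate (suc p) uu))))
      where
      case-[] : {x : Edge q} {xs : List (Edge q)} → x ∷ xs ≢ []
      case-[] ()

  IsUV : Fin q → Set
  IsUV x = x ≡ u ⊎ x ≡ v

  classify : ∀ L → All (λ e → IsUV (proj₁ e) × IsUV (proj₂ e)) L →
    ∃ λ p → ∃ λ s → ∃ λ r → ∃ λ r′ → L ↭ twoVertex p s r r′
  classify []      []        = 0 , 0 , 0 , 0 , ↭-refl
  classify (e ∷ L) (h ∷ hs) with p , s , r , r′ , π ← classify L hs with h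
  ... | inj₁ refl , inj₁ refl = suc p , s , r , r′ , prep uu π
  ... | inj₂ refl , inj₂ refl = p , suc s , r , r′ ,
    ↭-trans (prep vv π) (↭-sym (Perm.shift vv (replicate p uu) _))
  ... | inj₁ refl , inj₂ refl = p , s , suc r , r′ ,
    ↭-trans (prep uv π) (↭-trans (↭-sym (Perm.shift uv (replicate p uu) _))
      (Perm.++⁺ˡ (replicate p uu) (↭-sym (Perm.shift uv (replicate s vv) _))))
  ... | inj₂ refl , inj₁ refl = p , s , r , suc r′ ,
    ↭-trans (prep vu π) (↭-trans (↭-sym (Perm.shift vu (replicate p uu) _))
      (Perm.++⁺ˡ (replicate p uu) (↭-trans (↭-sym (Perm.shift vu (replicate s vv) _))
        (Perm.++⁺ˡ (replicate s vv) (↭-sym (Perm.shift vu (replicate r uv) _))))))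

  isUV? : ∀ x → Dec (IsUV x)
  isUV? x = (x ≟ u) ⊎-dec (x ≟ v)

  𝟙-isUV : ∀ {x} → IsUV x → 𝟙 (u ≟ x) + 𝟙 (v ≟ x) ≡ 1
  𝟙-isUV (inj₁ refl) = cong₂ _+_ u≟u v≟u
  𝟙-isUV (inj₂ refl) = cong₂ _+_ u≟v v≟v

  𝟙-notUV : ∀ {x} → ¬ IsUV x → 𝟙 (u ≟ x) + 𝟙 (v ≟ x) ≡ 0
  𝟙-notUV {x} h = cong₂ _+_ (𝟙-no (u ≟ x) (h ∘ inj₁ ∘ sym)) (𝟙-no (v ≟ x) (h ∘ inj₂ ∘ sym))

  private
    count : (Edge q → Fin q) → List (Edge q) → ℕ
    count end L = ∑ L (λ e → 𝟙 (u ≟ end e)) + ∑ L (λ e → 𝟙 (v ≟ end e))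

    count-∷ : ∀ end e L → count end (e ∷ L) ≡ (𝟙 (u ≟ end e) + 𝟙 (v ≟ end e)) + count end L
    count-∷ end e L = +-interchange (𝟙 (u ≟ end e)) _ (𝟙 (v ≟ end e)) _

    count-all : ∀ end L → All (IsUV ∘ end) L → count end L ≡ length L
    count-all end []      []       = refl
    count-all end (e ∷ L) (h ∷ hs) = trans (count-∷ end e L) (cong₂ _+_ (𝟙-isUV h) (count-all end L hs))

    count-≤ : ∀ end L → count end L ≤ length L
    count-≤ end []      = z≤n
    count-≤ end (e ∷ L) with isUV? (end e)
    ... | yes h = ≤-trans (≤-reflexive (trans (count-∷ end e L) (cong (_+ count end L) (𝟙-isUV h)))) (s≤s (count-≤ end L))
    ... | no ¬h = ≤-trans (≤-reflexive (trans (count-∷ end e L) (cong (_+ count end L) (𝟙-notUV ¬h)))) (m≤n⇒m≤1+n (count-≤ end L))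

    -- Every edge counts at most once, so a count that reaches the number of edges leaves no end
    -- outside {u, v}.
    count⇒all : ∀ end L → count end L ≡ length L → All (IsUV ∘ end) L
    count⇒all end []      h = []
    count⇒all end (e ∷ L) h with isUV? (end e)
    ... | yes k = k ∷ count⇒all end L (suc-injective
                    (trans (sym (trans (count-∷ end e L) (cong (_+ count end L) (𝟙-isUV k)))) h))
    ... | no ¬k = ⊥-elim (1+n≰n (≤-trans (≤-reflexive (sym
                    (trans (sym (trans (count-∷ end e L) (cong (_+ count end L) (𝟙-notUV ¬k)))) h))) (count-≤ end L)))

  c : Fin q → Fin q
  c = contract u v

  c-uv : ∀ {x} → IsUV x → c x ≡ u
  c-uv (inj₁ refl) with u ≟ v
  ... | yes _ = refl
  ... | no  _ = refl
  c-uv (inj₂ refl) with v ≟ v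
  ... | yes _ = refl
  ... | no ¬p = ⊥-elim (¬p refl)

  c-notUV : ∀ {x} → ¬ IsUV x → c x ≡ x
  c-notUV {x} h with x ≟ v
  ... | yes p = ⊥-elim (h (inj₂ p))
  ... | no _  = refl

  map-contract-loops : ∀ L → All (λ e → IsUV (proj₁ e) × IsUV (proj₂ e)) L →
    map (mapEdge c) L ≡ replicate (length L) uu
  map-contract-loops []      []             = refl
  map-contract-loops (e ∷ L) ((h , k) ∷ hs) =
    cong₂ _∷_ (cong₂ _,_ (c-uv h) (c-uv k)) (map-contract-loops L hs)

  -- Balance at `u` forces equally many edges in the two directions, say r. Two more loops raise the
  -- degrees as much as two opposite edges do, so the two counts are r + 1 and r times the same
  -- product (p + r)! (s + r)!, which is i! j!.
  contraction-base : ∀ L i j → outdeg u L ≡ i → indeg u L ≡ i → outdeg v L ≡ j →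
    All (λ e → IsUV (proj₁ e) × IsUV (proj₂ e)) L →
    tours (uv ∷ vu ∷ L) ≡ tours (uu ∷ vv ∷ L) + i ! * j !
  contraction-base L i j ou iu ov hs with p , s , r , r′ , π ← classify L hs
    with refl ← +-cancelˡ-≡ p r r′ (trans (sym (outdeg-u p s r r′)) (trans (sym (outdeg-↭ u π))
                  (trans ou (trans (sym iu) (trans (indeg-↭ u π) (indeg-u p s r r′))))))
    with refl ← trans (sym ou) (trans (outdeg-↭ u π) (outdeg-u p s r r))
    with refl ← trans (sym ov) (trans (outdeg-↭ v π) (outdeg-v p s r r)) = begin
      tours (uv ∷ vu ∷ L)                     ≡⟨ tours-↭ bridge ⟩
      tours (twoVertex p s (suc r) (suc r))   ≡⟨ tours-twoVertex p s r ⟩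
      (p + r) ! * (s + r) ! + r * ((p + r) ! * (s + r) !)
        ≡⟨ +-comm ((p + r) ! * (s + r) !) _ ⟩
      r * ((p + r) ! * (s + r) !) + (p + r) ! * (s + r) !
        ≡⟨ cong (_+ (p + r) ! * (s + r) !) (trans (tours-↭ loops) (loops-value r)) ⟨
      tours (uu ∷ vv ∷ L) + (p + r) ! * (s + r) ! ∎
    where
    bridge : uv ∷ vu ∷ L ↭ twoVertex p s (suc r) (suc r)
    bridge = ↭-trans (prep uv (↭-trans (prep vu π) (shift₃ vu p s r r)))
      (↭-trans (↭-sym (Perm.shift uv (replicate p uu) _))
        (Perm.++⁺ˡ (replicate p uu) (↭-sym (Perm.shift uv (replicate s vv) _))))
      where
      shift₃ : ∀ e p s r r′ → e ∷ twoVertex p s r r′ ↭ replicate p uu ++ replicate s vv ++ replicate r uv ++ e ∷ replicate r′ vu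
      shift₃ e p s r r′ = ↭-trans (↭-sym (Perm.shift e (replicate p uu) _))
        (Perm.++⁺ˡ (replicate p uu) (↭-trans (↭-sym (Perm.shift e (replicate s vv) _))
          (Perm.++⁺ˡ (replicate s vv) (↭-sym (Perm.shift e (replicate r uv) _)))))
    loops : uu ∷ vv ∷ L ↭ twoVertex (suc p) (suc s) r r
    loops = prep uu (↭-trans (prep vv π) (↭-sym (Perm.shift vv (replicate p uu) _)))
    loops-value : ∀ r → tours (twoVertex (suc p) (suc s) r r) ≡ r * ((p + r) ! * (s + r) !)
    loops-value zero    = tours-twoVertex-disconnected p s
    loops-value (suc r) = trans (tours-twoVertex (suc p) (suc s) r)
      (cong (suc r *_) (cong₂ (λ a b → a ! * b !) (sym (+-suc p r)) (sym (+-suc s r))))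

  -- By the BEST theorem a balanced digraph has τ · Π (deg − 1)! tours, where τ
  -- counts spanning trees, and τ(G + uv) − τ(G) = τ(G / uv).  The proof merges
  -- edges with their successors until only the vertices u and v are left.
  contraction : ∀ L i j → outdeg u L ≡ i → indeg u L ≡ i → outdeg v L ≡ j → indeg v L ≡ j →
    suc (i + j) ! * tours (uv ∷ vu ∷ L) ≡
    suc (i + j) ! * tours (uu ∷ vv ∷ L) + i ! * j ! * tours (uu ∷ uu ∷ map (mapEdge c) L)
  contraction L i j = go (length L) L ≤-refl
    where
    Z = suc (i + j) !
    go : ∀ k L → length L ≤ k → outdeg u L ≡ i → indeg u L ≡ i → outdeg v L ≡ j → indeg v L ≡ j →
      Z * tours (uv ∷ vu ∷ L) ≡ Z * tours (uu ∷ vv ∷ L) + i ! * j ! * tours (uu ∷ uu ∷ map (mapEdge c) L)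
    go k L L≤k ou iu ov iv with All.all? (isUV? ∘ proj₂) L
    ... | yes heads = begin
      Z * tours (uv ∷ vu ∷ L)
        ≡⟨ cong (Z *_) (contraction-base L i j ou iu ov ends) ⟩
      Z * (tours (uu ∷ vv ∷ L) + i ! * j !)
        ≡⟨ *-distribˡ-+ Z (tours (uu ∷ vv ∷ L)) _ ⟩
      Z * tours (uu ∷ vv ∷ L) + Z * (i ! * j !)
        ≡⟨ cong (Z * tours (uu ∷ vv ∷ L) +_) (*-comm Z (i ! * j !)) ⟩
      Z * tours (uu ∷ vv ∷ L) + i ! * j ! * Z
        ≡⟨ cong (λ z → Z * tours (uu ∷ vv ∷ L) + i ! * j ! * z) loops ⟨
      Z * tours (uu ∷ vv ∷ L) + i ! * j ! * tours (uu ∷ uu ∷ map (mapEdge c) L) ∎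
      where
      size : i + j ≡ length L
      size = trans (cong₂ _+_ (sym iu) (sym iv)) (count-all proj₂ L heads)
      -- With all heads in {u, v}, the in-degrees of `u` and `v` add up to the number of edges. By
      -- balance the out-degrees do so too, which confines the tails.
      tails : All (IsUV ∘ proj₁) L
      tails = count⇒all proj₁ L (trans (cong₂ _+_ ou ov) size)
      ends : All (λ e → IsUV (proj₁ e) × IsUV (proj₂ e)) L
      ends = All.zip (tails , heads)
      loops : tours (uu ∷ uu ∷ map (mapEdge c) L) ≡ Z
      loops = trans (cong (λ M → tours (uu ∷ uu ∷ M)) (trans (map-contract-loops L ends) (cong (λ n → replicate n uu) (sym size))))
        (tours-loops u (suc (i + j)))
    -- The fused vertex `b` is neither `u` nor `v`, so fusing keeps the degrees i and j, and
    -- contraction leaves `b` alone. All three tour counts thus expand over the same successors.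
    ... | no ¬heads with (a , b) , e∈ , b∉ ← find (¬All⇒Any¬ (isUV? ∘ proj₂) L ¬heads)
                   with L₁ , π ← ∈-remove e∈ = begin
      Z * tours (uv ∷ vu ∷ L)
        ≡⟨ cong (Z *_) (expand uv vu b≢u b≢v) ⟩
      Z * ∑ (picks L₁) (λ (y , l) → 𝟙 (b ≟ proj₁ y) * tours ((a , proj₂ y) ∷ uv ∷ vu ∷ l))
        ≡⟨ ∑-*ˡ (picks L₁) Z _ ⟨
      ∑ (picks L₁) (λ (y , l) → Z * (𝟙 (b ≟ proj₁ y) * tours ((a , proj₂ y) ∷ uv ∷ vu ∷ l)))
        ≡⟨ ∑-picks-cong L₁ (λ y l ρ → term y l ρ (b ≟ proj₁ y)) ⟩
      ∑ (picks L₁) (λ (y , l) → Z * (𝟙 (b ≟ proj₁ y) * tours ((a , proj₂ y) ∷ uu ∷ vv ∷ l))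
          + i ! * j ! * (𝟙 (b ≟ proj₁ y) * tours (mapEdge c (a , proj₂ y) ∷ uu ∷ uu ∷ map (mapEdge c) l)))
        ≡⟨ ∑-+ (picks L₁) _ _ ⟩
      ∑ (picks L₁) (λ (y , l) → Z * (𝟙 (b ≟ proj₁ y) * tours ((a , proj₂ y) ∷ uu ∷ vv ∷ l)))
        + ∑ (picks L₁) (λ (y , l) → i ! * j ! * (𝟙 (b ≟ proj₁ y) * tours (mapEdge c (a , proj₂ y) ∷ uu ∷ uu ∷ map (mapEdge c) l)))
        ≡⟨ cong₂ _+_ (trans (∑-*ˡ (picks L₁) Z _) (cong (Z *_) (sym (expand uu vv b≢u b≢v))))
                     (trans (∑-*ˡ (picks L₁) (i ! * j !) _) (cong (i ! * j ! *_) (sym contracted))) ⟩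
      Z * tours (uu ∷ vv ∷ L) + i ! * j ! * tours (uu ∷ uu ∷ map (mapEdge c) L) ∎
      where
      b≢u : b ≢ u
      b≢u = b∉ ∘ inj₁
      b≢v : b ≢ v
      b≢v = b∉ ∘ inj₂

      vanish : ∀ (x : Edge q) z → b ≢ proj₁ x → 𝟙 (b ≟ proj₁ x) * z ≡ 0
      vanish x z h = cong (_* z) (𝟙-no (b ≟ proj₁ x) h)

      front : ∀ {M M′ : List (Edge q)} x y e → M ↭ e ∷ M′ → x ∷ y ∷ M ↭ e ∷ x ∷ y ∷ M′
      front x y e ρ = ↭-trans (prep x (↭-trans (prep y ρ) (swap y e ↭-refl))) (swap x e ↭-refl)

      back : ∀ (x y e : Edge q) l → e ∷ x ∷ y ∷ l ↭ x ∷ y ∷ e ∷ l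
      back x y e l = ↭-sym (front x y e ↭-refl)

      -- Neither `x` nor `y` leaves `b`, so the successor of (a , b) lies in `M`.
      merge₂ : ∀ x y a M → b ≢ proj₁ x → b ≢ proj₁ y → tours ((a , b) ∷ x ∷ y ∷ M) ≡
        ∑ (picks M) (λ (z , l) → 𝟙 (b ≟ proj₁ z) * tours ((a , proj₂ z) ∷ x ∷ y ∷ l))
      merge₂ x y a M hx hy = begin
        tours ((a , b) ∷ x ∷ y ∷ M)
          ≡⟨ tours-merge a b x (y ∷ M) ⟩
        ∑ (picks (x ∷ y ∷ M)) φ
          ≡⟨ ∑-picks-∷ x (y ∷ M) φ ⟩
        φ (x , y ∷ M) + ∑ (picks (y ∷ M)) (λ (z , l) → φ (z , x ∷ l))
          ≡⟨ cong₂ _+_ (vanish x _ hx) (∑-picks-∷ y M (λ (z , l) → φ (z , x ∷ l))) ⟩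
        φ (y , x ∷ M) + ∑ (picks M) (λ (z , l) → φ (z , x ∷ y ∷ l))
          ≡⟨ cong (_+ ∑ (picks M) (λ (z , l) → φ (z , x ∷ y ∷ l))) (vanish y _ hy) ⟩
        ∑ (picks M) (λ (z , l) → φ (z , x ∷ y ∷ l)) ∎
        where
        φ : Edge q × List (Edge q) → ℕ
        φ (z , l) = 𝟙 (b ≟ proj₁ z) * tours ((a , proj₂ z) ∷ l)

      expand : ∀ x y → b ≢ proj₁ x → b ≢ proj₁ y → tours (x ∷ y ∷ L) ≡
        ∑ (picks L₁) (λ (z , l) → 𝟙 (b ≟ proj₁ z) * tours ((a , proj₂ z) ∷ x ∷ y ∷ l))
      expand x y hx hy = trans (tours-↭ (front x y (a , b) π)) (merge₂ x y a L₁ hx hy)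

      contracted : tours (uu ∷ uu ∷ map (mapEdge c) L) ≡
        ∑ (picks L₁) (λ (y , l) → 𝟙 (b ≟ proj₁ y) * tours (mapEdge c (a , proj₂ y) ∷ uu ∷ uu ∷ map (mapEdge c) l))
      contracted = begin
        tours (uu ∷ uu ∷ map (mapEdge c) L)
          ≡⟨ tours-↭ (front uu uu (mapEdge c (a , b)) (Perm.map⁺ (mapEdge c) π)) ⟩
        tours ((c a , c b) ∷ uu ∷ uu ∷ map (mapEdge c) L₁)
          ≡⟨ cong (λ z → tours ((c a , z) ∷ uu ∷ uu ∷ map (mapEdge c) L₁)) (c-notUV b∉) ⟩
        tours ((c a , b) ∷ uu ∷ uu ∷ map (mapEdge c) L₁)
          ≡⟨ merge₂ uu uu (c a) (map (mapEdge c) L₁) b≢u b≢u ⟩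
        ∑ (picks (map (mapEdge c) L₁)) (λ (z , l) → 𝟙 (b ≟ proj₁ z) * tours ((c a , proj₂ z) ∷ uu ∷ uu ∷ l))
          ≡⟨ ∑-picks-map (mapEdge c) L₁ _ ⟩
        ∑ (picks L₁) (λ (z , l) → 𝟙 (b ≟ c (proj₁ z)) * tours (mapEdge c (a , proj₂ z) ∷ uu ∷ uu ∷ map (mapEdge c) l))
          ≡⟨ ∑-cong (picks L₁) (λ (z , l) → cong (_* tours (mapEdge c (a , proj₂ z) ∷ uu ∷ uu ∷ map (mapEdge c) l))
               (𝟙-cong (b ≟ c (proj₁ z)) (b ≟ proj₁ z) (from (proj₁ z)) (λ { refl → sym (c-notUV b∉) }))) ⟩
        ∑ (picks L₁) (λ (y , l) → 𝟙 (b ≟ proj₁ y) * tours (mapEdge c (a , proj₂ y) ∷ uu ∷ uu ∷ map (mapEdge c) l)) ∎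
        where
        from : ∀ x → b ≡ c x → b ≡ x
        from x e with isUV? x
        ... | yes h = ⊥-elim (b≢u (trans e (c-uv h)))
        ... | no ¬h = trans e (c-notUV ¬h)

      term : ∀ y l → L₁ ↭ y ∷ l → (d : Dec (b ≡ proj₁ y)) →
        Z * (𝟙 d * tours ((a , proj₂ y) ∷ uv ∷ vu ∷ l)) ≡
        Z * (𝟙 d * tours ((a , proj₂ y) ∷ uu ∷ vv ∷ l))
          + i ! * j ! * (𝟙 d * tours (mapEdge c (a , proj₂ y) ∷ uu ∷ uu ∷ map (mapEdge c) l))
      term y l ρ (no _) = sym (trans (cong (Z * 0 +_) (*-zeroʳ (i ! * j !))) (+-identityʳ (Z * 0)))
      term (b , h) l ρ (yes refl) = begin
        Z * (1 * tours ((a , h) ∷ uv ∷ vu ∷ l))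
          ≡⟨ cong (Z *_) (trans (*-identityˡ _) (tours-↭ (back uv vu (a , h) l))) ⟩
        Z * tours (uv ∷ vu ∷ (a , h) ∷ l)
          ≡⟨ IH k L≤k ⟩
        Z * tours (uu ∷ vv ∷ (a , h) ∷ l) + i ! * j ! * tours (uu ∷ uu ∷ mapEdge c (a , h) ∷ map (mapEdge c) l)
          ≡⟨ cong₂ (λ s t → Z * s + i ! * j ! * t)
               (trans (*-identityˡ _) (tours-↭ (back uu vv (a , h) l)))
               (trans (*-identityˡ _) (tours-↭ (back uu uu (mapEdge c (a , h)) (map (mapEdge c) l)))) ⟨
        Z * (1 * tours ((a , h) ∷ uu ∷ vv ∷ l))
          + i ! * j ! * (1 * tours (mapEdge c (a , h) ∷ uu ∷ uu ∷ map (mapEdge c) l)) ∎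
        where
        σ : L ↭ (a , b) ∷ (b , h) ∷ l
        σ = ↭-trans π (prep (a , b) ρ)
        out : ∀ w {d} → b ≢ w → outdeg w L ≡ d → outdeg w ((a , h) ∷ l) ≡ d
        out w b≢w e = trans (cong (λ z → 𝟙 (w ≟ a) + (z + outdeg w l)) (sym (𝟙-no (w ≟ b) (b≢w ∘ sym))))
          (trans (sym (outdeg-↭ w σ)) e)
        inn : ∀ w {d} → b ≢ w → indeg w L ≡ d → indeg w ((a , h) ∷ l) ≡ d
        inn w b≢w e = trans (cong (λ z → z + (𝟙 (w ≟ h) + indeg w l)) (sym (𝟙-no (w ≟ b) (b≢w ∘ sym))))
          (trans (sym (indeg-↭ w σ)) e)
        IH : ∀ k → length L ≤ k → Z * tours (uv ∷ vu ∷ (a , h) ∷ l) ≡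
          Z * tours (uu ∷ vv ∷ (a , h) ∷ l) + i ! * j ! * tours (uu ∷ uu ∷ map (mapEdge c) ((a , h) ∷ l))
        IH zero L≤k with () ← subst (_≤ 0) (Perm.↭-length σ) L≤k
        IH (suc k) L≤k = go k ((a , h) ∷ l) (≤-pred (subst (_≤ suc k) (Perm.↭-length σ) L≤k))
          (out u b≢u ou) (inn u b≢u iu) (out v b≢v ov) (inn v b≢v iv)

-- Colourings and the contraction of two colours

Injective : (Fin n → Fin n) → Set
Injective π = ∀ {x y} → π x ≡ π y → x ≡ y

-- The orientation is chosen so that edge y may follow edge x exactly when f (π y) = f x, the
-- invariance condition for y = ζ x.
edges : (Fin n → Fin n) → Vec (Fin q) n → List (Edge q)
edges π f = List.tabulate (λ x → lookup f (π x) , lookup f x)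

∑-tabulate : {A : Set} (h : Fin n → A) (φ : A → ℕ) → ∑ (List.tabulate h) φ ≡ ∑ (allFin n) (φ ∘ h)
∑-tabulate h φ = trans (cong (λ L → ∑ L φ) (sym (map-tabulate id h))) (∑-map h (allFin _) φ)

∑-allFin-reindex : (π : Fin n → Fin n) → Injective π → (φ : Fin n → ℕ) → ∑ (allFin n) (φ ∘ π) ≡ ∑ (allFin n) φ
∑-allFin-reindex π inj φ = ∑-reindex π (Uniq.allFin⁺ _) ∈-allFin inj φ

-- Both degrees of a colour count the points that carry it, one of them after a permutation of the
-- points.
edges-balanced : (π : Fin n → Fin n) → Injective π → (f : Vec (Fin q) n) (w : Fin q) →
  outdeg w (edges π f) ≡ indeg w (edges π f)
edges-balanced π inj f w = begin
  outdeg w (edges π f)                        ≡⟨ ∑-tabulate (λ x → lookup f (π x) , lookup f x) (λ e → 𝟙 (w ≟ proj₁ e)) ⟩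
  ∑ (allFin _) (λ x → 𝟙 (w ≟ lookup f (π x))) ≡⟨ ∑-allFin-reindex π inj (λ x → 𝟙 (w ≟ lookup f x)) ⟩
  ∑ (allFin _) (λ x → 𝟙 (w ≟ lookup f x))     ≡⟨ ∑-tabulate (λ x → lookup f (π x) , lookup f x) (λ e → 𝟙 (w ≟ proj₂ e)) ⟨
  indeg w (edges π f)                         ∎

edges-map : ∀ {p} (ι : Fin q → Fin p) (π : Fin n → Fin n) (f : Vec (Fin q) n) →
  edges π (Vec.map ι f) ≡ map (mapEdge ι) (edges π f)
edges-map ι π f = trans
  (tabulate-cong (λ x → cong₂ _,_ (lookup-map (π x) ι f) (lookup-map x ι f)))
  (sym (map-tabulate (λ x → lookup f (π x) , lookup f x) (mapEdge ι)))

mult : Fin q → Vec (Fin q) n → ℕ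
mult w []      = 0
mult w (x ∷ f) = 𝟙 (w ≟ x) + mult w f

indeg-tabulate : (w : Fin q) (f : Vec (Fin q) n) (t : Fin n → Fin q) →
  indeg w (List.tabulate (λ x → t x , lookup f x)) ≡ mult w f
indeg-tabulate w []      t = refl
indeg-tabulate w (x ∷ f) t = cong (𝟙 (w ≟ x) +_) (indeg-tabulate w f (t ∘ suc))

length-allFin : ∀ n → length (allFin n) ≡ n
length-allFin n = length-tabulate {n = n} id

∑-punchIn : (v : Fin (suc q)) (ψ : Fin (suc q) → ℕ) →
  ∑ (allFin (suc q)) ψ ≡ ψ v + ∑ (allFin q) (ψ ∘ punchIn v)
∑-punchIn {q} v ψ = sym (trans (cong (ψ v +_) (sym (∑-map (punchIn v) (allFin q) ψ))) (∑-↭ ψ perm))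
  where
  perm : v ∷ map (punchIn v) (allFin q) ↭ allFin (suc q)
  perm = unique-⊆⇒↭
    (All.tabulate (λ x∈ e → let (z , _ , e′) = ∈-map⁻ (punchIn v) x∈ in punchInᵢ≢i v z (sym (trans e e′)))
      ∷ Uniq.map⁺ (punchIn-injective v _ _) (Uniq.allFin⁺ q))
    (λ {x} _ → ∈-allFin x)
    (≤-reflexive (trans (length-allFin (suc q)) (cong suc (sym (trans (length-map (punchIn v) (allFin q)) (length-allFin q))))))

-- The q colours other than `v` are named through `punchIn v`. Renaming `v` to `u` thus turns a
-- colouring with q + 1 colours into one with q colours, in which `u′` is the merged colour;
-- `fibre g` collects the colourings that become `g`.
module Fibre {q : ℕ} (v : Fin (suc q)) (u′ : Fin q) where

  u : Fin (suc q)
  u = punchIn v u′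

  u≢v : u ≢ v
  u≢v = punchInᵢ≢i v u′

  open Contraction u v u≢v using (c; u≟u; v≟v; u≟v; v≟u; c-uv)

  preimages : Fin q → List (Fin (suc q))
  preimages z = if does (z ≟ u′) then u ∷ v ∷ [] else punchIn v z ∷ []

  fibre : Vec (Fin q) m → List (Vec (Fin (suc q)) m)
  fibre []      = [] ∷ []
  fibre (z ∷ g) = concatMap (λ x → map (x ∷_) (fibre g)) (preimages z)

  ∑-preimages : (ψ : Fin (suc q) → ℕ) (z : Fin q) → ∑ (preimages z) ψ ≡ ψ (punchIn v z) + 𝟙 (z ≟ u′) * ψ v
  ∑-preimages ψ z with z ≟ u′
  ... | yes refl = refl
  ... | no _     = refl

  ∑-fibre-∷ : (z : Fin q) (g : Vec (Fin q) m) (φ : Vec (Fin (suc q)) (suc m) → ℕ) →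
    ∑ (fibre (z ∷ g)) φ ≡ ∑[ x ∈ preimages z ] ∑[ f ∈ fibre g ] φ (x ∷ f)
  ∑-fibre-∷ z g φ = trans (∑-concatMap _ (preimages z) φ) (∑-cong (preimages z) (λ x → ∑-map (x ∷_) (fibre g) φ))

  ∑-all-preimages : (ψ : Fin (suc q) → ℕ) → ∑ (allFin (suc q)) ψ ≡ ∑[ z ∈ allFin q ] ∑ (preimages z) ψ
  ∑-all-preimages ψ = begin
    ∑ (allFin (suc q)) ψ
      ≡⟨ ∑-punchIn v ψ ⟩
    ψ v + ∑ (allFin q) (ψ ∘ punchIn v)
      ≡⟨ +-comm (ψ v) _ ⟩
    ∑ (allFin q) (ψ ∘ punchIn v) + ψ v
      ≡⟨ cong (∑ (allFin q) (ψ ∘ punchIn v) +_) only-u′ ⟨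
    ∑ (allFin q) (ψ ∘ punchIn v) + ∑ (allFin q) (λ z → 𝟙 (z ≟ u′) * ψ v)
      ≡⟨ ∑-+ (allFin q) _ _ ⟨
    ∑ (allFin q) (λ z → ψ (punchIn v z) + 𝟙 (z ≟ u′) * ψ v)
      ≡⟨ ∑-cong (allFin q) (∑-preimages ψ) ⟨
    ∑[ z ∈ allFin q ] ∑ (preimages z) ψ ∎
    where
    only-u′ : ∑ (allFin q) (λ z → 𝟙 (z ≟ u′) * ψ v) ≡ ψ v
    only-u′ = trans (∑-unique (λ z → 𝟙 (z ≟ u′) * ψ v) (Uniq.allFin⁺ q) (∈-allFin u′)
        (λ {z} _ z≢ → cong (_* ψ v) (𝟙-no (z ≟ u′) z≢)))
      (trans (cong (_* ψ v) (𝟙-refl u′)) (*-identityˡ (ψ v)))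

  ∑-fibres : ∀ m (φ : Vec (Fin (suc q)) m → ℕ) → ∑ (allVecs (suc q) m) φ ≡ ∑[ g ∈ allVecs q m ] ∑ (fibre g) φ
  ∑-fibres zero    φ = sym (+-identityʳ _)
  ∑-fibres (suc m) φ = begin
    ∑ (allVecs (suc q) (suc m)) φ
      ≡⟨ ∑-allVecs-∷ (suc q) m φ ⟩
    ∑[ x ∈ allFin (suc q) ] ∑[ f ∈ allVecs (suc q) m ] φ (x ∷ f)
      ≡⟨ ∑-all-preimages _ ⟩
    ∑[ z ∈ allFin q ] ∑[ x ∈ preimages z ] ∑[ f ∈ allVecs (suc q) m ] φ (x ∷ f)
      ≡⟨ ∑-cong (allFin q) (λ z → ∑-cong (preimages z) (λ x → ∑-fibres m (λ f → φ (x ∷ f)))) ⟩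
    ∑[ z ∈ allFin q ] ∑[ x ∈ preimages z ] ∑[ g ∈ allVecs q m ] ∑[ f ∈ fibre g ] φ (x ∷ f)
      ≡⟨ ∑-cong (allFin q) (λ z → ∑-swap (preimages z) (allVecs q m) _) ⟩
    ∑[ z ∈ allFin q ] ∑[ g ∈ allVecs q m ] ∑[ x ∈ preimages z ] ∑[ f ∈ fibre g ] φ (x ∷ f)
      ≡⟨ ∑-cong (allFin q) (λ z → ∑-cong (allVecs q m) (λ g → ∑-fibre-∷ z g φ)) ⟨
    ∑[ z ∈ allFin q ] ∑[ g ∈ allVecs q m ] ∑ (fibre (z ∷ g)) φ
      ≡⟨ ∑-allVecs-∷ q m _ ⟨
    ∑[ g ∈ allVecs q (suc m) ] ∑ (fibre g) φ ∎

  mult-u-punchIn : ∀ z → z ≢ u′ → 𝟙 (u ≟ punchIn v z) ≡ 0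
  mult-u-punchIn z z≢ = 𝟙-no (u ≟ punchIn v z) (λ e → z≢ (sym (punchIn-injective v u′ z e)))

  mult-v-punchIn : ∀ z → 𝟙 (v ≟ punchIn v z) ≡ 0
  mult-v-punchIn z = 𝟙-no (v ≟ punchIn v z) (λ e → punchInᵢ≢i v z (sym e))

  c-punchIn : ∀ z → c (punchIn v z) ≡ punchIn v z
  c-punchIn z with punchIn v z ≟ v
  ... | yes e = ⊥-elim (punchInᵢ≢i v z e)
  ... | no _  = refl

  fibre-member : (g : Vec (Fin q) m) {f : Vec (Fin (suc q)) m} → f ∈ fibre g →
    mult u f + mult v f ≡ mult u′ g × Vec.map c f ≡ Vec.map (punchIn v) g
  fibre-member []      (here refl) = refl , refl
  fibre-member (z ∷ g) f∈ with x , x∈ , p ← find (∈-concatMap⁻ (λ x → map (x ∷_) (fibre g)) {xs = preimages z} f∈)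
    with f , f∈′ , refl ← ∈-map⁻ (x ∷_) p with e₁ , e₂ ← fibre-member g f∈′ =
      trans (+-interchange (𝟙 (u ≟ x)) (mult u f) (𝟙 (v ≟ x)) (mult v f)) (cong₂ _+_ (proj₁ (colour z x∈)) e₁) ,
      cong₂ _∷_ (proj₂ (colour z x∈)) e₂
    where
    colour : ∀ z {x} → x ∈ preimages z → 𝟙 (u ≟ x) + 𝟙 (v ≟ x) ≡ 𝟙 (u′ ≟ z) × c x ≡ punchIn v z
    colour z x∈ with z ≟ u′
    colour z (here refl)         | yes refl = trans (cong₂ _+_ u≟u v≟u) (sym (𝟙-refl u′)) , c-uv (inj₁ refl)
    colour z (there (here refl)) | yes refl = trans (cong₂ _+_ u≟v v≟v) (sym (𝟙-refl u′)) , c-uv (inj₂ refl)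
    colour z (here refl)         | no z≢    =
      trans (cong₂ _+_ (mult-u-punchIn z z≢) (mult-v-punchIn z)) (sym (𝟙-no (u′ ≟ z) (z≢ ∘ sym))) , c-punchIn z

  -- The Pólya urn: i! j! counts pairs of linear orders, and each new element
  -- coloured u or v can be inserted into the two orders in i + j + 2 ways.
  ∑-fibre-factorials : (i j : ℕ) (g : Vec (Fin q) m) →
    suc (i + j) ! * ∑ (fibre g) (λ f → (i + mult u f) ! * (j + mult v f) !) ≡ i ! * j ! * (suc (i + j) + mult u′ g) !
  ∑-fibre-factorials i j [] = begin
    suc (i + j) ! * ((i + 0) ! * (j + 0) ! + 0)
      ≡⟨ cong (suc (i + j) ! *_) (trans (+-identityʳ _) (cong₂ (λ a b → a ! * b !) (+-identityʳ i) (+-identityʳ j))) ⟩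
    suc (i + j) ! * (i ! * j !)
      ≡⟨ *-comm (suc (i + j) !) _ ⟩
    i ! * j ! * suc (i + j) !
      ≡⟨ cong (λ a → i ! * j ! * a !) (+-identityʳ (suc (i + j))) ⟨
    i ! * j ! * (suc (i + j) + 0) ! ∎
  ∑-fibre-factorials i j (z ∷ g) = trans (cong (suc (i + j) ! *_) (∑-fibre-∷ z g _)) (go (z ≟ u′))
    where
    w : Fin (suc q) → ℕ
    w x = ∑[ f ∈ fibre g ] ((i + (𝟙 (u ≟ x) + mult u f)) ! * (j + (𝟙 (v ≟ x) + mult v f)) !)
    N = suc (i + j)
    M = mult u′ g

    w-≡ : ∀ {x a b} → 𝟙 (u ≟ x) ≡ a → 𝟙 (v ≟ x) ≡ b →
      w x ≡ ∑[ f ∈ fibre g ] ((i + (a + mult u f)) ! * (j + (b + mult v f)) !)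
    w-≡ e₁ e₂ = ∑-cong (fibre g) (λ f → cong₂ (λ a b → (i + (a + mult u f)) ! * (j + (b + mult v f)) !) e₁ e₂)

    go : Dec (z ≡ u′) → N ! * ∑ (preimages z) w ≡ i ! * j ! * (N + (𝟙 (u′ ≟ z) + M)) !
    go (no z≢) = begin
      N ! * ∑ (preimages z) w
        ≡⟨ cong (N ! *_) (trans (∑-preimages w z) (cong (λ a → w (punchIn v z) + a * w v) (𝟙-no (z ≟ u′) z≢))) ⟩
      N ! * (w (punchIn v z) + 0)
        ≡⟨ cong (N ! *_) (trans (+-identityʳ _) (w-≡ (mult-u-punchIn z z≢) (mult-v-punchIn z))) ⟩
      N ! * ∑ (fibre g) (λ f → (i + mult u f) ! * (j + mult v f) !)
        ≡⟨ ∑-fibre-factorials i j g ⟩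
      i ! * j ! * (N + M) !
        ≡⟨ cong (λ a → i ! * j ! * (N + (a + M)) !) (𝟙-no (u′ ≟ z) (z≢ ∘ sym)) ⟨
      i ! * j ! * (N + (𝟙 (u′ ≟ z) + M)) ! ∎
    go (yes refl) = *-cancelˡ-≡ _ _ (suc N) (begin
      suc N * (N ! * ∑ (preimages z) w)
        ≡⟨ *-assoc (suc N) (N !) _ ⟨
      suc N ! * ∑ (preimages z) w
        ≡⟨ cong (suc N ! *_) (trans (∑-preimages w z) (trans (cong (λ a → w u + a * w v) (𝟙-refl z))
             (cong₂ _+_ w-u (trans (*-identityˡ (w v)) w-v)))) ⟩
      suc N ! * (S₁ + S₂)
        ≡⟨ *-distribˡ-+ (suc N !) S₁ S₂ ⟩
      suc N ! * S₁ + suc N ! * S₂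
        ≡⟨ cong₂ _+_ (∑-fibre-factorials (suc i) j g)
             (trans (cong (λ a → a ! * S₂) (cong suc (sym (+-suc i j)))) (∑-fibre-factorials i (suc j) g)) ⟩
      suc i ! * j ! * (suc N + M) ! + i ! * suc j ! * (suc (i + suc j) + M) !
        ≡⟨ cong (λ a → suc i ! * j ! * (suc N + M) ! + i ! * suc j ! * (suc a + M) !) (+-suc i j) ⟩
      suc i ! * j ! * (suc N + M) ! + i ! * suc j ! * (suc N + M) !
        ≡⟨ rearrange i j (i !) (j !) ((suc N + M) !) ⟩
      suc N * (i ! * j ! * (suc N + M) !)
        ≡⟨ cong (λ a → suc N * (i ! * j ! * a !)) (+-suc N M) ⟨
      suc N * (i ! * j ! * (N + suc M) !)
        ≡⟨ cong (λ a → suc N * (i ! * j ! * (N + (a + M)) !)) (𝟙-refl z) ⟨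
      suc N * (i ! * j ! * (N + (𝟙 (z ≟ z) + M)) !) ∎)
      where
      S₁ = ∑[ f ∈ fibre g ] ((suc i + mult u f) ! * (j + mult v f) !)
      S₂ = ∑[ f ∈ fibre g ] ((i + mult u f) ! * (suc j + mult v f) !)
      w-u : w u ≡ S₁
      w-u = trans (w-≡ u≟u v≟u) (∑-cong (fibre g) (λ f → cong (λ a → a ! * (j + mult v f) !) (+-suc i (mult u f))))
      w-v : w v ≡ S₂
      w-v = trans (w-≡ u≟v v≟v) (∑-cong (fibre g) (λ f → cong (λ a → (i + mult u f) ! * a !) (+-suc j (mult v f))))
      rearrange : ∀ i j a b c → (suc i * a) * b * c + a * (suc j * b) * c ≡ suc (suc (i + j)) * (a * b * c)
      rearrange = solve-∀

-- The effect of a transposition on the number of tours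

flip : Fin (2 + m) → Fin (2 + m)
flip zero          = suc zero
flip (suc zero)    = zero
flip (suc (suc x)) = suc (suc x)

-- These are P_π and B with the sums exchanged: colourings outside, full cycles inside.
tourCount : (Fin n → Fin n) → ℕ → ℕ
tourCount π q = ∑[ f ∈ allVecs q _ ] tours (edges π f)

tourCount₌ : (Fin n → Fin n) → Fin n → Fin n → ℕ → ℕ
tourCount₌ π a b q = ∑[ f ∈ allVecs q _ ] (𝟙 (lookup f a ≟ lookup f b) * tours (edges π f))

module Transposition {m : ℕ} (π : Fin (2 + m) → Fin (2 + m)) (inj : Injective π)
  (π0 : π zero ≡ zero) (π1 : π (suc zero) ≡ suc zero) where

  flip-π : ∀ x → flip (π (suc (suc x))) ≡ π (suc (suc x))
  flip-π x with π (suc (suc x)) in e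
  ... | zero        with () ← inj (trans e (sym π0))
  ... | suc zero    with () ← inj (trans e (sym π1))
  ... | suc (suc _) = refl

  rest : Vec (Fin q) (2 + m) → List (Edge q)
  rest f = List.tabulate (λ x → lookup f (π (suc (suc x))) , lookup f (suc (suc x)))

  edges-π : (x y : Fin q) (f : Vec (Fin q) m) →
    edges π (x ∷ y ∷ f) ≡ (x , x) ∷ (y , y) ∷ rest (x ∷ y ∷ f)
  edges-π x y f = cong₂ (λ a b → (lookup (x ∷ y ∷ f) a , x) ∷ (lookup (x ∷ y ∷ f) b , y) ∷ rest (x ∷ y ∷ f)) π0 π1

  edges-flip-π : (x y : Fin q) (f : Vec (Fin q) m) →
    edges (flip ∘ π) (x ∷ y ∷ f) ≡ (y , x) ∷ (x , y) ∷ rest (x ∷ y ∷ f)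
  edges-flip-π x y f = trans
    (cong₂ (λ a b → (lookup (x ∷ y ∷ f) (flip a) , x) ∷ (lookup (x ∷ y ∷ f) (flip b) , y)
        ∷ List.tabulate (λ z → lookup (x ∷ y ∷ f) (flip (π (suc (suc z)))) , lookup f z)) π0 π1)
    (cong (λ L → (y , x) ∷ (x , y) ∷ L)
      (tabulate-cong (λ z → cong (λ a → lookup (x ∷ y ∷ f) a , lookup f z) (flip-π z))))

  module _ {q : ℕ} (v : Fin (suc q)) (u′ : Fin q) where
    open Fibre v u′
    open Contraction u v u≢v using (c; uu; vv; uv; vu; c-uv; contraction)

    -- The points 0 and 1 carry the colours `u` and `v`. After the contraction they share the colour
    -- `u′`, so the contracted digraph is one of those counted by B.
    contracted-tours : (f : Vec (Fin (suc q)) m) (g : Vec (Fin q) m) → Vec.map c f ≡ Vec.map (punchIn v) g →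
      tours (uu ∷ uu ∷ map (mapEdge c) (rest (u ∷ v ∷ f))) ≡ tours (edges π (u′ ∷ u′ ∷ g))
    contracted-tours f g e = begin
      tours (uu ∷ uu ∷ map (mapEdge c) (rest (u ∷ v ∷ f)))
        ≡⟨ cong₂ (λ a b → tours ((a , a) ∷ (b , b) ∷ map (mapEdge c) (rest (u ∷ v ∷ f)))) (c-uv (inj₁ refl)) (c-uv (inj₂ refl)) ⟨
      tours (map (mapEdge c) (uu ∷ vv ∷ rest (u ∷ v ∷ f)))
        ≡⟨ cong (tours ∘ map (mapEdge c)) (edges-π u v f) ⟨
      tours (map (mapEdge c) (edges π (u ∷ v ∷ f)))
        ≡⟨ cong tours (edges-map c π (u ∷ v ∷ f)) ⟨
      tours (edges π (c u ∷ c v ∷ Vec.map c f))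
        ≡⟨ cong (tours ∘ edges π) (cong₂ _∷_ (c-uv (inj₁ refl)) (cong₂ _∷_ (c-uv (inj₂ refl)) e)) ⟩
      tours (edges π (Vec.map (punchIn v) (u′ ∷ u′ ∷ g)))
        ≡⟨ cong tours (edges-map (punchIn v) π (u′ ∷ u′ ∷ g)) ⟩
      tours (map (mapEdge (punchIn v)) (edges π (u′ ∷ u′ ∷ g)))
        ≡⟨ tours-relabel (punchIn v) (punchIn-injective v _ _) (edges π (u′ ∷ u′ ∷ g)) ⟩
      tours (edges π (u′ ∷ u′ ∷ g)) ∎

    tours-flip-π : (f : Vec (Fin (suc q)) m) (g : Vec (Fin q) m) → f ∈ fibre g →
      suc (mult u′ g) ! * tours (edges (flip ∘ π) (u ∷ v ∷ f)) ≡
      suc (mult u′ g) ! * tours (edges π (u ∷ v ∷ f)) + mult u f ! * mult v f ! * tours (edges π (u′ ∷ u′ ∷ g))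
    tours-flip-π f g f∈ with e₁ , e₂ ← fibre-member g f∈ = begin
      suc (mult u′ g) ! * tours (edges (flip ∘ π) (u ∷ v ∷ f))
        ≡⟨ cong₂ (λ a L → suc a ! * tours L) (sym e₁) (edges-flip-π u v f) ⟩
      suc (i + j) ! * tours (vu ∷ uv ∷ L)
        ≡⟨ cong (suc (i + j) ! *_) (tours-swap vu uv L) ⟩
      suc (i + j) ! * tours (uv ∷ vu ∷ L)
        ≡⟨ contraction L i j (out u) (indeg-tabulate u f _) (out v) (indeg-tabulate v f _) ⟩
      suc (i + j) ! * tours (uu ∷ vv ∷ L) + i ! * j ! * tours (uu ∷ uu ∷ map (mapEdge c) L)
        ≡⟨ cong₂ _+_ (cong₂ (λ a L → suc a ! * tours L) (sym e₁) (edges-π u v f))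
             (cong (i ! * j ! *_) (sym (contracted-tours f g e₂))) ⟨
      suc (mult u′ g) ! * tours (edges π (u ∷ v ∷ f)) + i ! * j ! * tours (edges π (u′ ∷ u′ ∷ g)) ∎
      where
      L = rest (u ∷ v ∷ f)
      i = mult u f
      j = mult v f
      -- The full digraph is balanced, and the loops at the fixed points 0 and 1 cancel from both of
      -- its degrees.
      out : ∀ w → outdeg w L ≡ mult w f
      out w = trans (+-cancelˡ-≡ (𝟙 (w ≟ v)) _ _ (+-cancelˡ-≡ (𝟙 (w ≟ u)) _ _
        (subst (λ M → outdeg w M ≡ indeg w M) (edges-π u v f) (edges-balanced π inj (u ∷ v ∷ f) w))))
        (indeg-tabulate w f _)

    -- The contracted digraph depends on `g` only, so just the weights are summed over the fibre.
    -- The urn identity with i = j = 0 makes their total equal to the cleared denominator `Z`.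
    ∑-fibre-flip-π : (g : Vec (Fin q) m) →
      ∑[ f ∈ fibre g ] tours (edges (flip ∘ π) (u ∷ v ∷ f)) ≡
      ∑ (fibre g) (λ f → tours (edges π (u ∷ v ∷ f))) + tours (edges π (u′ ∷ u′ ∷ g))
    ∑-fibre-flip-π g = *-factorial-cancelˡ (suc (mult u′ g)) (begin
      Z * ∑ (fibre g) (λ f → tours (edges (flip ∘ π) (u ∷ v ∷ f)))
        ≡⟨ ∑-*ˡ (fibre g) Z _ ⟨
      ∑[ f ∈ fibre g ] (Z * tours (edges (flip ∘ π) (u ∷ v ∷ f)))
        ≡⟨ ∑-cong-∈ (fibre g) (λ {f} f∈ → tours-flip-π f g f∈) ⟩
      ∑[ f ∈ fibre g ] (Z * tours (edges π (u ∷ v ∷ f)) + mult u f ! * mult v f ! * T)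
        ≡⟨ ∑-+ (fibre g) _ _ ⟩
      ∑ (fibre g) (λ f → Z * tours (edges π (u ∷ v ∷ f))) + ∑ (fibre g) (λ f → mult u f ! * mult v f ! * T)
        ≡⟨ cong₂ _+_ (∑-*ˡ (fibre g) Z _) (trans (∑-*ʳ (fibre g) T _) (cong (_* T) urn)) ⟩
      Z * ∑ (fibre g) (λ f → tours (edges π (u ∷ v ∷ f))) + Z * T
        ≡⟨ *-distribˡ-+ Z _ T ⟨
      Z * (∑ (fibre g) (λ f → tours (edges π (u ∷ v ∷ f))) + T) ∎)
      where
      Z = suc (mult u′ g) !
      T = tours (edges π (u′ ∷ u′ ∷ g))
      urn : ∑[ f ∈ fibre g ] (mult u f ! * mult v f !) ≡ Z
      urn = trans (sym (*-identityˡ _)) (trans (∑-fibre-factorials 0 0 g) (*-identityˡ Z))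

    ∑-flip-π : ∑[ f ∈ allVecs (suc q) m ] tours (edges (flip ∘ π) (punchIn v u′ ∷ v ∷ f)) ≡
      ∑ (allVecs (suc q) m) (λ f → tours (edges π (punchIn v u′ ∷ v ∷ f)))
        + ∑ (allVecs q m) (λ g → tours (edges π (u′ ∷ u′ ∷ g)))
    ∑-flip-π = begin
      ∑ (allVecs (suc q) m) (λ f → tours (edges (flip ∘ π) (u ∷ v ∷ f)))
        ≡⟨ ∑-fibres m _ ⟩
      ∑[ g ∈ allVecs q m ] ∑[ f ∈ fibre g ] tours (edges (flip ∘ π) (u ∷ v ∷ f))
        ≡⟨ ∑-cong (allVecs q m) ∑-fibre-flip-π ⟩
      ∑[ g ∈ allVecs q m ] (∑ (fibre g) (λ f → tours (edges π (u ∷ v ∷ f))) + tours (edges π (u′ ∷ u′ ∷ g)))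
        ≡⟨ ∑-+ (allVecs q m) _ _ ⟩
      ∑ (allVecs q m) (λ g → ∑ (fibre g) (λ f → tours (edges π (u ∷ v ∷ f))))
        + ∑ (allVecs q m) (λ g → tours (edges π (u′ ∷ u′ ∷ g)))
        ≡⟨ cong (_+ ∑ (allVecs q m) (λ g → tours (edges π (u′ ∷ u′ ∷ g)))) (∑-fibres m _) ⟨
      ∑ (allVecs (suc q) m) (λ f → tours (edges π (u ∷ v ∷ f)))
        + ∑ (allVecs q m) (λ g → tours (edges π (u′ ∷ u′ ∷ g))) ∎

  ∑-split : ∀ q (φ : Vec (Fin q) (2 + m) → ℕ) → ∑ (allVecs q (2 + m)) φ ≡
    ∑[ y ∈ allFin q ] ∑[ x ∈ allFin q ] ∑[ f ∈ allVecs q m ] φ (x ∷ y ∷ f)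
  ∑-split q φ = trans (∑-allVecs-∷ q (suc m) φ)
    (trans (∑-cong (allFin q) (λ x → ∑-allVecs-∷ q m (λ f → φ (x ∷ f)))) (∑-swap (allFin q) (allFin q) _))

  -- Let x and y be the colours of the points 0 and 1. For x = y the two digraphs coincide. For
  -- fixed y, the colours x ≠ y are the values of `punchIn y`, and their extra terms add up to one
  -- copy of B(q), whatever y is; there are q + 1 choices of y.
  tourCount-flip₀ : ∀ q → tourCount (flip ∘ π) (suc q) ≡
    tourCount π (suc q) + suc q * tourCount₌ π zero (suc zero) q
  tourCount-flip₀ q = begin
    tourCount (flip ∘ π) (suc q)
      ≡⟨ ∑-split (suc q) _ ⟩
    ∑[ y ∈ allFin (suc q) ] ∑ (allFin (suc q)) (λ x → E₁ x y)
      ≡⟨ ∑-cong (allFin (suc q)) column ⟩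
    ∑[ y ∈ allFin (suc q) ] (∑ (allFin (suc q)) (λ x → E₂ x y) + Y)
      ≡⟨ ∑-+ (allFin (suc q)) (λ y → ∑ (allFin (suc q)) (λ x → E₂ x y)) (λ _ → Y) ⟩
    ∑ (allFin (suc q)) (λ y → ∑ (allFin (suc q)) (λ x → E₂ x y)) + ∑ (allFin (suc q)) (λ _ → Y)
      ≡⟨ cong₂ _+_ (sym (∑-split (suc q) _)) (trans (∑-const (allFin (suc q)) Y)
           (cong₂ _*_ (length-allFin (suc q)) diagonal)) ⟩
    tourCount π (suc q) + suc q * tourCount₌ π zero (suc zero) q ∎
    where
    E₁ E₂ : Fin (suc q) → Fin (suc q) → ℕ
    E₁ x y = ∑[ f ∈ allVecs (suc q) m ] tours (edges (flip ∘ π) (x ∷ y ∷ f))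
    E₂ x y = ∑[ f ∈ allVecs (suc q) m ] tours (edges π (x ∷ y ∷ f))
    Y = ∑[ z ∈ allFin q ] ∑[ g ∈ allVecs q m ] tours (edges π (z ∷ z ∷ g))

    same : ∀ y → E₁ y y ≡ E₂ y y
    same y = ∑-cong (allVecs (suc q) m) (λ f → cong tours (trans (edges-flip-π y y f) (sym (edges-π y y f))))

    column : ∀ y → ∑ (allFin (suc q)) (λ x → E₁ x y) ≡ ∑ (allFin (suc q)) (λ x → E₂ x y) + Y
    column y = begin
      ∑ (allFin (suc q)) (λ x → E₁ x y)
        ≡⟨ ∑-punchIn y _ ⟩
      E₁ y y + ∑ (allFin q) (λ z → E₁ (punchIn y z) y)
        ≡⟨ cong₂ _+_ (same y) (trans (∑-cong (allFin q) (∑-flip-π y)) (∑-+ (allFin q) _ _)) ⟩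
      E₂ y y + (∑ (allFin q) (λ z → E₂ (punchIn y z) y) + Y)
        ≡⟨ +-assoc (E₂ y y) _ Y ⟨
      E₂ y y + ∑ (allFin q) (λ z → E₂ (punchIn y z) y) + Y
        ≡⟨ cong (_+ Y) (∑-punchIn y (λ x → E₂ x y)) ⟨
      ∑ (allFin (suc q)) (λ x → E₂ x y) + Y ∎

    diagonal : Y ≡ tourCount₌ π zero (suc zero) q
    diagonal = sym (begin
      tourCount₌ π zero (suc zero) q
        ≡⟨ ∑-split q _ ⟩
      ∑[ y ∈ allFin q ] ∑[ x ∈ allFin q ] ∑[ f ∈ allVecs q m ] (𝟙 (x ≟ y) * tours (edges π (x ∷ y ∷ f)))
        ≡⟨ ∑-cong (allFin q) (λ y → trans (∑-unique _ (Uniq.allFin⁺ q) (∈-allFin y)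
             (λ {x} _ x≢y → ∑-zero (allVecs q m) (λ {f} _ → cong (_* tours (edges π (x ∷ y ∷ f))) (𝟙-no (x ≟ y) x≢y))))
             (∑-cong (allVecs q m) (λ f → trans (cong (_* tours (edges π (y ∷ y ∷ f))) (𝟙-refl y)) (*-identityˡ _)))) ⟩
      Y ∎)

-- Conjugation

transpose-left : (a b : Fin n) → transpose a b a ≡ b
transpose-left a b with a ≟ a
... | yes _ = refl
... | no ¬p = ⊥-elim (¬p refl)

transpose-right : (a b : Fin n) → transpose a b b ≡ a
transpose-right a b with b ≟ a
... | yes b≡a = b≡a
... | no _ with b ≟ b
...   | yes _ = refl
...   | no ¬p = ⊥-elim (¬p refl)

transpose-other : (a b : Fin n) {x : Fin n} → x ≢ a → x ≢ b → transpose a b x ≡ x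
transpose-other a b {x} x≢a x≢b with x ≟ a
... | yes p = ⊥-elim (x≢a p)
... | no _ with x ≟ b
...   | yes p = ⊥-elim (x≢b p)
...   | no _  = refl

data Position (a b x : Fin n) : Set where
  at-a  : x ≡ a → Position a b x
  at-b  : x ≡ b → Position a b x
  other : x ≢ a → x ≢ b → Position a b x

position : (a b x : Fin n) → Position a b x
position a b x with x ≟ a
... | yes p = at-a p
... | no p with x ≟ b
...   | yes r = at-b r
...   | no r  = other p r

transpose-involutive : (a b x : Fin n) → transpose a b (transpose a b x) ≡ x
transpose-involutive a b x with position a b x
... | at-a refl = trans (cong (transpose a b) (transpose-left a b)) (transpose-right a b)
... | at-b refl = trans (cong (transpose a b) (transpose-right a b)) (transpose-left a b)
... | other p r = trans (cong (transpose a b) (transpose-other a b p r)) (transpose-other a b p r)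

transpose-injective : (a b : Fin n) → Injective (transpose a b)
transpose-injective a b {x} {y} e =
  trans (sym (transpose-involutive a b x)) (trans (cong (transpose a b) e) (transpose-involutive a b y))

lookup-ext : {A : Set} {f g : Vec A n} → (∀ x → lookup f x ≡ lookup g x) → f ≡ g
lookup-ext {f = f} {g} h = trans (sym (tabulate∘lookup f)) (trans (VecP.tabulate-cong h) (tabulate∘lookup g))

reorder : {A : Set} → (Fin n → Fin n) → Vec A n → Vec A n
reorder σ f = Vec.tabulate (lookup f ∘ σ)

lookup-reorder : {A : Set} (σ : Fin n → Fin n) (f : Vec A n) (x : Fin n) → lookup (reorder σ f) x ≡ lookup f (σ x)
lookup-reorder σ f x = lookup∘tabulate (lookup f ∘ σ) x

edges-cong : {π ρ : Fin n → Fin n} → (∀ x → π x ≡ ρ x) → (f : Vec (Fin q) n) → edges π f ≡ edges ρ f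
edges-cong h f = tabulate-cong (λ x → cong (λ y → lookup f y , lookup f x) (h x))

tourCount-cong : {π ρ : Fin n → Fin n} → (∀ x → π x ≡ ρ x) → ∀ q → tourCount π q ≡ tourCount ρ q
tourCount-cong {n} h q = ∑-cong (allVecs q n) (λ f → cong tours (edges-cong h f))

-- The digraph of `π` under a colouring f is the digraph of `ρ` under f ∘ σ with its edges listed in
-- another order.
module Conjugation (σ σ⁻¹ : Fin n → Fin n) (σσ⁻¹ : ∀ x → σ (σ⁻¹ x) ≡ x) (σ⁻¹σ : ∀ x → σ⁻¹ (σ x) ≡ x)
  {π ρ : Fin n → Fin n} (πσ≗σρ : ∀ x → π (σ x) ≡ σ (ρ x)) where

  σ-injective : Injective σ
  σ-injective {x} {y} e = trans (sym (σ⁻¹σ x)) (trans (cong σ⁻¹ e) (σ⁻¹σ y))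

  reorder-injective : {f g : Vec (Fin q) n} → reorder σ f ≡ reorder σ g → f ≡ g
  reorder-injective {f = f} {g} e = lookup-ext (λ x → begin
    lookup f x                       ≡⟨ cong (lookup f) (σσ⁻¹ x) ⟨
    lookup f (σ (σ⁻¹ x))             ≡⟨ lookup-reorder σ f (σ⁻¹ x) ⟨
    lookup (reorder σ f) (σ⁻¹ x)     ≡⟨ cong (λ h → lookup h (σ⁻¹ x)) e ⟩
    lookup (reorder σ g) (σ⁻¹ x)     ≡⟨ lookup-reorder σ g (σ⁻¹ x) ⟩
    lookup g (σ (σ⁻¹ x))             ≡⟨ cong (lookup g) (σσ⁻¹ x) ⟩
    lookup g x                       ∎)

  tours-conj : (f : Vec (Fin q) n) → tours (edges π f) ≡ tours (edges ρ (reorder σ f))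
  tours-conj {q} f = sym (begin
    tours (edges ρ (reorder σ f))
      ≡⟨ cong tours (tabulate-cong (λ x → cong₂ _,_
           (trans (lookup-reorder σ f (ρ x)) (cong (lookup f) (sym (πσ≗σρ x)))) (lookup-reorder σ f x))) ⟩
    tours (List.tabulate (h ∘ σ))
      ≡⟨ cong tours (trans (sym (map-tabulate id (h ∘ σ))) (map-∘ (allFin n))) ⟩
    tours (map h (map σ (allFin n)))
      ≡⟨ tours-↭ (Perm.map⁺ h (injective⇒map-↭ σ (Uniq.allFin⁺ n) ∈-allFin σ-injective)) ⟩
    tours (map h (allFin n))
      ≡⟨ cong tours (map-tabulate id h) ⟩
    tours (edges π f) ∎)
    where
    h : Fin n → Edge q
    h x = lookup f (π x) , lookup f x

  ∑-reorder : (φ : Vec (Fin q) n → ℕ) → ∑ (allVecs q n) (φ ∘ reorder σ) ≡ ∑ (allVecs q n) φ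
  ∑-reorder {q} φ = ∑-reindex (reorder σ) (allVecs-unique q n) ∈-allVecs reorder-injective φ

  tourCount-conj : ∀ q → tourCount π q ≡ tourCount ρ q
  tourCount-conj q = trans (∑-cong (allVecs q n) tours-conj) (∑-reorder (tours ∘ edges ρ))

  tourCount₌-conj : ∀ a b q → tourCount₌ π (σ a) (σ b) q ≡ tourCount₌ ρ a b q
  tourCount₌-conj a b q = trans
    (∑-cong (allVecs q n) (λ f → cong₂ _*_
      (cong₂ (λ x y → 𝟙 (x ≟ y)) (sym (lookup-reorder σ f a)) (sym (lookup-reorder σ f b))) (tours-conj f)))
    (∑-reorder (λ f → 𝟙 (lookup f a ≟ lookup f b) * tours (edges ρ f)))

-- Conjugation carries `a` and `b` to the points 0 and 1, whose colours are the first two entries of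
-- a colouring.
tourCount-transpose : (π : Fin n → Fin n) → Injective π → {a b : Fin n} → a ≢ b → π a ≡ a → π b ≡ b →
  ∀ q → tourCount (transpose a b ∘ π) (suc q) ≡ tourCount π (suc q) + suc q * tourCount₌ π a b q
tourCount-transpose {suc zero} π inj {zero} {zero} a≢b πa πb q = ⊥-elim (a≢b refl)
tourCount-transpose {suc (suc m)} π inj {a} {b} a≢b πa πb q = begin
  tourCount (transpose a b ∘ π) (suc q)
    ≡⟨ C′.tourCount-conj (suc q) ⟩
  tourCount (flip ∘ ρ) (suc q)
    ≡⟨ Transposition.tourCount-flip₀ ρ ρ-injective ρ0 ρ1 q ⟩
  tourCount ρ (suc q) + suc q * tourCount₌ ρ zero (suc zero) q
    ≡⟨ cong₂ (λ s t → s + suc q * t) (C.tourCount-conj (suc q))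
         (trans (cong₂ (λ x y → tourCount₌ π x y q) (sym σ0) (sym σ1)) (C.tourCount₌-conj zero (suc zero) q)) ⟨
  tourCount π (suc q) + suc q * tourCount₌ π a b q ∎
  where
  -- This is the point that `transpose zero a` carries to `b`, so that `σ` takes 0 to `a` and 1 to
  -- `b`.
  b′ : Fin (2 + m)
  b′ = transpose zero a b
  σ σ⁻¹ ρ : Fin (2 + m) → Fin (2 + m)
  σ   = transpose zero a ∘ transpose (suc zero) b′
  σ⁻¹ = transpose (suc zero) b′ ∘ transpose zero a
  ρ   = σ⁻¹ ∘ π ∘ σ

  σσ⁻¹ : ∀ x → σ (σ⁻¹ x) ≡ x
  σσ⁻¹ x = trans (cong (transpose zero a) (transpose-involutive (suc zero) b′ (transpose zero a x))) (transpose-involutive zero a x)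
  σ⁻¹σ : ∀ x → σ⁻¹ (σ x) ≡ x
  σ⁻¹σ x = trans (cong (transpose (suc zero) b′) (transpose-involutive zero a (transpose (suc zero) b′ x))) (transpose-involutive (suc zero) b′ x)

  b′≢0 : zero ≢ b′
  b′≢0 e = a≢b (transpose-injective zero a (trans (transpose-right zero a) e))
  σ0 : σ zero ≡ a
  σ0 = trans (cong (transpose zero a) (transpose-other (suc zero) b′ (λ ()) b′≢0)) (transpose-left zero a)
  σ1 : σ (suc zero) ≡ b
  σ1 = trans (cong (transpose zero a) (transpose-left (suc zero) b′)) (transpose-involutive zero a b)

  fixes : ∀ {x y} → σ x ≡ y → π y ≡ y → ρ x ≡ x
  fixes {x} refl e = trans (cong σ⁻¹ e) (σ⁻¹σ x)
  ρ0 : ρ zero ≡ zero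
  ρ0 = fixes σ0 πa
  ρ1 : ρ (suc zero) ≡ suc zero
  ρ1 = fixes σ1 πb

  ρ-injective : Injective ρ
  ρ-injective e = transpose-injective (suc zero) b′ (transpose-injective zero a
    (inj (transpose-injective zero a (transpose-injective (suc zero) b′ e))))

  πσ≗σρ : ∀ x → π (σ x) ≡ σ (ρ x)
  πσ≗σρ x = sym (σσ⁻¹ (π (σ x)))

  σ-flip : ∀ x → transpose a b (σ x) ≡ σ (flip x)
  σ-flip zero          = trans (cong (transpose a b) σ0) (trans (transpose-left a b) (sym σ1))
  σ-flip (suc zero)    = trans (cong (transpose a b) σ1) (trans (transpose-right a b) (sym σ0))
  σ-flip (suc (suc x)) = transpose-other a b
    (λ e → case-0 (σ-inj (trans e (sym σ0)))) (λ e → case-1 (σ-inj (trans e (sym σ1))))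
    where
    σ-inj : Injective σ
    σ-inj = Conjugation.σ-injective σ σ⁻¹ σσ⁻¹ σ⁻¹σ {π} {ρ} πσ≗σρ
    case-0 : suc (suc x) ≢ zero
    case-0 ()
    case-1 : suc (suc x) ≢ suc zero
    case-1 ()

  module C  = Conjugation σ σ⁻¹ σσ⁻¹ σ⁻¹σ {π} {ρ} πσ≗σρ
  module C′ = Conjugation σ σ⁻¹ σσ⁻¹ σ⁻¹σ {transpose a b ∘ π} {flip ∘ ρ}
    (λ x → trans (cong (transpose a b) (πσ≗σρ x)) (σ-flip (ρ x)))

-- Full cycles as Eulerian tours

-- The recursion follows that of `walksₖ`, with the orders kept instead of counted, so that the two
-- can be compared by induction on `k`.
ordersₖ : ℕ → List A → List (List A)
ordersₖ zero    L = [] ∷ []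
ordersₖ (suc k) L = concatMap (λ (y , L′) → map (y ∷_) (ordersₖ k L′)) (picks L)

orders : List A → List (List A)
orders L = ordersₖ (length L) L

map-proj₁-picks : (L : List A) → map proj₁ (picks L) ≡ L
map-proj₁-picks []      = refl
map-proj₁-picks (x ∷ L) = cong (x ∷_) (trans (sym (map-∘ (picks L))) (map-proj₁-picks L))

picks-∈ : {y : A} {L : List A} → y ∈ L → ∃ λ L′ → (y , L′) ∈ picks L
picks-∈ {y = y} {L} y∈ with (_ , L′) , p , refl ← ∈-map⁻ proj₁ {xs = picks L} (subst (y ∈_) (sym (map-proj₁-picks L)) y∈) = L′ , p

ordersₖ-∈⁻ : ∀ k {L : List A} {o} → o ∈ ordersₖ (suc k) L →
  ∃ λ y → ∃ λ L′ → ∃ λ o′ → o ≡ y ∷ o′ × (y , L′) ∈ picks L × o′ ∈ ordersₖ k L′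
ordersₖ-∈⁻ k {L} o∈ with (y , L′) , p , r ← find (∈-concatMap⁻ (λ (y , L′) → map (y ∷_) (ordersₖ k L′)) {xs = picks L} o∈)
  with o′ , o′∈ , refl ← ∈-map⁻ (y ∷_) r = y , L′ , o′ , refl , p , o′∈

orders-↭ : ∀ k {L : List A} {o} → length L ≡ k → o ∈ ordersₖ k L → o ↭ L
orders-↭ zero    {[]} e (here refl) = ↭-refl
orders-↭ (suc k) {L}  e o∈ with y , L′ , o′ , refl , p , o′∈ ← ordersₖ-∈⁻ k {L} o∈ =
  ↭-trans (prep y (orders-↭ k (suc-injective (trans (sym (Perm.↭-length (picks-↭ p))) e)) o′∈)) (↭-sym (picks-↭ p))

↭⇒∈-orders : {L o : List A} → o ↭ L → o ∈ orders L
↭⇒∈-orders {L = L} {o} p = subst (λ k → o ∈ ordersₖ k L) (Perm.↭-length p) (go o p)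
  where
  go : ∀ o {L} → o ↭ L → o ∈ ordersₖ (length o) L
  go []      p = here refl
  go (y ∷ o) {L} p with L′ , r ← picks-∈ (Perm.∈-resp-↭ p (here refl)) =
    ∈-concatMap⁺ (λ (y , L′) → map (y ∷_) (ordersₖ (length o) L′)) {xs = picks L}
      (lose r (∈-map⁺ (y ∷_) (go o (Perm.drop-∷ (↭-trans p (picks-↭ r))))))

unique-map⇒injective : {B : Set} (f : A → B) {xs : List A} → Unique (map f xs) →
  ∀ {x y} → x ∈ xs → y ∈ xs → f x ≡ f y → x ≡ y
unique-map⇒injective f u        (here refl) (here refl) e = refl
unique-map⇒injective f (h ∷ u)  (here refl) (there y∈)  e = ⊥-elim (All.lookup h (∈-map⁺ f y∈) e)
unique-map⇒injective f (h ∷ u)  (there x∈)  (here refl) e = ⊥-elim (All.lookup h (∈-map⁺ f x∈) (sym e))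
unique-map⇒injective f (h ∷ u)  (there x∈)  (there y∈)  e = unique-map⇒injective f u x∈ y∈ e

Unique-resp-↭ : {L M : List A} → L ↭ M → Unique M → Unique L
Unique-resp-↭ ↭.refl         u             = u
Unique-resp-↭ (prep x p)     (h ∷ u)       = Perm.All-resp-↭ (↭-sym p) h ∷ Unique-resp-↭ p u
Unique-resp-↭ (swap x y p)   ((y≢x ∷ hy) ∷ hx ∷ u) =
  (y≢x ∘ sym ∷ Perm.All-resp-↭ (↭-sym p) hx) ∷ Perm.All-resp-↭ (↭-sym p) hy ∷ Unique-resp-↭ p u
Unique-resp-↭ (↭.trans p r)  u             = Unique-resp-↭ p (Unique-resp-↭ r u)

ordersₖ-unique : ∀ k {L : List A} → Unique L → Unique (ordersₖ k L)
ordersₖ-unique zero    u = [] ∷ []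
ordersₖ-unique (suc k) {L} u = concatMap-unique _ (Uniq.map⁻ picks-unique)
  (λ p → Uniq.map⁺ ∷-injectiveʳ (ordersₖ-unique k (tail (Unique-resp-↭ (↭-sym (picks-↭ p)) u))))
  (λ p r z∈ z∈′ → let (_ , _ , e) = ∈-map⁻ _ z∈ ; (_ , _ , e′) = ∈-map⁻ _ z∈′ in
     unique-map⇒injective proj₁ picks-unique p r (∷-injectiveˡ (trans (sym e) e′)))
  where
  picks-unique : Unique (map proj₁ (picks L))
  picks-unique = subst Unique (sym (map-proj₁-picks L)) u
  tail : ∀ {x} {xs : List _} → Unique (x ∷ xs) → Unique xs
  tail (_ ∷ u) = u

-- With equal ends this is a condition on a cyclic order opened at x. It serves both for tours,
-- where a head meets the next tail, and for cycles of a map, where each point goes to the next.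
Chain : (A → A → Set) → A → List A → A → Set
Chain R x []      z = R x z
Chain R x (y ∷ o) z = R x y × Chain R y o z

chain? : {R : A → A → Set} → (∀ x y → Dec (R x y)) → ∀ x o z → Dec (Chain R x o z)
chain? R? x []      z = R? x z
chain? R? x (y ∷ o) z = R? x y ×-dec chain? R? y o z

Chain-map : {R S : A → A → Set} → (∀ {x y} → R x y → S x y) → ∀ {x} o {z} → Chain R x o z → Chain S x o z
Chain-map h []      r       = h r
Chain-map h (y ∷ o) (r , c) = h r , Chain-map h o c

Chain-zip : {R S : A → A → Set} → ∀ {x} o {z} → Chain R x o z → Chain S x o z →
  ∀ {a} → a ∈ x ∷ o → ∃ λ b → R a b × S a b
Chain-zip []      r       s       (here refl) = _ , r , s
Chain-zip (y ∷ o) (r , _) (s , _) (here refl) = y , r , s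
Chain-zip (y ∷ o) (_ , c) (_ , d) (there a∈)  = Chain-zip o c d a∈

module _ (g f : Fin n → Fin q) where

  private
    edge : Fin n → Edge q
    edge x = g x , f x

  match? : ∀ x y → Dec (f x ≡ g y)
  match? x y = f x ≟ g y

  walks-orders : ∀ k x z (L : List (Fin n)) →
    walksₖ k (f x) (g z) (map edge L) ≡ ∑[ o ∈ ordersₖ k L ] 𝟙 (chain? match? x o z)
  walks-orders zero    x z L = sym (+-identityʳ _)
  walks-orders (suc k) x z L = begin
    walksₖ (suc k) (f x) (g z) (map edge L)
      ≡⟨ ∑-picks-map edge L _ ⟩
    ∑ (picks L) (λ (y , L′) → 𝟙 (f x ≟ g y) * walksₖ k (f y) (g z) (map edge L′))
      ≡⟨ ∑-cong (picks L) (λ (y , L′) → begin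
           𝟙 (f x ≟ g y) * walksₖ k (f y) (g z) (map edge L′)
             ≡⟨ cong (𝟙 (f x ≟ g y) *_) (walks-orders k y z L′) ⟩
           𝟙 (f x ≟ g y) * ∑ (ordersₖ k L′) (λ o → 𝟙 (chain? match? y o z))
             ≡⟨ ∑-*ˡ (ordersₖ k L′) (𝟙 (f x ≟ g y)) _ ⟨
           ∑[ o ∈ ordersₖ k L′ ] (𝟙 (f x ≟ g y) * 𝟙 (chain? match? y o z))
             ≡⟨ ∑-cong (ordersₖ k L′) (λ o → 𝟙-×-dec (f x ≟ g y) (chain? match? y o z)) ⟨
           ∑[ o ∈ ordersₖ k L′ ] 𝟙 (chain? match? x (y ∷ o) z)
             ≡⟨ ∑-map (y ∷_) (ordersₖ k L′) _ ⟨
           ∑[ o ∈ map (y ∷_) (ordersₖ k L′) ] 𝟙 (chain? match? x o z) ∎) ⟩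
    ∑ (picks L) (λ (y , L′) → ∑[ o ∈ map (y ∷_) (ordersₖ k L′) ] 𝟙 (chain? match? x o z))
      ≡⟨ ∑-concatMap _ (picks L) _ ⟨
    ∑[ o ∈ ordersₖ (suc k) L ] 𝟙 (chain? match? x o z) ∎

  tours-orders : ∀ x (L : List (Fin n)) →
    tours (map edge (x ∷ L)) ≡ ∑[ o ∈ orders L ] 𝟙 (chain? match? x o x)
  tours-orders x L = trans (cong (λ k → walksₖ k (f x) (g x) (map edge L)) (length-map edge L))
    (walks-orders (length L) x x L)

iter-suc : (η : Map n) (j : ℕ) (x : Fin n) → iter η j (η x) ≡ η (iter η j x)
iter-suc η zero    x = refl
iter-suc η (suc j) x = cong η (iter-suc η j x)

trail : Map n → ℕ → Fin n → List (Fin n)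
trail η zero    x = []
trail η (suc k) x = η x ∷ trail η k (η x)

length-trail : (η : Map n) (k : ℕ) (x : Fin n) → length (trail η k x) ≡ k
length-trail η zero    x = refl
length-trail η (suc k) x = cong suc (length-trail η k (η x))

trail-applyUpTo : (η : Map n) (k : ℕ) (x : Fin n) → applyUpTo (λ i → iter η (suc i) x) k ≡ trail η k x
trail-applyUpTo η zero    x = refl
trail-applyUpTo η (suc k) x = cong (η x ∷_) (trans
  (applyUpTo-cong k (λ i → sym (iter-suc η (suc i) x))) (trail-applyUpTo η k (η x)))
  where
  applyUpTo-cong : ∀ k {φ ψ : ℕ → Fin _} → (∀ i → φ i ≡ ψ i) → applyUpTo φ k ≡ applyUpTo ψ k
  applyUpTo-cong zero    h = refl
  applyUpTo-cong (suc k) h = cong₂ _∷_ (h 0) (applyUpTo-cong k (h ∘ suc))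

orbit-list : (ζ : Map (suc m)) → map (λ i → iter ζ i zero) (upTo (suc m)) ≡ zero ∷ trail ζ m zero
orbit-list {m} ζ = cong (zero ∷_) (trans (map-applyUpTo suc (λ i → iter ζ i zero) m) (trail-applyUpTo ζ m zero))

Step : Map n → Fin n → Fin n → Set
Step η x y = η x ≡ y

chain-trail : (η : Map n) (k : ℕ) (x : Fin n) → Chain (Step η) x (trail η k x) (iter η (suc k) x)
chain-trail η zero    x = refl
chain-trail η (suc k) x = refl , subst (Chain (Step η) (η x) (trail η k (η x))) (iter-suc η (suc k) x) (chain-trail η k (η x))

trail-chain : (η : Map n) (o : List (Fin n)) {x z : Fin n} → Chain (Step η) x o z →
  o ≡ trail η (length o) x × iter η (suc (length o)) x ≡ z
trail-chain η []      r = refl , r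
trail-chain η (y ∷ o) {x} (refl , c) with e₁ , e₂ ← trail-chain η o c =
  cong (η x ∷_) e₁ , trans (sym (iter-suc η (suc (length o)) x)) e₂

along : Fin n → List (Fin n) → Fin n → Vec (Fin n) n → Vec (Fin n) n
along x []      z base = base [ x ]≔ z
along x (y ∷ o) z base = along y o z base [ x ]≔ y

chain-update : (v : Vec (Fin n) n) (x w : Fin n) {y z : Fin n} (o : List (Fin n)) → x ∉ y ∷ o →
  Chain (Step (lookup v)) y o z → Chain (Step (lookup (v [ x ]≔ w))) y o z
chain-update v x w []      x∉ r       = trans (lookup∘update′ (λ e → x∉ (here (sym e))) v w) r
chain-update v x w (_ ∷ o) x∉ (r , c) = trans (lookup∘update′ (λ e → x∉ (here (sym e))) v w) r , chain-update v x w o (x∉ ∘ there) c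

chain-along : (x : Fin n) (o : List (Fin n)) (z : Fin n) (base : Vec (Fin n) n) → Unique (x ∷ o) →
  Chain (Step (lookup (along x o z base))) x o z
chain-along x []      z base u       = lookup∘update x base z
chain-along x (y ∷ o) z base (h ∷ u) = lookup∘update x (along y o z base) y ,
  chain-update (along y o z base) x y o (λ x∈ → All.lookup h x∈ refl) (chain-along y o z base u)

module _ {m : ℕ} where

  -- A cyclic order is opened at `zero`, like the orbit in `IsFullCycle`, so the other points are
  -- the ones to be ordered.
  nonzero : List (Fin (suc m))
  nonzero = List.tabulate suc

  follows? : (v : Vec (Fin (suc m)) (suc m)) (o : List (Fin (suc m))) → Dec (Chain (Step (lookup v)) zero o zero)
  follows? v o = chain? (λ x y → lookup v x ≟ y) zero o zero

  orders-cover : ∀ {o} → o ∈ orders nonzero → zero ∷ o ↭ allFin (suc m)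
  orders-cover o∈ = prep zero (orders-↭ (length nonzero) refl o∈)

  orders-length : ∀ {o} → o ∈ orders nonzero → length o ≡ m
  orders-length o∈ = trans (Perm.↭-length (orders-↭ (length nonzero) {nonzero} refl o∈)) (length-tabulate {A = Fin (suc m)} suc)

  orders-unique : ∀ {o} → o ∈ orders nonzero → Unique (zero ∷ o)
  orders-unique o∈ = Unique-resp-↭ (orders-cover o∈) (Uniq.allFin⁺ (suc m))

  follows⇒full : ∀ v {o} → o ∈ orders nonzero → Chain (Step (lookup v)) zero o zero → IsFullCycle (lookup v)
  follows⇒full v {o} o∈ c with e₁ , e₂ ← trail-chain (lookup v) o c rewrite orders-length o∈ =
    subst Unique (trans (cong (zero ∷_) e₁) (sym (orbit-list (lookup v)))) (orders-unique o∈) , e₂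

  full⇒cover : ∀ (ζ : Map (suc m)) → IsFullCycle ζ → zero ∷ trail ζ m zero ↭ allFin (suc m)
  full⇒cover ζ (u , _) = unique-⊆⇒↭ (subst Unique (orbit-list ζ) u) (λ {x} _ → ∈-allFin x)
    (≤-reflexive (trans (length-allFin (suc m)) (cong suc (sym (length-trail ζ m zero)))))

  full⇒follows : ∀ (ζ : Map (suc m)) → IsFullCycle ζ → Chain (Step ζ) zero (trail ζ m zero) zero
  full⇒follows ζ (_ , e) = subst (Chain (Step ζ) zero (trail ζ m zero)) e (chain-trail ζ m zero)

  -- A full cycle follows only the order in which its orbit visits the points, and a map that
  -- follows an order of all points is a full cycle.
  ∑-follows : ∀ v → ∑[ o ∈ orders nonzero ] 𝟙 (follows? v o) ≡ 𝟙 (isFullCycle? (lookup v))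
  ∑-follows v = go (isFullCycle? (lookup v))
    where
    path = trail (lookup v) m zero
    suc-inj : ∀ {i j : Fin m} → suc i ≡ suc j → i ≡ j
    suc-inj refl = refl
    go : (d : Dec (IsFullCycle (lookup v))) → ∑[ o ∈ orders nonzero ] 𝟙 (follows? v o) ≡ 𝟙 d
    go (yes full) = trans
      (∑-unique (λ o → 𝟙 (follows? v o)) (ordersₖ-unique (length nonzero) {nonzero} (Uniq.tabulate⁺ suc-inj))
        (↭⇒∈-orders (Perm.drop-∷ (full⇒cover (lookup v) full)))
        (λ {o} o∈ o≢ → 𝟙-no (follows? v o) (λ c → o≢ (trans (proj₁ (trail-chain (lookup v) o c))
          (cong (λ k → trail (lookup v) k zero) (orders-length o∈))))))
      (𝟙-yes (follows? v path) (full⇒follows (lookup v) full))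
    go (no ¬full) = ∑-zero (orders nonzero) (λ {o} o∈ → 𝟙-no (follows? v o) (¬full ∘ follows⇒full v o∈))

  module _ (g f : Fin (suc m) → Fin q) where

    matches? : (ζ : Map (suc m)) → Dec (∀ x → g (ζ x) ≡ f x)
    matches? ζ = all? (λ x → g (ζ x) ≟ f x)

    -- An order of all points is followed by a single map `w`. For this map the matching condition
    -- says that consecutive edges of the order fit together.
    ∑-matches : ∀ {o} → o ∈ orders nonzero →
      ∑[ v ∈ allVecs (suc m) (suc m) ] (𝟙 (follows? v o) * 𝟙 (matches? (lookup v))) ≡ 𝟙 (chain? (match? g f) zero o zero)
    ∑-matches {o} o∈ = begin
      ∑[ v ∈ allVecs (suc m) (suc m) ] (𝟙 (follows? v o) * 𝟙 (matches? (lookup v)))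
        ≡⟨ ∑-unique _ (allVecs-unique (suc m) (suc m)) (∈-allVecs w)
             (λ {v} _ v≢w → cong (_* 𝟙 (matches? (lookup v))) (𝟙-no (follows? v o) (v≢w ∘ determined))) ⟩
      𝟙 (follows? w o) * 𝟙 (matches? (lookup w))
        ≡⟨ cong (_* 𝟙 (matches? (lookup w))) (𝟙-yes (follows? w o) w-chain) ⟩
      1 * 𝟙 (matches? (lookup w))
        ≡⟨ *-identityˡ _ ⟩
      𝟙 (matches? (lookup w))
        ≡⟨ 𝟙-cong (matches? (lookup w)) (chain? (match? g f) zero o zero)
             (λ h → Chain-map (λ {x} e → trans (sym (h x)) (cong g e)) o w-chain)
             (λ c x → let (y , e₁ , e₂) = Chain-zip o w-chain c (covers x) in trans (cong g e₁) (sym e₂)) ⟩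
      𝟙 (chain? (match? g f) zero o zero) ∎
      where
      w : Vec (Fin (suc m)) (suc m)
      w = along zero o zero (Vec.replicate (suc m) zero)
      w-chain : Chain (Step (lookup w)) zero o zero
      w-chain = chain-along zero o zero _ (orders-unique o∈)
      covers : ∀ x → x ∈ zero ∷ o
      covers x = Perm.∈-resp-↭ (↭-sym (orders-cover o∈)) (∈-allFin x)
      determined : ∀ {v} → Chain (Step (lookup v)) zero o zero → v ≡ w
      determined {v} c = lookup-ext (λ x → let (y , e₁ , e₂) = Chain-zip o c w-chain (covers x) in trans e₁ (sym e₂))

    -- Double count of the pairs of a map and an order that it follows: each full cycle has one
    -- order, and each order has one map.
    ∑-fullCycles-matches : ∑[ v ∈ allVecs (suc m) (suc m) ] (𝟙 (isFullCycle? (lookup v)) * 𝟙 (matches? (lookup v))) ≡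
      tours (List.tabulate (λ x → g x , f x))
    ∑-fullCycles-matches = begin
      ∑[ v ∈ V ] (𝟙 (isFullCycle? (lookup v)) * M v)
        ≡⟨ ∑-cong V (λ v → trans (cong (_* M v) (sym (∑-follows v))) (sym (∑-*ʳ (orders nonzero) (M v) _))) ⟩
      ∑[ v ∈ V ] ∑[ o ∈ orders nonzero ] (𝟙 (follows? v o) * M v)
        ≡⟨ ∑-swap V (orders nonzero) _ ⟩
      ∑[ o ∈ orders nonzero ] ∑[ v ∈ V ] (𝟙 (follows? v o) * M v)
        ≡⟨ ∑-cong-∈ (orders nonzero) ∑-matches ⟩
      ∑[ o ∈ orders nonzero ] 𝟙 (chain? (match? g f) zero o zero)
        ≡⟨ tours-orders g f zero nonzero ⟨
      tours (map (λ x → g x , f x) (zero ∷ nonzero))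
        ≡⟨ cong tours (map-tabulate id (λ x → g x , f x)) ⟩
      tours (List.tabulate (λ x → g x , f x)) ∎
      where
      V = allVecs (suc m) (suc m)
      M : Vec (Fin (suc m)) (suc m) → ℕ
      M v = 𝟙 (matches? (lookup v))

-- Colourings constant on cycles

Chain-pred : {R : A → A → Set} → ∀ {x} o {z} → Chain R x o z → ∀ {y} → y ∈ z ∷ o → ∃ λ a → R a y
Chain-pred []      r       (here refl)         = _ , r
Chain-pred (y ∷ o) (r , c) (here refl)         = Chain-pred o c (here refl)
Chain-pred (y ∷ o) (r , c) (there (here refl)) = _ , r
Chain-pred (y ∷ o) (r , c) (there (there p))   = Chain-pred o c (there p)

-- The orbit meets every point, so `ζ` has a section. The section is injective, hence onto by
-- finiteness, and `ζ` is injective on its values.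
full⇒injective : (ζ : Map (suc m)) → IsFullCycle ζ → Injective ζ
full⇒injective {m} ζ full {x} {x′} e = step (preimage x) (preimage x′)
  where
  predecessor : ∀ y → ∃ λ x → ζ x ≡ y
  predecessor y = Chain-pred (trail ζ m zero) (full⇒follows ζ full) (Perm.∈-resp-↭ (↭-sym (full⇒cover ζ full)) (∈-allFin y))
  ζ⁻¹ : Fin (suc m) → Fin (suc m)
  ζ⁻¹ y = proj₁ (predecessor y)
  ζζ⁻¹ : ∀ y → ζ (ζ⁻¹ y) ≡ y
  ζζ⁻¹ y = proj₂ (predecessor y)
  ζ⁻¹-injective : Injective ζ⁻¹
  ζ⁻¹-injective {y} {y′} e = trans (sym (ζζ⁻¹ y)) (trans (cong ζ e) (ζζ⁻¹ y′))
  preimage : ∀ x → ∃ λ y → y ∈ allFin (suc m) × x ≡ ζ⁻¹ y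
  preimage x = ∈-map⁻ ζ⁻¹ (Perm.∈-resp-↭
    (↭-sym (injective⇒map-↭ ζ⁻¹ (Uniq.allFin⁺ (suc m)) ∈-allFin ζ⁻¹-injective)) (∈-allFin x))
  step : (∃ λ y → y ∈ allFin (suc m) × x ≡ ζ⁻¹ y) → (∃ λ y → y ∈ allFin (suc m) × x′ ≡ ζ⁻¹ y) → x ≡ x′
  step (y , _ , refl) (y′ , _ , refl) = cong ζ⁻¹ (trans (sym (ζζ⁻¹ y)) (trans e (ζζ⁻¹ y′)))

Invariant : Map n → Vec (Fin q) n → Set
Invariant η f = ∀ x → lookup f (η x) ≡ lookup f x

invariant? : (η : Map n) (f : Vec (Fin q) n) → Dec (Invariant η f)
invariant? η f = all? (λ x → lookup f (η x) ≟ lookup f x)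

invariants : Map n → ℕ → ℕ
invariants η q = ∑[ f ∈ allVecs q _ ] 𝟙 (invariant? η f)

invariants₌ : Map n → Fin n → Fin n → ℕ → ℕ
invariants₌ η a b q = ∑[ f ∈ allVecs q _ ] (𝟙 (invariant? η f) * 𝟙 (lookup f a ≟ lookup f b))

invariant-iter : (η : Map n) (f : Vec (Fin q) n) → Invariant η f → ∀ j x → lookup f (iter η j x) ≡ lookup f x
invariant-iter η f h zero    x = refl
invariant-iter η f h (suc j) x = trans (h (iter η j x)) (invariant-iter η f h j x)

iter-+ : (η : Map n) → ∀ i j x → iter η (i + j) x ≡ iter η i (iter η j x)
iter-+ η zero    j x = refl
iter-+ η (suc i) j x = cong η (iter-+ η i j x)

∑-allVecs-1 : ∀ q k → ∑[ _ ∈ allVecs q k ] 1 ≡ q ^ k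
∑-allVecs-1 q zero    = refl
∑-allVecs-1 q (suc k) = begin
  ∑[ _ ∈ allVecs q (suc k) ] 1                  ≡⟨ ∑-allVecs-∷ q k _ ⟩
  ∑[ _ ∈ allFin q ] ∑[ _ ∈ allVecs q k ] 1      ≡⟨ ∑-const (allFin q) _ ⟩
  length (allFin q) * ∑ (allVecs q k) (λ _ → 1) ≡⟨ cong₂ _*_ (length-allFin q) (∑-allVecs-1 q k) ⟩
  q ^ suc k                                     ∎

-- Colours of cycles are stored along the list of cycle minima, since `cycles` is the length of that
-- list. A colour is looked up by a proof of membership.
value : {ms : List A} → Vec B (length ms) → ∀ {y} → y ∈ ms → B
value {ms = _ ∷ _} (b ∷ g) (here _)  = b
value {ms = _ ∷ _} (b ∷ g) (there p) = value g p

value-irrelevant : {ms : List A} (g : Vec B (length ms)) → Unique ms → ∀ {y} (p r : y ∈ ms) → value g p ≡ value g r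
value-irrelevant {ms = _ ∷ _} (b ∷ g) u       (here _)    (here _)    = refl
value-irrelevant {ms = _ ∷ _} (b ∷ g) (h ∷ u) (here refl) (there r)   = ⊥-elim (All.lookup h r refl)
value-irrelevant {ms = _ ∷ _} (b ∷ g) (h ∷ u) (there p)   (here refl) = ⊥-elim (All.lookup h p refl)
value-irrelevant {ms = _ ∷ _} (b ∷ g) (h ∷ u) (there p)   (there r)   = value-irrelevant g u p r

restrict-value : (ms : List A) (g : Vec B (length ms)) (h : A → B) → (∀ {y} (p : y ∈ ms) → h y ≡ value g p) →
  Vec.map h (fromList ms) ≡ g
restrict-value []       []      h e = refl
restrict-value (_ ∷ ms) (b ∷ g) h e = cong₂ _∷_ (e (here refl)) (restrict-value ms g h (e ∘ there))

value-restrict : (ms : List A) (h : A → B) → ∀ {y} (p : y ∈ ms) → value (Vec.map h (fromList ms)) p ≡ h y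
value-restrict (_ ∷ ms) h (here refl) = refl
value-restrict (_ ∷ ms) h (there p)   = value-restrict ms h p

module Orbits (η : Map n) (inj : Injective η) where

  iter-injective : ∀ j → Injective (iter η j)
  iter-injective zero    e = e
  iter-injective (suc j) e = iter-injective j (inj e)

  -- Two of the n + 1 first iterates collide, and injectivity cancels their common steps. The bound
  -- matters because `IsCycleMin` tests only the iterates below n.
  period : ∀ x → ∃ λ p → suc p ≤ n × iter η (suc p) x ≡ x
  period x with i , j , i<j , e ← pigeonhole (n<1+n n) (λ (i : Fin (suc n)) → iter η (toℕ i) x) = collide i j i<j e
    where
    collide : ∀ (i j : Fin (suc n)) → toℕ i < toℕ j → iter η (toℕ i) x ≡ iter η (toℕ j) x →
      ∃ λ p → suc p ≤ n × iter η (suc p) x ≡ x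
    collide i j i<j e = d , ≤-trans (≤-trans (m≤n+m (suc d) (toℕ i)) (≤-reflexive (sym j≡))) (toℕ≤pred[n] j) ,
      sym (iter-injective (toℕ i) (trans e (trans (cong (λ k → iter η k x) j≡) (iter-+ η (toℕ i) (suc d) x))))
      where
      d = toℕ j ∸ suc (toℕ i)
      j≡ : toℕ j ≡ toℕ i + suc d
      j≡ = sym (trans (+-suc (toℕ i) d) (m+[n∸m]≡n i<j))

  iter-multiple : ∀ {p x} → iter η p x ≡ x → ∀ k → iter η (k * p) x ≡ x
  iter-multiple e zero    = refl
  iter-multiple {p} {x} e (suc k) = trans (iter-+ η p (k * p) x) (trans (cong (iter η p) (iter-multiple e k)) e)

  cycleMin⇒≤ : ∀ {x} → IsCycleMin η x → ∀ j → toℕ x ≤ toℕ (iter η j x)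
  cycleMin⇒≤ {x} h j = subst (λ y → toℕ x ≤ toℕ y) (sym reduce)
      (All.lookup h (∈-upTo⁺ (<-≤-trans (m%n<n j (suc p)) (proj₁ (proj₂ (period x))))))
    where
    p = proj₁ (period x)
    reduce : iter η j x ≡ iter η (j % suc p) x
    reduce = trans (cong (λ k → iter η k x) (m≡m%n+[m/n]*n j (suc p)))
      (trans (iter-+ η (j % suc p) _ x) (cong (iter η (j % suc p)) (iter-multiple (proj₂ (proj₂ (period x))) (j / suc p))))

  iter-back : ∀ j x → ∃ λ k → iter η k (iter η j x) ≡ x
  iter-back j x with p , _ , e ← period x = j * suc p ∸ j ,
    trans (sym (iter-+ η (j * suc p ∸ j) j x))
      (trans (cong (λ k → iter η k x) (m∸n+n≡m (m≤m*n j (suc p)))) (iter-multiple e j))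

  -- Descent: a point that fails the test has a smaller iterate.
  root : ∀ x → ∃ λ y → IsCycleMin η y × ∃ λ j → iter η j x ≡ y
  root x = go x (<-wellFounded (toℕ x))
    where
    go : ∀ x → Acc _<_ (toℕ x) → ∃ λ y → IsCycleMin η y × ∃ λ j → iter η j x ≡ y
    go x (acc rec) with isCycleMin? η x
    ... | yes h = x , h , 0 , refl
    ... | no ¬h with j , _ , ≰ ← find (¬All⇒Any¬ (λ j → toℕ x ℕ.≤? toℕ (iter η j x)) (upTo n) ¬h)
        with y , h , k , e ← go (iter η j x) (rec (≰⇒> ≰)) = y , h , k + j , trans (iter-+ η k j x) e

  root-unique : ∀ {y y′} → IsCycleMin η y → IsCycleMin η y′ → ∀ j → iter η j y ≡ y′ → y ≡ y′
  root-unique {y} h h′ j refl with k , e ← iter-back j y =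
    toℕ-injective (≤-antisym (cycleMin⇒≤ h j) (subst (λ z → toℕ (iter η j y) ≤ toℕ z) e (cycleMin⇒≤ h′ k)))

  -- An invariant colouring is determined by its colours at the cycle minima, and these are free.
  -- The proof counts the pairs of an invariant colouring and its restriction in two ways.
  invariants-cycles : ∀ q → invariants η q ≡ q ^ cycles η
  invariants-cycles q = begin
    ∑[ f ∈ F ] 𝟙 (invariant? η f)
      ≡⟨ ∑-cong F (λ f → trans (sym (*-identityʳ _)) (cong (𝟙 (invariant? η f) *_) (sym (unit f)))) ⟩
    ∑[ f ∈ F ] (𝟙 (invariant? η f) * ∑ G (λ g → 𝟙 (restrict f ≟ᵥ g)))
      ≡⟨ ∑-cong F (λ f → ∑-*ˡ G (𝟙 (invariant? η f)) _) ⟨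
    ∑[ f ∈ F ] ∑[ g ∈ G ] (𝟙 (invariant? η f) * 𝟙 (restrict f ≟ᵥ g))
      ≡⟨ ∑-swap F G _ ⟩
    ∑[ g ∈ G ] ∑[ f ∈ F ] (𝟙 (invariant? η f) * 𝟙 (restrict f ≟ᵥ g))
      ≡⟨ ∑-cong G one ⟩
    ∑[ _ ∈ G ] 1
      ≡⟨ ∑-allVecs-1 q (cycles η) ⟩
    q ^ cycles η ∎
    where
    F = allVecs q n
    G = allVecs q (cycles η)
    mins = filter (isCycleMin? η) (allFin n)
    _≟ᵥ_ = ≡-dec (_≟_ {q})

    restrict : Vec (Fin q) n → Vec (Fin q) (cycles η)
    restrict f = Vec.map (lookup f) (fromList mins)

    unit : ∀ f → ∑[ g ∈ G ] 𝟙 (restrict f ≟ᵥ g) ≡ 1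
    unit f = trans (∑-unique _ (allVecs-unique q (cycles η)) (∈-allVecs (restrict f))
      (λ {g} _ g≢ → 𝟙-no (restrict f ≟ᵥ g) (g≢ ∘ sym))) (𝟙-yes (restrict f ≟ᵥ restrict f) refl)

    mins-unique : Unique mins
    mins-unique = Uniq.filter⁺ (isCycleMin? η) (Uniq.allFin⁺ n)

    r : Fin n → Fin n
    r x = proj₁ (root x)
    r-min : ∀ x → IsCycleMin η (r x)
    r-min x = proj₁ (proj₂ (root x))
    r∈ : ∀ x → r x ∈ mins
    r∈ x = ∈-filter⁺ (isCycleMin? η) (∈-allFin (r x)) (r-min x)
    reach : ∀ x → ∃ λ j → iter η j x ≡ r x
    reach x = proj₂ (proj₂ (root x))

    r-fixed : ∀ {y} → IsCycleMin η y → r y ≡ y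
    r-fixed {y} h with j , e ← reach y = sym (root-unique h (r-min y) j e)

    r-η : ∀ x → r (η x) ≡ r x
    r-η x with j , e ← reach (η x) with i , e′ ← reach x with k , e″ ← iter-back i x =
      sym (root-unique (r-min x) (r-min (η x)) (j + suc k) (begin
        iter η (j + suc k) (r x)           ≡⟨ iter-+ η j (suc k) (r x) ⟩
        iter η j (η (iter η k (r x)))      ≡⟨ cong (λ y → iter η j (η (iter η k y))) e′ ⟨
        iter η j (η (iter η k (iter η i x))) ≡⟨ cong (iter η j ∘ η) e″ ⟩
        iter η j (η x)                     ≡⟨ e ⟩
        r (η x)                            ∎))

    one : ∀ g → ∑[ f ∈ F ] (𝟙 (invariant? η f) * 𝟙 (restrict f ≟ᵥ g)) ≡ 1
    one g = trans (∑-unique _ (allVecs-unique q n) (∈-allVecs extend) vanish)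
      (cong₂ _*_ (𝟙-yes (invariant? η extend) extend-invariant) (𝟙-yes (restrict extend ≟ᵥ g) extend-restrict))
      where
      extend : Vec (Fin q) n
      extend = Vec.tabulate (λ x → value g (r∈ x))

      lookup-extend : ∀ x → lookup extend x ≡ value g (r∈ x)
      lookup-extend = lookup∘tabulate (λ x → value g (r∈ x))

      value-cong : ∀ {y y′} → y ≡ y′ → (p : y ∈ mins) (p′ : y′ ∈ mins) → value g p ≡ value g p′
      value-cong refl = value-irrelevant g mins-unique

      extend-invariant : Invariant η extend
      extend-invariant x = trans (lookup-extend (η x)) (trans (value-cong (r-η x) _ _) (sym (lookup-extend x)))

      extend-restrict : restrict extend ≡ g
      extend-restrict = restrict-value mins g (lookup extend) (λ {y} p → trans (lookup-extend y)
        (value-cong (r-fixed (proj₂ (∈-filter⁻ (isCycleMin? η) {xs = allFin n} p))) _ p))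

      determined : ∀ f → Invariant η f → restrict f ≡ g → f ≡ extend
      determined f h e = lookup-ext (λ x → begin
        lookup f x                    ≡⟨ invariant-iter η f h (proj₁ (reach x)) x ⟨
        lookup f (iter η (proj₁ (reach x)) x) ≡⟨ cong (lookup f) (proj₂ (reach x)) ⟩
        lookup f (r x)                ≡⟨ value-restrict mins (lookup f) (r∈ x) ⟨
        value (restrict f) (r∈ x)     ≡⟨ cong (λ g → value g (r∈ x)) e ⟩
        value g (r∈ x)                ≡⟨ lookup-extend x ⟨
        lookup extend x               ∎)

      vanish : ∀ {f} → f ∈ F → f ≢ extend → 𝟙 (invariant? η f) * 𝟙 (restrict f ≟ᵥ g) ≡ 0
      vanish {f} _ f≢ = trans
        (𝟙-guard (invariant? η f) (λ h → 𝟙-no (restrict f ≟ᵥ g) (f≢ ∘ determined f h)))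
        (*-zeroʳ (𝟙 (invariant? η f)))

∑-𝟙≟ : (c : Fin q) → ∑[ i ∈ allFin q ] 𝟙 (i ≟ c) ≡ 1
∑-𝟙≟ c = trans (∑-unique _ (Uniq.allFin⁺ _) (∈-allFin c) (λ {i} _ → 𝟙-no (i ≟ c))) (𝟙-refl c)

joined⇒invariants : (η : Map n) (a b : Fin n) (q : ℕ) →
  (∀ (f : Vec (Fin q) n) → Invariant η f → lookup f a ≡ lookup f b) → invariants η q ≡ invariants₌ η a b q
joined⇒invariants η a b q h = ∑-cong (allVecs q _) (λ f → trans (sym (*-identityʳ _))
  (𝟙-guard (invariant? η f) (λ inv → sym (𝟙-yes (lookup f a ≟ lookup f b) (h f inv)))))

-- The set `S` is a union of cycles that contains `b` but not `a`. Exchanging two colours inside `S`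
-- keeps a colouring invariant, so the colour of `b` can be changed independently of that of `a`.
module Separated (η : Map n) (S : Fin n → Bool) (S-invariant : ∀ x → S (η x) ≡ S x)
  {a b : Fin n} (a∉S : S a ≡ false) (b∈S : S b ≡ true) (q : ℕ) where

  private
    F = allVecs q n
    Q = allFin q

  recolour : Fin q → Fin q → Vec (Fin q) n → Vec (Fin q) n
  recolour i j f = Vec.tabulate (λ x → if S x then transpose i j (lookup f x) else lookup f x)

  lookup-recolour : ∀ i j f x → lookup (recolour i j f) x ≡ (if S x then transpose i j (lookup f x) else lookup f x)
  lookup-recolour i j f = lookup∘tabulate (λ x → if S x then transpose i j (lookup f x) else lookup f x)

  recolour-involutive : ∀ i j f → recolour i j (recolour i j f) ≡ f
  recolour-involutive i j f = lookup-ext (λ x → trans (lookup-recolour i j (recolour i j f) x)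
    (trans (cong (λ c → if S x then transpose i j c else c) (lookup-recolour i j f x)) (twice (S x) (lookup f x))))
    where
    twice : ∀ s c → (if s then transpose i j (if s then transpose i j c else c) else (if s then transpose i j c else c)) ≡ c
    twice true  c = transpose-involutive i j c
    twice false c = refl

  recolour-injective : ∀ i j {f g} → recolour i j f ≡ recolour i j g → f ≡ g
  recolour-injective i j {f} {g} e =
    trans (sym (recolour-involutive i j f)) (trans (cong (recolour i j) e) (recolour-involutive i j g))

  recolour-invariant : ∀ i j f → Invariant η f → Invariant η (recolour i j f)
  recolour-invariant i j f h x = trans (lookup-recolour i j f (η x))
    (trans (cong₂ (λ s c → if s then transpose i j c else c) (S-invariant x) (h x)) (sym (lookup-recolour i j f x)))

  recoloured : ∀ i j →
    ∑[ f ∈ F ] (𝟙 (invariant? η f) * (𝟙 (i ≟ lookup f a) * 𝟙 (j ≟ lookup f b))) ≡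
    ∑[ f ∈ F ] (𝟙 (invariant? η f) * (𝟙 (i ≟ lookup f a) * 𝟙 (i ≟ lookup f b)))
  recoloured i j = trans
    (sym (∑-reindex (recolour i j) (allVecs-unique q n) ∈-allVecs (recolour-injective i j) _))
    (∑-cong F (λ f → cong₂ _*_
      (𝟙-cong (invariant? η (recolour i j f)) (invariant? η f)
        (λ h → subst (Invariant η) (recolour-involutive i j f) (recolour-invariant i j (recolour i j f) h))
        (recolour-invariant i j f))
      (cong₂ _*_
        (cong (λ c → 𝟙 (i ≟ c)) (trans (lookup-recolour i j f a) (cong (λ s → if s then transpose i j (lookup f a) else lookup f a) a∉S)))
        (trans (cong (λ c → 𝟙 (j ≟ c)) (trans (lookup-recolour i j f b) (cong (λ s → if s then transpose i j (lookup f b) else lookup f b) b∈S)))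
          (𝟙-cong (j ≟ transpose i j (lookup f b)) (i ≟ lookup f b)
            (λ e → trans (sym (transpose-right i j)) (trans (cong (transpose i j) e) (transpose-involutive i j (lookup f b))))
            (λ e → trans (sym (transpose-left i j)) (cong (transpose i j) e)))))))

  -- The invariant colourings are sorted by the colours i of `a` and j of `b`. Recolouring makes the
  -- count for (i , j) equal to the count for (i , i), so each i occurs q times.
  separated⇒invariants : invariants η q ≡ q * invariants₌ η a b q
  separated⇒invariants = begin
    ∑[ f ∈ F ] I f
      ≡⟨ ∑-cong F (λ f → sym (resolve f)) ⟩
    ∑[ f ∈ F ] ∑[ i ∈ Q ] ∑[ j ∈ Q ] (I f * (𝟙 (i ≟ lookup f a) * 𝟙 (j ≟ lookup f b)))
      ≡⟨ ∑-swap F Q _ ⟩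
    ∑[ i ∈ Q ] ∑[ f ∈ F ] ∑[ j ∈ Q ] (I f * (𝟙 (i ≟ lookup f a) * 𝟙 (j ≟ lookup f b)))
      ≡⟨ ∑-cong Q (λ i → ∑-swap F Q _) ⟩
    ∑[ i ∈ Q ] ∑[ j ∈ Q ] ∑[ f ∈ F ] (I f * (𝟙 (i ≟ lookup f a) * 𝟙 (j ≟ lookup f b)))
      ≡⟨ ∑-cong Q (λ i → ∑-cong Q (recoloured i)) ⟩
    ∑[ i ∈ Q ] ∑[ j ∈ Q ] D i
      ≡⟨ ∑-cong Q (λ i → trans (∑-const Q (D i)) (cong (_* D i) (length-allFin q))) ⟩
    ∑[ i ∈ Q ] (q * D i)
      ≡⟨ ∑-*ˡ Q q D ⟩
    q * ∑ Q D
      ≡⟨ cong (q *_) (trans (∑-swap Q F _) (∑-cong F collapse)) ⟩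
    q * invariants₌ η a b q ∎
    where
    I : Vec (Fin q) n → ℕ
    I f = 𝟙 (invariant? η f)
    D : Fin q → ℕ
    D i = ∑[ f ∈ F ] (I f * (𝟙 (i ≟ lookup f a) * 𝟙 (i ≟ lookup f b)))

    resolve : ∀ f → ∑[ i ∈ Q ] ∑[ j ∈ Q ] (I f * (𝟙 (i ≟ lookup f a) * 𝟙 (j ≟ lookup f b))) ≡ I f
    resolve f = begin
      ∑[ i ∈ Q ] ∑[ j ∈ Q ] (I f * (𝟙 (i ≟ lookup f a) * 𝟙 (j ≟ lookup f b)))
        ≡⟨ ∑-cong Q (λ i → trans (∑-*ˡ Q (I f) _) (cong (I f *_)
             (trans (∑-*ˡ Q (𝟙 (i ≟ lookup f a)) _) (trans (cong (𝟙 (i ≟ lookup f a) *_) (∑-𝟙≟ (lookup f b))) (*-identityʳ _))))) ⟩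
      ∑[ i ∈ Q ] (I f * 𝟙 (i ≟ lookup f a))
        ≡⟨ ∑-*ˡ Q (I f) _ ⟩
      I f * ∑ Q (λ i → 𝟙 (i ≟ lookup f a))
        ≡⟨ cong (I f *_) (∑-𝟙≟ (lookup f a)) ⟩
      I f * 1
        ≡⟨ *-identityʳ (I f) ⟩
      I f ∎

    collapse : ∀ f → ∑[ i ∈ Q ] (I f * (𝟙 (i ≟ lookup f a) * 𝟙 (i ≟ lookup f b))) ≡ I f * 𝟙 (lookup f a ≟ lookup f b)
    collapse f = trans (∑-*ˡ Q (I f) _) (cong (I f *_)
      (trans (∑-unique _ (Uniq.allFin⁺ q) (∈-allFin (lookup f a))
          (λ {i} _ i≢ → cong (_* 𝟙 (i ≟ lookup f b)) (𝟙-no (i ≟ lookup f a) i≢)))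
        (trans (cong (_* 𝟙 (lookup f a ≟ lookup f b)) (𝟙-refl (lookup f a))) (*-identityˡ _))))

-- Cycles before and after a transposition

Avoids : Map n → Fin n → Fin n → ℕ → Set
Avoids η a b t = ∀ s → s < t → iter η (suc s) b ≢ a × iter η (suc s) b ≢ b

module _ (η : Map n) (inj : Injective η) {a b : Fin n} (a≢b : a ≢ b) where

  -- When `b` returns to itself without meeting `a`, its cycle is complete and can serve as the set
  -- `S` of `Separated`.
  cycle-separates : ∀ t → Avoids η a b t → iter η (suc t) b ≡ b → ∀ q → invariants η q ≡ q * invariants₌ η a b q
  cycle-separates t avoids closes q = Separated.separated⇒invariants η (does ∘ onCycle?)
      (λ x → does-⇔ (mk⇔ (back x) (forth x)) (onCycle? (η x)) (onCycle? x))
      (dec-false (onCycle? a) a∉) (dec-true (onCycle? b) (0 , s≤s z≤n , refl)) q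
    where
    OnCycle : Fin n → Set
    OnCycle x = ∃ λ s → s < suc t × iter η s b ≡ x
    onCycle? : ∀ x → Dec (OnCycle x)
    onCycle? x = anyUpTo? (λ s → iter η s b ≟ x) (suc t)
    forth : ∀ x → OnCycle x → OnCycle (η x)
    forth x (s , s<t , refl) with m<1+n⇒m<n∨m≡n s<t
    ... | inj₁ s<t  = suc s , s≤s s<t , refl
    ... | inj₂ refl = 0 , s≤s z≤n , sym closes
    back : ∀ x → OnCycle (η x) → OnCycle x
    back x (zero  , _   , e) = t , ≤-refl , inj (trans closes e)
    back x (suc s , s<t , e) = s , <-trans (n<1+n s) s<t , inj e
    a∉ : ¬ OnCycle a
    a∉ (zero  , _         , e) = a≢b (sym e)
    a∉ (suc s , s≤s s<t   , e) = proj₁ (avoids s s<t) e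

module _ (η : Map n) (inj : Injective η) {a b : Fin n} (a≢b : a ≢ b) where

  -- The point of {a, b} that `b` reaches first decides the matter: reaching `a` means a common
  -- cycle, reaching `b` means separate cycles.
  firstReturn : ∃ λ t → Avoids η a b t × (iter η (suc t) b ≡ a ⊎ iter η (suc t) b ≡ b)
  firstReturn with p , _ , closes ← Orbits.period η inj b with search (suc p)
    where
    search : ∀ k → Avoids η a b k ⊎ ∃ λ t → Avoids η a b t × (iter η (suc t) b ≡ a ⊎ iter η (suc t) b ≡ b)
    search zero = inj₁ (λ _ ())
    search (suc k) with search k
    ... | inj₂ found = inj₂ found
    ... | inj₁ avoids with position a b (iter η (suc k) b)
    ...   | at-a e = inj₂ (k , avoids , inj₁ e)
    ...   | at-b e = inj₂ (k , avoids , inj₂ e)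
    ...   | other e₁ e₂ = inj₁ extended
      where
      extended : Avoids η a b (suc k)
      extended s s<k with m<1+n⇒m<n∨m≡n s<k
      ... | inj₁ s<k  = avoids s s<k
      ... | inj₂ refl = e₁ , e₂
  ... | inj₂ found  = found
  ... | inj₁ avoids = ⊥-elim (proj₂ (avoids p ≤-refl) closes)

  private
    η′ : Map n
    η′ = transpose a b ∘ η

  -- Before the first return the iterates avoid `a` and `b`, so the transposition is not felt. At
  -- the return it exchanges the two outcomes.
  iter-agrees : ∀ t → Avoids η a b t → ∀ s → s ≤ t → iter η′ s b ≡ iter η s b
  iter-agrees t avoids zero    s≤t = refl
  iter-agrees t avoids (suc s) s≤t = trans (cong η′ (iter-agrees t avoids s (<⇒≤ s≤t)))
    (transpose-other a b (proj₁ (avoids s s≤t)) (proj₂ (avoids s s≤t)))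

  -- A colouring with equal colours at `a` and `b` does not see the transposition.
  invariants₌-transpose : ∀ q → invariants₌ η′ a b q ≡ invariants₌ η a b q
  invariants₌-transpose q = ∑-cong (allVecs q n) (λ f → begin
    𝟙 (invariant? η′ f) * 𝟙 (lookup f a ≟ lookup f b)   ≡⟨ *-comm (𝟙 (invariant? η′ f)) _ ⟩
    𝟙 (lookup f a ≟ lookup f b) * 𝟙 (invariant? η′ f)   ≡⟨ 𝟙-guard (lookup f a ≟ lookup f b) (λ e →
      𝟙-cong (invariant? η′ f) (invariant? η f)
        (λ h x → trans (sym (blind f e (η x))) (h x)) (λ h x → trans (blind f e (η x)) (h x))) ⟩
    𝟙 (lookup f a ≟ lookup f b) * 𝟙 (invariant? η f)    ≡⟨ *-comm (𝟙 (lookup f a ≟ lookup f b)) _ ⟩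
    𝟙 (invariant? η f) * 𝟙 (lookup f a ≟ lookup f b)    ∎)
    where
    blind : ∀ f → lookup f a ≡ lookup f b → ∀ y → lookup f (transpose a b y) ≡ lookup f y
    blind f e y with position a b y
    ... | at-a refl = trans (cong (lookup f) (transpose-left y b)) (sym e)
    ... | at-b refl = trans (cong (lookup f) (transpose-right a y)) e
    ... | other p r = cong (lookup f) (transpose-other a b p r)

  -- Exactly one of η and (a b) η has a and b on a common cycle.
  invariants-transpose : ∀ q → invariants η′ q + invariants η q ≡ suc q * invariants₌ η a b q
  invariants-transpose q with firstReturn
  ... | t , avoids , inj₂ closes = cong₂ _+_
    (trans (joined⇒invariants η′ a b q (λ f h → trans (cong (lookup f) (sym reaches)) (invariant-iter η′ f h (suc t) b)))
      (invariants₌-transpose q))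
    (cycle-separates η inj a≢b t avoids closes q)
    where
    reaches : iter η′ (suc t) b ≡ a
    reaches = trans (cong η′ (iter-agrees t avoids t ≤-refl)) (trans (cong (transpose a b) closes) (transpose-right a b))
  ... | t , avoids , inj₁ reaches = trans (+-comm (invariants η′ q) _) (cong₂ _+_
    (joined⇒invariants η a b q (λ f h → trans (cong (lookup f) (sym reaches)) (invariant-iter η f h (suc t) b)))
    (trans (cycle-separates η′ (inj ∘ transpose-injective a b) a≢b t avoids′ closes q) (cong (q *_) (invariants₌-transpose q))))
    where
    avoids′ : Avoids η′ a b t
    avoids′ s s<t = subst (λ y → y ≢ a × y ≢ b) (sym (iter-agrees t avoids (suc s) s<t)) (avoids s s<t)
    closes : iter η′ (suc t) b ≡ b
    closes = trans (cong η′ (iter-agrees t avoids t ≤-refl)) (trans (cong (transpose a b) reaches) (transpose-left a b))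

-- The Harer–Zagier polynomials

-- Horner evaluation of the first N coefficients. Polynomials are coefficient sequences, and the
-- cut-off is supplied at the evaluation.
eval : ℕ → (ℕ → ℕ) → ℕ → ℕ
eval zero    a q = 0
eval (suc N) a q = a 0 + q * eval N (a ∘ suc) q

eval-cong : ∀ N {a b} → (∀ c → a c ≡ b c) → ∀ q → eval N a q ≡ eval N b q
eval-cong zero    h q = refl
eval-cong (suc N) h q = cong₂ (λ x y → x + q * y) (h 0) (eval-cong N (h ∘ suc) q)

eval-linear : ∀ N x y a b q → eval N (λ c → x * a c + y * b c) q ≡ x * eval N a q + y * eval N b q
eval-linear zero    x y a b q = sym (cong₂ _+_ (*-zeroʳ x) (*-zeroʳ y))
eval-linear (suc N) x y a b q = trans
  (cong (λ z → (x * a 0 + y * b 0) + q * z) (eval-linear N x y (a ∘ suc) (b ∘ suc) q))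
  (eq x y (a 0) (b 0) q (eval N (a ∘ suc) q) (eval N (b ∘ suc) q))
  where
  eq : ∀ x y a b q A B → (x * a + y * b) + q * (x * A + y * B) ≡ x * (a + q * A) + y * (b + q * B)
  eq = solve-∀

eval-scale : ∀ N x a q → eval N (λ c → x * a c) q ≡ x * eval N a q
eval-scale zero    x a q = sym (*-zeroʳ x)
eval-scale (suc N) x a q = trans (cong (λ z → x * a 0 + q * z) (eval-scale N x (a ∘ suc) q))
  (eq x (a 0) q (eval N (a ∘ suc) q))
  where
  eq : ∀ x a q A → x * a + q * (x * A) ≡ x * (a + q * A)
  eq = solve-∀

eval-zero : ∀ N q → eval N (λ _ → 0) q ≡ 0
eval-zero zero    q = refl
eval-zero (suc N) q = trans (cong (q *_) (eval-zero N q)) (*-zeroʳ q)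

eval-+ : ∀ N a b q → eval N (λ c → a c + b c) q ≡ eval N a q + eval N b q
eval-+ N a b q = trans (eval-cong N (λ c → sym (cong₂ _+_ (*-identityˡ (a c)) (*-identityˡ (b c)))) q)
  (trans (eval-linear N 1 1 a b q) (cong₂ _+_ (*-identityˡ (eval N a q)) (*-identityˡ (eval N b q))))

eval-∑ : {A : Set} (N : ℕ) (xs : List A) (φ : A → ℕ → ℕ) (q : ℕ) →
  eval N (λ c → ∑[ x ∈ xs ] φ x c) q ≡ ∑[ x ∈ xs ] eval N (φ x) q
eval-∑ N []       φ q = eval-zero N q
eval-∑ N (x ∷ xs) φ q = trans (eval-+ N (φ x) _ q) (cong (eval N (φ x) q +_) (eval-∑ N xs φ q))

eval-monomial : ∀ N d q → d < N → eval N (λ c → 𝟙 (d ℕ.≟ c)) q ≡ q ^ d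
eval-monomial (suc N) zero    q _         = cong suc (trans (cong (q *_) (trans
  (eval-cong N (λ c → 𝟙-no (0 ℕ.≟ suc c) (λ ())) q) (eval-zero N q))) (*-zeroʳ q))
eval-monomial (suc N) (suc d) q (s≤s d<N) = cong₂ (λ x y → x + q * y) (𝟙-no (suc d ℕ.≟ 0) (λ ()))
  (trans (eval-cong N (λ c → 𝟙-cong (suc d ℕ.≟ suc c) (d ℕ.≟ c) suc-injective (cong suc)) q) (eval-monomial N d q d<N))

-- For q larger than both constant terms, these are the residues of the values modulo q. They are
-- then removed and the rest is divided by q. The division needs q > 0, so the bound `Q` rises by
-- one with each coefficient.
eval-injective : ∀ N Q a b → (∀ q → Q ≤ q → eval N a q ≡ eval N b q) → ∀ c → c < N → a c ≡ b c
eval-injective (suc N) Q a b h = λ where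
    zero    _         → a₀≡b₀
    (suc c) (s≤s c<N) → eval-injective N (suc Q) (a ∘ suc) (b ∘ suc) rest c c<N
  where
  big = suc (Q + (a 0 + b 0))
  low : ∀ x X → x ≤ a 0 + b 0 → (x + big * X) % big ≡ x
  low x X x≤ = trans (cong (λ z → (x + z) % big) (*-comm big X))
    (trans ([m+kn]%n≡m%n x X big) (m<n⇒m%n≡m (s≤s (≤-trans x≤ (m≤n+m (a 0 + b 0) Q)))))
  a₀≡b₀ : a 0 ≡ b 0
  a₀≡b₀ = trans (sym (low (a 0) _ (m≤m+n (a 0) (b 0))))
    (trans (cong (_% big) (h big (m≤n⇒m≤1+n (m≤m+n Q _)))) (low (b 0) _ (m≤n+m (b 0) (a 0))))
  rest : ∀ q → suc Q ≤ q → eval N (a ∘ suc) q ≡ eval N (b ∘ suc) q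
  rest q@(suc _) Q<q = *-cancelˡ-≡ _ _ q (+-cancelˡ-≡ (a 0) _ _
    (trans (h q (<⇒≤ Q<q)) (cong (_+ q * eval N (b ∘ suc) q) (sym a₀≡b₀))))

-- On polynomials, `shift` is multiplication by q and `spread` is the substitution of q² for q.
shift : (ℕ → ℕ) → ℕ → ℕ
shift a zero    = 0
shift a (suc c) = a c

spread : (ℕ → ℕ) → ℕ → ℕ
spread a zero          = a 0
spread a (suc zero)    = 0
spread a (suc (suc c)) = spread (a ∘ suc) c

eval-spread : ∀ N a q → eval (N * 2) (spread a) q ≡ eval N a (q * q)
eval-spread zero    a q = refl
eval-spread (suc N) a q = cong (a 0 +_) (trans (cong (λ z → q * (q * z)) (eval-spread N (a ∘ suc) q))
  (sym (*-assoc q q (eval N (a ∘ suc) (q * q)))))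

spread-even : ∀ a j → spread a (j * 2) ≡ a j
spread-even a zero    = refl
spread-even a (suc j) = spread-even (a ∘ suc) j

spread-odd : ∀ a j → spread a (suc (j * 2)) ≡ 0
spread-odd a zero    = refl
spread-odd a (suc j) = spread-odd (a ∘ suc) j

shift-spread-even : ∀ a j → shift (spread a) (j * 2) ≡ 0
shift-spread-even a zero    = refl
shift-spread-even a (suc j) = spread-odd a j

-- (k + 1)! times the coefficient of x^(k+1) in ((1 + x) / (1 - x))^q / 2.
w : ℕ → ℕ → ℕ
w zero          q = q
w (suc zero)    q = 2 * (q * q)
w (suc (suc k)) q = 2 * q * w (suc k) q + (2 + k) * (1 + k) * w k q

w-at-0 : ∀ k → w k 0 ≡ 0
w-at-0 zero          = refl
w-at-0 (suc zero)    = refl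
w-at-0 (suc (suc k)) = trans (cong ((2 + k) * (1 + k) *_) (w-at-0 k)) (*-zeroʳ ((2 + k) * (1 + k)))

-- Let A_q = ((1 + x) / (1 - x))^q. The first identity is (1 + x) A_q' = q (A_(q+1) + A_q), and the
-- second is A_(q+1) - A_q = x (A_(q+1) + A_q). Only the second is wanted in the end; the first
-- absorbs the factor q of the recurrence in the induction.
w-difference : ∀ k q →
  w (suc k) q + (1 + k) * w k q ≡ q * (w k (suc q) + w k q) ×
  w (suc k) (suc q) ≡ w (suc k) q + (2 + k) * (w k (suc q) + w k q)
w-difference zero q = eq₁ q , eq₂ q
  where
  eq₁ : ∀ q → 2 * (q * q) + (1 + 0) * q ≡ q * (suc q + q)
  eq₁ = solve-∀
  eq₂ : ∀ q → 2 * (suc q * suc q) ≡ 2 * (q * q) + (2 + 0) * (suc q + q)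
  eq₂ = solve-∀
w-difference (suc k) q with G , H ← w-difference k q = G′ , H′
  where
  x = w k (suc q)
  y = w k q
  Y = w (suc k) q
  G′ : 2 * q * Y + (2 + k) * (1 + k) * y + (2 + k) * Y ≡ q * (w (suc k) (suc q) + Y)
  G′ = begin
    2 * q * Y + (2 + k) * (1 + k) * y + (2 + k) * Y   ≡⟨ eq₁ k q y Y ⟩
    2 * q * Y + (2 + k) * (Y + (1 + k) * y)           ≡⟨ cong (λ z → 2 * q * Y + (2 + k) * z) G ⟩
    2 * q * Y + (2 + k) * (q * (x + y))               ≡⟨ eq₂ k q (x + y) Y ⟩
    q * ((Y + (2 + k) * (x + y)) + Y)                 ≡⟨ cong (λ z → q * (z + Y)) H ⟨
    q * (w (suc k) (suc q) + Y)                       ∎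
    where
    eq₁ : ∀ k q y Y → 2 * q * Y + (2 + k) * (1 + k) * y + (2 + k) * Y ≡ 2 * q * Y + (2 + k) * (Y + (1 + k) * y)
    eq₁ = solve-∀
    eq₂ : ∀ k q s Y → 2 * q * Y + (2 + k) * (q * s) ≡ q * ((Y + (2 + k) * s) + Y)
    eq₂ = solve-∀
  H′ : 2 * suc q * w (suc k) (suc q) + (2 + k) * (1 + k) * x ≡
    2 * q * Y + (2 + k) * (1 + k) * y + (3 + k) * (w (suc k) (suc q) + Y)
  H′ = begin
    2 * suc q * w (suc k) (suc q) + (2 + k) * (1 + k) * x
      ≡⟨ cong (λ z → 2 * suc q * z + (2 + k) * (1 + k) * x) H ⟩
    2 * suc q * (Y + (2 + k) * (x + y)) + (2 + k) * (1 + k) * x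
      ≡⟨ eq₁ k q x y Y ⟩
    2 * suc q * Y + 2 * (2 + k) * (x + y) + (2 + k) * (1 + k) * x + 2 * (2 + k) * (q * (x + y))
      ≡⟨ cong (λ z → 2 * suc q * Y + 2 * (2 + k) * (x + y) + (2 + k) * (1 + k) * x + 2 * (2 + k) * z) G ⟨
    2 * suc q * Y + 2 * (2 + k) * (x + y) + (2 + k) * (1 + k) * x + 2 * (2 + k) * (Y + (1 + k) * y)
      ≡⟨ eq₂ k q x y Y ⟩
    2 * q * Y + (2 + k) * (1 + k) * y + (3 + k) * ((Y + (2 + k) * (x + y)) + Y)
      ≡⟨ cong (λ z → 2 * q * Y + (2 + k) * (1 + k) * y + (3 + k) * (z + Y)) H ⟨
    2 * q * Y + (2 + k) * (1 + k) * y + (3 + k) * (w (suc k) (suc q) + Y) ∎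
    where
    eq₁ : ∀ k q x y Y → 2 * suc q * (Y + (2 + k) * (x + y)) + (2 + k) * (1 + k) * x ≡
      2 * suc q * Y + 2 * (2 + k) * (x + y) + (2 + k) * (1 + k) * x + 2 * (2 + k) * (q * (x + y))
    eq₁ = solve-∀
    eq₂ : ∀ k q x y Y →
      2 * suc q * Y + 2 * (2 + k) * (x + y) + (2 + k) * (1 + k) * x + 2 * (2 + k) * (Y + (1 + k) * y) ≡
      2 * q * Y + (2 + k) * (1 + k) * y + (3 + k) * ((Y + (2 + k) * (x + y)) + Y)
    eq₂ = solve-∀

-- The coefficients of e_r and o_r with w_(2r) = q e_r(q²) and w_(2r+1) = q² o_r(q²). In the rule
-- for e_(r+1) the factor 2q of the recurrence meets q² o_r(q²) and leaves an extra q², hence the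
-- `shift`.
even odd : ℕ → ℕ → ℕ
even zero    zero    = 1
even zero    (suc j) = 0
even (suc r) j       = 2 * shift (odd r) j + (2 + r * 2) * (1 + r * 2) * even r j
odd zero    j = 2 * even zero j
odd (suc r) j = 2 * even (suc r) j + (3 + r * 2) * (2 + r * 2) * odd r j

-- The polynomials have degree r, so a cut-off above r captures all of their coefficients.
w-even : ∀ r N q → r < N → q * eval N (even r) (q * q) ≡ w (r * 2) q
w-odd  : ∀ r N q → r < N → q * q * eval N (odd r) (q * q) ≡ w (suc (r * 2)) q

w-even zero    (suc N) q _ = trans (cong (λ z → q * (1 + q * q * z)) (eval-zero N (q * q))) (eq q)
  where
  eq : ∀ q → q * (1 + q * q * 0) ≡ q
  eq = solve-∀
w-even (suc r) (suc N) q (s≤s r<N) = begin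
  q * eval (suc N) (even (suc r)) (q * q)
    ≡⟨ cong (q *_) (eval-linear (suc N) 2 κ (shift (odd r)) (even r) (q * q)) ⟩
  q * (2 * (q * q * eval N (odd r) (q * q)) + κ * eval (suc N) (even r) (q * q))
    ≡⟨ eq q κ (q * q * eval N (odd r) (q * q)) (eval (suc N) (even r) (q * q)) ⟩
  2 * q * (q * q * eval N (odd r) (q * q)) + κ * (q * eval (suc N) (even r) (q * q))
    ≡⟨ cong₂ (λ x y → 2 * q * x + κ * y) (w-odd r N q r<N) (w-even r (suc N) q (m≤n⇒m≤1+n r<N)) ⟩
  2 * q * w (suc (r * 2)) q + κ * w (r * 2) q ∎
  where
  κ = (2 + r * 2) * (1 + r * 2)
  eq : ∀ q κ x y → q * (2 * x + κ * y) ≡ 2 * q * x + κ * (q * y)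
  eq = solve-∀

w-odd zero    N q r<N = begin
  q * q * eval N (odd zero) (q * q)        ≡⟨ cong (q * q *_) (eval-scale N 2 (even zero) (q * q)) ⟩
  q * q * (2 * eval N (even zero) (q * q)) ≡⟨ eq q (eval N (even zero) (q * q)) ⟩
  2 * (q * (q * eval N (even zero) (q * q))) ≡⟨ cong (λ z → 2 * (q * z)) (w-even zero N q r<N) ⟩
  2 * (q * q)                              ∎
  where
  eq : ∀ q x → q * q * (2 * x) ≡ 2 * (q * (q * x))
  eq = solve-∀
w-odd (suc r) N q r<N = begin
  q * q * eval N (odd (suc r)) (q * q)
    ≡⟨ cong (q * q *_) (eval-linear N 2 κ (even (suc r)) (odd r) (q * q)) ⟩
  q * q * (2 * eval N (even (suc r)) (q * q) + κ * eval N (odd r) (q * q))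
    ≡⟨ eq q κ (eval N (even (suc r)) (q * q)) (eval N (odd r) (q * q)) ⟩
  2 * q * (q * eval N (even (suc r)) (q * q)) + κ * (q * q * eval N (odd r) (q * q))
    ≡⟨ cong₂ (λ x y → 2 * q * x + κ * y) (w-even (suc r) N q r<N) (w-odd r N q (<-trans (n<1+n r) r<N)) ⟩
  2 * q * w (suc r * 2) q + κ * w (suc (r * 2)) q ∎
  where
  κ = (3 + r * 2) * (2 + r * 2)
  eq : ∀ q κ x y → q * q * (2 * x + κ * y) ≡ 2 * q * (q * x) + κ * (q * q * y)
  eq = solve-∀

-- Log-concavity by interlacing

infix 4 _≼_
-- With cleared denominators: the ratios b j / a j do not decrease. Both sides of the inequality are
-- bilinear in a and b, which gives closure under nonnegative combinations in each argument.
_≼_ : (ℕ → ℕ) → (ℕ → ℕ) → Set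
a ≼ b = ∀ j → a (suc j) * b j ≤ a j * b (suc j)

combine : ℕ → ℕ → (ℕ → ℕ) → (ℕ → ℕ) → ℕ → ℕ
combine x y a b j = x * a j + y * b j

≼-refl : ∀ a → a ≼ a
≼-refl a j = ≤-reflexive (*-comm (a (suc j)) (a j))

≼-combineʳ : ∀ x y {a b c} → a ≼ b → a ≼ c → a ≼ combine x y b c
≼-combineʳ x y {a} {b} {c} h k j = subst₂ _≤_
  (eq (a (suc j)) x y (b j) (c j)) (eq (a j) x y (b (suc j)) (c (suc j)))
  (+-mono-≤ (*-monoʳ-≤ x (h j)) (*-monoʳ-≤ y (k j)))
  where
  eq : ∀ a x y b c → x * (a * b) + y * (a * c) ≡ a * (x * b + y * c)
  eq = solve-∀

≼-combineˡ : ∀ x y {a b c} → a ≼ c → b ≼ c → combine x y a b ≼ c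
≼-combineˡ x y {a} {b} {c} h k j = subst₂ _≤_
  (eq (a (suc j)) x y (b (suc j)) (c j)) (eq (a j) x y (b j) (c (suc j)))
  (+-mono-≤ (*-monoʳ-≤ x (h j)) (*-monoʳ-≤ y (k j)))
  where
  eq : ∀ a x y b c → x * (a * c) + y * (b * c) ≡ (x * a + y * b) * c
  eq = solve-∀

≼-shift : ∀ {a b} → a ≼ b → shift a ≼ shift b
≼-shift {a} h zero    = ≤-reflexive (*-zeroʳ (a 0))
≼-shift     h (suc j) = h j

≼-respʳ : ∀ {a b c} → (∀ j → b j ≡ c j) → a ≼ b → a ≼ c
≼-respʳ {a} h k j = subst₂ (λ x y → a (suc j) * x ≤ a j * y) (h j) (h (suc j)) (k j)

≼-shift-combine : ∀ x y {a b c} → a ≼ shift b → a ≼ shift c → a ≼ shift (combine x y b c)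
≼-shift-combine x y {a} {b} {c} h k = ≼-respʳ {a} pointwise (≼-combineʳ x y {a} {shift b} {shift c} h k)
  where
  pointwise : ∀ j → combine x y (shift b) (shift c) j ≡ shift (combine x y b c) j
  pointwise zero    = cong₂ _+_ (*-zeroʳ x) (*-zeroʳ y)
  pointwise (suc j) = refl

-- Transitivity of ≼ fails across zeros of b.
≼-trans-at : ∀ {a a′ b b′ c c′} → a′ * b ≤ a * b′ → b′ * c ≤ b * c′ → (b ≡ 0 → a′ * c ≡ 0) → (b′ ≡ 0 → a′ * c ≡ 0) →
  a′ * c ≤ a * c′
≼-trans-at {b = zero} h k z z′ = ≤-trans (≤-reflexive (z refl)) z≤n
≼-trans-at {b = suc _} {zero} h k z z′ = ≤-trans (≤-reflexive (z′ refl)) z≤n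
≼-trans-at {a} {a′} {b@(suc _)} {b′@(suc _)} {c} {c′} h k z z′ =
  *-cancelˡ-≤ (b * b′) (subst₂ _≤_ (eq₁ b b′ a′ c) (eq₂ b b′ a c′) (*-mono-≤ h k))
  where
  eq₁ : ∀ b b′ a c → (a * b) * (b′ * c) ≡ b * b′ * (a * c)
  eq₁ = solve-∀
  eq₂ : ∀ b b′ a c → (a * b′) * (b * c) ≡ b * b′ * (a * c)
  eq₂ = solve-∀

-- Excludes internal zeros, across which `≼` could not be composed.
ZeroClosed : (ℕ → ℕ) → Set
ZeroClosed a = ∀ j → a j ≡ 0 → a (suc j) ≡ 0

-- The guiding picture is the chain o ≼ e ≼ shift o ≼ shift e. The relations that skip a member,
-- among them both log-concavities, are fields of their own since `≼` is not transitive in general.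
record Interlaced (e o : ℕ → ℕ) : Set where
  field
    o≼e        : o ≼ e
    e≼shift-o  : e ≼ shift o
    e≼shift-e  : e ≼ shift e
    o≼shift-o  : o ≼ shift o
    e-closed   : ZeroClosed e
    o-closed   : ZeroClosed o
    o≡0⇒e≡0    : ∀ j → o j ≡ 0 → e j ≡ 0
    e≡0⇒o≡0    : ∀ j → e j ≡ 0 → o j ≡ 0

combine≡0 : ∀ x y {a b} → suc x * a + suc y * b ≡ 0 → a ≡ 0 × b ≡ 0
combine≡0 x y {a} {b} h = m+n≡0⇒m≡0 a (m+n≡0⇒m≡0 (suc x * a) h) , m+n≡0⇒m≡0 b (m+n≡0⇒n≡0 (suc x * a) h)

≡0⇒combine : ∀ x y {a b} → a ≡ 0 → b ≡ 0 → x * a + y * b ≡ 0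
≡0⇒combine x y refl refl = cong₂ _+_ (*-zeroʳ x) (*-zeroʳ y)

interlaced-step : ∀ x y x′ y′ {e o} → Interlaced e o →
  let e′ = combine (suc x) (suc y) (shift o) e
      o′ = combine (suc x′) (suc y′) e′ o
  in Interlaced e′ o′
interlaced-step x y x′ y′ {e} {o} I = record
  { o≼e       = ≼-combineˡ (suc x′) (suc y′) {e′} {o} {e′} (≼-refl e′) o≼e′
  ; e≼shift-o = ≼-shift-combine (suc x′) (suc y′) {e′} {e′} {o} e′≼shift-e′ e′≼shift-o
  ; e≼shift-e = e′≼shift-e′
  ; o≼shift-o = ≼-combineˡ (suc x′) (suc y′) {e′} {o} {shift o′}
      (≼-shift-combine (suc x′) (suc y′) {e′} {e′} {o} e′≼shift-e′ e′≼shift-o)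
      (≼-shift-combine (suc x′) (suc y′) {o} {e′} {o} o≼shift-e′ o≼shift-o)
  ; e-closed  = e′-closed
  ; o-closed  = λ j h → let (he , ho) = combine≡0 x′ y′ {e′ j} {o j} h in
      ≡0⇒combine (suc x′) (suc y′) (e′-closed j he) (o-closed j ho)
  ; o≡0⇒e≡0   = λ j h → proj₁ (combine≡0 x′ y′ {e′ j} {o j} h)
  ; e≡0⇒o≡0   = λ j h → ≡0⇒combine (suc x′) (suc y′) h (e′≡0⇒o≡0 j h)
  }
  where
  open Interlaced I
  e′ = combine (suc x) (suc y) (shift o) e
  o′ = combine (suc x′) (suc y′) e′ o

  e′≡0⇒o≡0 : ∀ j → e′ j ≡ 0 → o j ≡ 0
  e′≡0⇒o≡0 j h = e≡0⇒o≡0 j (proj₂ (combine≡0 x y {shift o j} {e j} h))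

  e′-closed : ZeroClosed e′
  e′-closed j h = ≡0⇒combine (suc x) (suc y) (e′≡0⇒o≡0 j h) (e-closed j (proj₂ (combine≡0 x y {shift o j} {e j} h)))

  o≼e′ : o ≼ e′
  o≼e′ = ≼-combineʳ (suc x) (suc y) {o} {shift o} {e} o≼shift-o o≼e

  e′≼shift-o : e′ ≼ shift o
  e′≼shift-o = ≼-combineˡ (suc x) (suc y) {shift o} {e} {shift o} (≼-refl (shift o)) e≼shift-o

  e≼shift²-o : e ≼ shift (shift o)
  e≼shift²-o zero          = ≤-trans (≤-reflexive (*-zeroʳ (e 1))) z≤n
  e≼shift²-o (suc zero)    = ≤-trans (≤-reflexive (*-zeroʳ (e 2))) z≤n
  e≼shift²-o (suc (suc l)) = ≼-trans-at {e (2 + l)} {e (3 + l)} {o (1 + l)} {o (2 + l)} {o l} {o (1 + l)}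
    (e≼shift-o (2 + l)) (o≼shift-o (1 + l)) vanish (λ h → cong (_* o l) (e-closed (2 + l) (o≡0⇒e≡0 (2 + l) h)))
    where
    vanish : o (1 + l) ≡ 0 → e (3 + l) * o l ≡ 0
    vanish h = cong (_* o l) (e-closed (2 + l) (e-closed (1 + l) (o≡0⇒e≡0 (1 + l) h)))

  e′≼shift-e′ : e′ ≼ shift e′
  e′≼shift-e′ = ≼-combineˡ (suc x) (suc y) {shift o} {e} {shift e′}
    (≼-shift-combine (suc x) (suc y) {shift o} {shift o} {e} (≼-shift {o} {shift o} o≼shift-o) (≼-shift {o} {e} o≼e))
    (≼-shift-combine (suc x) (suc y) {e} {shift o} {e} e≼shift²-o e≼shift-e)

  o≼shift-e′ : o ≼ shift e′
  o≼shift-e′ zero    = ≤-trans (≤-reflexive (*-zeroʳ (o 1))) z≤n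
  o≼shift-e′ (suc l) = ≼-trans-at {o (1 + l)} {o (2 + l)} {e′ (1 + l)} {e′ (2 + l)} {e′ l} {e′ (1 + l)}
    (o≼e′ (1 + l)) (e′≼shift-e′ (1 + l))
    (λ h → cong (_* e′ l) (o-closed (1 + l) (e′≡0⇒o≡0 (1 + l) h)))
    (λ h → cong (_* e′ l) (e′≡0⇒o≡0 (2 + l) h))

interlaced : ∀ r → Interlaced (even r) (odd r)
interlaced zero = record
  { o≼e       = λ j → z≤n
  ; e≼shift-o = λ j → z≤n
  ; e≼shift-e = λ j → z≤n
  ; o≼shift-o = λ j → z≤n
  ; e-closed  = λ j _ → refl
  ; o-closed  = λ j _ → refl
  ; o≡0⇒e≡0   = λ { zero () ; (suc j) _ → refl }
  ; e≡0⇒o≡0   = λ { zero () ; (suc j) _ → refl }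
  }
-- The long arguments are the predecessors of (2 + 2r) (1 + 2r) and (3 + 2r) (2 + 2r).
interlaced (suc r) = interlaced-step 1 (r * 2 + (1 + r * 2) * (1 + r * 2)) 1 (1 + r * 2 + (2 + r * 2) * (2 + r * 2)) (interlaced r)

≼-shift⇒logConcave : ∀ {a} → a ≼ shift a → LogConcave a
≼-shift⇒logConcave {a} h k = ≤-trans (≤-reflexive (*-comm (a k) (a (2 + k)))) (h (suc k))

logConcave-scale : ∀ {a b} x y → .{{NonZero x}} → (∀ j → x * a j ≡ y * b j) → LogConcave b → LogConcave a
logConcave-scale {a} {b} x y h lc k = *-cancelˡ-≤ (x * x) {{m*n≢0 x x}}
  (subst₂ _≤_ (rescale k (2 + k)) (rescale (1 + k) (1 + k)) (*-monoʳ-≤ (y * y) (lc k)))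
  where
  eq : ∀ x a b → x * x * (a * b) ≡ (x * a) * (x * b)
  eq = solve-∀
  rescale : ∀ i j → y * y * (b i * b j) ≡ x * x * (a i * a j)
  rescale i j = begin
    y * y * (b i * b j)       ≡⟨ eq y (b i) (b j) ⟩
    (y * b i) * (y * b j)     ≡⟨ cong₂ _*_ (h i) (h j) ⟨
    (x * a i) * (x * a j)     ≡⟨ eq x (a i) (a j) ⟨
    x * x * (a i * a j)       ∎

-- Cycle counts of involutions

∈-fullCycles : {ζ : Map (suc m)} → ζ ∈ fullCycles m → IsFullCycle ζ
∈-fullCycles {m} ζ∈ = proj₂ (∈-filter⁻ isFullCycle? {xs = allMaps (suc m)} ζ∈)

-- The weight covers two cases by one exchange of sums: `φ` = 1 yields P, and the indicator of equal
-- colours at a and b yields B.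
∑-fullCycles-invariant : (π : Map (suc m)) (q : ℕ) (φ : Vec (Fin q) (suc m) → ℕ) →
  ∑[ ζ ∈ fullCycles m ] ∑[ f ∈ allVecs q (suc m) ] (𝟙 (invariant? (ζ · π) f) * φ f) ≡
  ∑[ f ∈ allVecs q (suc m) ] (φ f * tours (edges π f))
∑-fullCycles-invariant {m} π q φ = begin
  ∑[ ζ ∈ fullCycles m ] ∑[ f ∈ F ] (𝟙 (invariant? (ζ · π) f) * φ f)
    ≡⟨ ∑-swap (fullCycles m) F _ ⟩
  ∑[ f ∈ F ] ∑[ ζ ∈ fullCycles m ] (𝟙 (invariant? (ζ · π) f) * φ f)
    ≡⟨ ∑-cong F (λ f → trans (∑-*ʳ (fullCycles m) (φ f) _) (trans (*-comm _ (φ f)) (cong (φ f *_) (count f)))) ⟩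
  ∑[ f ∈ F ] (φ f * tours (edges π f)) ∎
  where
  F = allVecs q (suc m)
  count : ∀ f → ∑[ ζ ∈ fullCycles m ] 𝟙 (invariant? (ζ · π) f) ≡ tours (edges π f)
  count f = begin
    ∑[ ζ ∈ fullCycles m ] 𝟙 (invariant? (ζ · π) f)
      ≡⟨ ∑-filter isFullCycle? (allMaps (suc m)) (λ ζ → 𝟙 (invariant? (ζ · π) f)) ⟩
    ∑[ ζ ∈ allMaps (suc m) ] (𝟙 (isFullCycle? ζ) * 𝟙 (invariant? (ζ · π) f))
      ≡⟨ ∑-map lookup (allVecs (suc m) (suc m)) (λ ζ → 𝟙 (isFullCycle? ζ) * 𝟙 (invariant? (ζ · π) f)) ⟩
    ∑[ v ∈ allVecs (suc m) (suc m) ] (𝟙 (isFullCycle? (lookup v)) * 𝟙 (invariant? (lookup v · π) f))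
      ≡⟨ ∑-fullCycles-matches (lookup f ∘ π) (lookup f) ⟩
    tours (edges π f) ∎

∑-fullCycles-invariants : (π : Map (suc m)) (q : ℕ) → ∑[ ζ ∈ fullCycles m ] invariants (ζ · π) q ≡ tourCount π q
∑-fullCycles-invariants {m} π q = begin
  ∑[ ζ ∈ fullCycles m ] ∑[ f ∈ F ] 𝟙 (invariant? (ζ · π) f)
    ≡⟨ ∑-cong (fullCycles m) (λ ζ → ∑-cong F (λ f → *-identityʳ _)) ⟨
  ∑[ ζ ∈ fullCycles m ] ∑[ f ∈ F ] (𝟙 (invariant? (ζ · π) f) * 1)
    ≡⟨ ∑-fullCycles-invariant π q (λ _ → 1) ⟩
  ∑[ f ∈ F ] (1 * tours (edges π f))
    ≡⟨ ∑-cong F (λ f → *-identityˡ _) ⟩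
  tourCount π q ∎
  where F = allVecs q (suc m)

∑-cycles : (π : Map (suc m)) → Injective π → ∀ q → ∑[ ζ ∈ fullCycles m ] (q ^ cycles (ζ · π)) ≡ tourCount π q
∑-cycles {m} π inj q = trans
  (sym (∑-cong-∈ (fullCycles m) (λ {ζ} ζ∈ → Orbits.invariants-cycles (ζ · π) (full⇒injective ζ (∈-fullCycles ζ∈) ∘ inj) q)))
  (∑-fullCycles-invariants π q)

tourCount-transpose₌ : (π : Map (suc m)) → Injective π → {a b : Fin (suc m)} → a ≢ b → ∀ q →
  tourCount (transpose a b ∘ π) q + tourCount π q ≡ suc q * tourCount₌ π a b q
tourCount-transpose₌ {m} π inj {a} {b} a≢b q = begin
  tourCount (transpose a b ∘ π) q + tourCount π q
    ≡⟨ cong₂ _+_ (∑-fullCycles-invariants (transpose a b ∘ π) q) (∑-fullCycles-invariants π q) ⟨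
  ∑ Z (λ ζ → invariants (ζ · (transpose a b ∘ π)) q) + ∑ Z (λ ζ → invariants (ζ · π) q)
    ≡⟨ ∑-+ Z _ _ ⟨
  ∑[ ζ ∈ Z ] (invariants (ζ · (transpose a b ∘ π)) q + invariants (ζ · π) q)
    -- Products apply the left factor first, so `ζ · (transpose a b ∘ π)` unfolds to
    -- `transpose a b ∘ (ζ · π)`.
    ≡⟨ ∑-cong-∈ Z (λ {ζ} ζ∈ → invariants-transpose (ζ · π) (full⇒injective ζ (∈-fullCycles ζ∈) ∘ inj) a≢b q) ⟩
  ∑[ ζ ∈ Z ] (suc q * invariants₌ (ζ · π) a b q)
    ≡⟨ ∑-*ˡ Z (suc q) _ ⟩
  suc q * ∑ Z (λ ζ → invariants₌ (ζ · π) a b q)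
    ≡⟨ cong (suc q *_) (∑-fullCycles-invariant π q (λ f → 𝟙 (lookup f a ≟ lookup f b))) ⟩
  suc q * tourCount₌ π a b q ∎
  where Z = fullCycles m

-- Both relations contain B(q) with the same factor q + 1, so it is eliminated without a division.
tourCount-step : (π : Map (suc m)) → Injective π → {a b : Fin (suc m)} → a ≢ b → π a ≡ a → π b ≡ b → ∀ q →
  tourCount (transpose a b ∘ π) (suc q) ≡ tourCount π (suc q) + (tourCount (transpose a b ∘ π) q + tourCount π q)
tourCount-step π inj a≢b πa πb q = trans (tourCount-transpose π inj a≢b πa πb q)
  (cong (tourCount π (suc q) +_) (sym (tourCount-transpose₌ π inj a≢b q)))

cycles-full : (ζ : Map (suc m)) → IsFullCycle ζ → cycles ζ ≡ 1
cycles-full {m} ζ full = begin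
  cycles ζ                                            ≡⟨ length-filter-∑ (isCycleMin? ζ) (allFin (suc m)) ⟩
  ∑[ x ∈ allFin (suc m) ] 𝟙 (isCycleMin? ζ x)         ≡⟨ ∑-unique _ (Uniq.allFin⁺ (suc m)) (∈-allFin zero)
    (λ {x} _ x≢0 → 𝟙-no (isCycleMin? ζ x) (x≢0 ∘ onlyZero x)) ⟩
  𝟙 (isCycleMin? ζ zero)                              ≡⟨ 𝟙-yes (isCycleMin? ζ zero) (All.tabulate (λ _ → z≤n)) ⟩
  1                                                   ∎
  where
  open Orbits ζ (full⇒injective ζ full)
  reached : ∀ x → ∃ λ i → x ≡ iter ζ i zero
  reached x = let (i , _ , e) = ∈-map⁻ (λ i → iter ζ i zero) {xs = upTo (suc m)}
                    (subst (x ∈_) (sym (orbit-list ζ)) (Perm.∈-resp-↭ (↭-sym (full⇒cover ζ full)) (∈-allFin x)))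
              in i , e
  onlyZero : ∀ x → IsCycleMin ζ x → x ≡ zero
  onlyZero x h with i , refl ← reached x with j , e ← iter-back i zero =
    toℕ-injective (n≤0⇒n≡0 (subst (λ y → toℕ x ≤ toℕ y) e (cycleMin⇒≤ h j)))

-- Here ζπ = ζ is a single cycle. The number of full cycles stays unevaluated, because a common
-- factor does not affect log-concavity.
tourCount-id : ∀ m q → tourCount {suc m} id q ≡ length (fullCycles m) * q
tourCount-id m q = trans (sym (∑-cycles id id q)) (trans
  (∑-cong-∈ (fullCycles m) (λ {ζ} ζ∈ → trans (cong (q ^_) (cycles-full ζ (∈-fullCycles ζ∈))) (*-identityʳ q)))
  (∑-const (fullCycles m) q))

Involutive : Map n → Set
Involutive π = ∀ x → π (π x) ≡ x

involutive⇒injective : {π : Map n} → Involutive π → Injective π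
involutive⇒injective {π = π} h {x} {y} e = trans (sym (h x)) (trans (cong π e) (h y))

-- Disjointness is expressed by `ρ` fixing both a and b. The equations are pointwise, for want of
-- function extensionality.
data Transpositions : ℕ → Map n → Set where
  none : {π : Map n} → (∀ x → π x ≡ x) → Transpositions 0 π
  add  : {π ρ : Map n} {a b : Fin n} → Transpositions k ρ → Injective ρ → a ≢ b → ρ a ≡ a → ρ b ≡ b →
         (∀ x → π x ≡ transpose a b (ρ x)) → Transpositions (suc k) π

-- The list in `go` contains all points that may still be moved. If its head a is moved to b, then
-- (a b) π fixes a and b and is again an involution, so a leaves the list.
transpositions : (π : Map n) → Involutive π → ∃ λ k → Transpositions k π
transpositions {n} π inv = go (allFin n) π inv (λ x x∉ → ⊥-elim (x∉ (∈-allFin x)))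
  where
  go : ∀ L (π : Map n) → Involutive π → (∀ x → x ∉ L → π x ≡ x) → ∃ λ k → Transpositions k π
  go []      π inv fixed = 0 , none (λ x → fixed x (λ ()))
  go (a ∷ L) π inv fixed with π a ≟ a
  ... | yes πa≡a = go L π inv fixed′
    where
    fixed′ : ∀ x → x ∉ L → π x ≡ x
    fixed′ x x∉ with x ≟ a
    ... | yes refl = πa≡a
    ... | no x≢a   = fixed x (x∉ ∘ ∈-tail x≢a)
  ... | no πa≢a = let (k , T) = go L ρ ρ-involutive fixed′ in
      suc k , add T (involutive⇒injective ρ-involutive) (πa≢a ∘ sym) ρa ρb (λ x → sym (transpose-involutive a b (π x)))
    where
    b = π a
    ρ : Map n
    ρ = transpose a b ∘ π
    ρa : ρ a ≡ a
    ρa = transpose-right a b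
    ρb : ρ b ≡ b
    ρb = trans (cong (transpose a b) (inv a)) (transpose-left a b)
    ρ-other : ∀ {x} → x ≢ a → x ≢ b → ρ x ≡ π x
    ρ-other {x} x≢a x≢b = transpose-other a b
      (λ e → x≢b (trans (sym (inv x)) (cong π e)))
      (λ e → x≢a (involutive⇒injective inv e))
    ρ-involutive : Involutive ρ
    ρ-involutive x with position a b x
    ... | at-a refl = trans (cong ρ ρa) ρa
    ... | at-b refl = trans (cong ρ ρb) ρb
    ... | other x≢a x≢b = trans (cong ρ (ρ-other x≢a x≢b)) (trans
      (ρ-other (λ e → x≢b (trans (sym (inv x)) (cong π e))) (λ e → x≢a (involutive⇒injective inv e))) (inv x))
    fixed′ : ∀ x → x ∉ L → ρ x ≡ x
    fixed′ x x∉ with position a b x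
    ... | at-a refl = ρa
    ... | at-b refl = ρb
    ... | other x≢a x≢b = trans (ρ-other x≢a x≢b) (fixed x (x∉ ∘ ∈-tail x≢a))

-- The difference relation determines the values from the one at q = 0, so an induction on q sits
-- inside the one on transpositions. At q = 0 both sides vanish, as nonempty sets have no colouring
-- without colours.
tourCount-w : {π : Map (suc m)} → Transpositions k π → ∀ q → suc k ! * tourCount π q ≡ length (fullCycles m) * w k q
tourCount-w {m} (none h) q = trans (*-identityˡ _) (trans (tourCount-cong h q) (tourCount-id m q))
tourCount-w {m} {suc k} {π} (add {ρ = ρ} {a} {b} T inj a≢b ρa ρb h) q =
    trans (cong (suc (suc k) ! *_) (tourCount-cong h q)) (go q)
  where
  K = length (fullCycles m)
  τρ : Map (suc m)
  τρ = transpose a b ∘ ρ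
  go : ∀ q → suc (suc k) ! * tourCount τρ q ≡ K * w (suc k) q
  go zero = trans (*-zeroʳ (suc (suc k) !)) (sym (trans (cong (K *_) (w-at-0 (suc k))) (*-zeroʳ K)))
  go (suc q) = begin
    (2 + k) * suc k ! * tourCount τρ (suc q)
      ≡⟨ cong ((2 + k) * suc k ! *_) (tourCount-step ρ inj a≢b ρa ρb q) ⟩
    (2 + k) * suc k ! * (tourCount ρ (suc q) + (tourCount τρ q + tourCount ρ q))
      ≡⟨ eq₁ (2 + k) (suc k !) (tourCount ρ (suc q)) (tourCount τρ q) (tourCount ρ q) ⟩
    (2 + k) * suc k ! * tourCount τρ q + (2 + k) * (suc k ! * tourCount ρ (suc q) + suc k ! * tourCount ρ q)
      ≡⟨ cong₂ _+_ (go q) (cong₂ (λ x y → (2 + k) * (x + y)) (tourCount-w T (suc q)) (tourCount-w T q)) ⟩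
    K * w (suc k) q + (2 + k) * (K * w k (suc q) + K * w k q)
      ≡⟨ eq₂ (2 + k) K (w (suc k) q) (w k (suc q)) (w k q) ⟩
    K * (w (suc k) q + (2 + k) * (w k (suc q) + w k q))
      ≡⟨ cong (K *_) (proj₂ (w-difference k q)) ⟨
    K * w (suc k) (suc q) ∎
    where
    eq₁ : ∀ c f x y z → c * f * (x + (y + z)) ≡ c * f * y + c * (f * x + f * z)
    eq₁ = solve-∀
    eq₂ : ∀ c K x y z → K * x + c * (K * y + K * z) ≡ K * (x + c * (y + z))
    eq₂ = solve-∀

halves : ∀ d j → 𝟙 (d / 2 ℕ.≟ j) ≡ 𝟙 (d ℕ.≟ j * 2) + 𝟙 (d ℕ.≟ suc (j * 2))
halves d j with d % 2 | m%n<n d 2 | m≡m%n+[m/n]*n d 2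
... | zero  | _ | e = begin
  𝟙 (d / 2 ℕ.≟ j)                                   ≡⟨ 𝟙-cong (d / 2 ℕ.≟ j) (d ℕ.≟ j * 2)
      (λ h → trans e (cong (_* 2) h)) (λ h → *-cancelʳ-≡ (d / 2) j 2 (trans (sym e) h)) ⟩
  𝟙 (d ℕ.≟ j * 2)                                   ≡⟨ +-identityʳ _ ⟨
  𝟙 (d ℕ.≟ j * 2) + 0                               ≡⟨ cong (𝟙 (d ℕ.≟ j * 2) +_) (𝟙-no (d ℕ.≟ suc (j * 2))
      (λ h → even≢odd (d / 2) j (trans (*-comm 2 (d / 2)) (trans (sym e) (trans h (cong suc (*-comm j 2))))))) ⟨
  𝟙 (d ℕ.≟ j * 2) + 𝟙 (d ℕ.≟ suc (j * 2))           ∎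
... | suc zero | _ | e = begin
  𝟙 (d / 2 ℕ.≟ j)                                   ≡⟨ 𝟙-cong (d / 2 ℕ.≟ j) (d ℕ.≟ suc (j * 2))
      (λ h → trans e (cong (λ z → suc (z * 2)) h)) (λ h → *-cancelʳ-≡ (d / 2) j 2 (suc-injective (trans (sym e) h))) ⟩
  𝟙 (d ℕ.≟ suc (j * 2))                             ≡⟨ cong (_+ 𝟙 (d ℕ.≟ suc (j * 2))) (𝟙-no (d ℕ.≟ j * 2)
      (λ h → even≢odd j (d / 2) (trans (*-comm 2 j) (trans (sym h) (trans e (cong suc (*-comm (d / 2) 2))))))) ⟨
  𝟙 (d ℕ.≟ j * 2) + 𝟙 (d ℕ.≟ suc (j * 2))           ∎
... | suc (suc _) | s≤s (s≤s ()) | _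

-- The point `zero` is a cycle minimum. A positive count keeps the subtraction in `expo` from being
-- truncated.
cycles-positive : (η : Map (suc m)) → ∃ λ d → cycles η ≡ suc d
cycles-positive {m} η with filter (isCycleMin? η) (allFin (suc m))
    | ∈-filter⁺ (isCycleMin? η) {xs = allFin (suc m)} (∈-allFin zero) (All.tabulate (λ _ → z≤n))
... | _ ∷ xs | _ = length xs , refl

cycleCoeff : Map (suc m) → ℕ → ℕ
cycleCoeff {m} π c = ∑[ ζ ∈ fullCycles m ] 𝟙 (cycles (ζ · π) ℕ.≟ c)

F-coeff-cycleCoeff : (π : Map (suc m)) → ∀ j →
  F-coeff π j ≡ cycleCoeff π (suc (j * 2)) + cycleCoeff π (suc (suc (j * 2)))
F-coeff-cycleCoeff {m} π j = begin
  F-coeff π j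
    ≡⟨ length-filter-∑ (λ ζ → expo ζ π ℕ.≟ j) (fullCycles m) ⟩
  ∑[ ζ ∈ fullCycles m ] 𝟙 ((cycles (ζ · π) ∸ 1) / 2 ℕ.≟ j)
    ≡⟨ ∑-cong (fullCycles m) (λ ζ → split (cycles (ζ · π)) (cycles-positive (ζ · π))) ⟩
  ∑[ ζ ∈ fullCycles m ] (𝟙 (cycles (ζ · π) ℕ.≟ suc (j * 2)) + 𝟙 (cycles (ζ · π) ℕ.≟ suc (suc (j * 2))))
    ≡⟨ ∑-+ (fullCycles m) _ _ ⟩
  cycleCoeff π (suc (j * 2)) + cycleCoeff π (suc (suc (j * 2))) ∎
  where
  split : ∀ c → (∃ λ d → c ≡ suc d) → 𝟙 ((c ∸ 1) / 2 ℕ.≟ j) ≡ 𝟙 (c ℕ.≟ suc (j * 2)) + 𝟙 (c ℕ.≟ suc (suc (j * 2)))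
  split _ (d , refl) = trans (halves d j) (cong₂ _+_
    (𝟙-cong (d ℕ.≟ j * 2) (suc d ℕ.≟ suc (j * 2)) (cong suc) suc-injective)
    (𝟙-cong (d ℕ.≟ suc (j * 2)) (suc d ℕ.≟ suc (suc (j * 2))) (cong suc) suc-injective))

eval-cycleCoeff : (π : Map (suc m)) → Injective π → ∀ N → suc m < N → ∀ q → eval N (cycleCoeff π) q ≡ tourCount π q
eval-cycleCoeff {m} π inj N m<N q = begin
  eval N (cycleCoeff π) q
    ≡⟨ eval-∑ N (fullCycles m) (λ ζ c → 𝟙 (cycles (ζ · π) ℕ.≟ c)) q ⟩
  ∑[ ζ ∈ fullCycles m ] eval N (λ c → 𝟙 (cycles (ζ · π) ℕ.≟ c)) q
    ≡⟨ ∑-cong (fullCycles m) (λ ζ → eval-monomial N (cycles (ζ · π)) q (≤-<-trans (bound (ζ · π)) m<N)) ⟩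
  ∑[ ζ ∈ fullCycles m ] (q ^ cycles (ζ · π))
    ≡⟨ ∑-cycles π inj q ⟩
  tourCount π q ∎
  where
  bound : (η : Map (suc m)) → cycles η ≤ suc m
  bound η = ≤-trans (length-filter (isCycleMin? η) (allFin (suc m))) (≤-reflexive (length-allFin (suc m)))

-- The exponent ⌊(c - 1) / 2⌋ merges the coefficients of q^(2j+1) and q^(2j+2); by
-- parity one of the two vanishes.
record Coefficients (k : ℕ) : Set where
  field
    coeff           : ℕ → ℕ
    evaluates       : ∀ M → ∃ λ N → M < N × ∀ q → eval N coeff q ≡ w k q
    paired          : ℕ → ℕ
    paired-≡        : ∀ j → coeff (suc (j * 2)) + coeff (suc (suc (j * 2))) ≡ paired j
    paired-concave  : LogConcave paired

coefficients : ∀ k → Coefficients k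
coefficients k with parity k
  where
  parity : ∀ k → ∃ λ r → k ≡ r * 2 ⊎ k ≡ suc (r * 2)
  parity zero    = 0 , inj₁ refl
  parity (suc k) with parity k
  ... | r , inj₁ refl = r , inj₂ refl
  ... | r , inj₂ refl = suc r , inj₁ refl
-- Since w k = q e_r(q²) has odd powers only, each pair keeps its first coefficient. The number of
-- terms is chosen above both `M` and the degree.
... | r , inj₁ refl = record
  { coeff          = shift (spread (even r))
  ; evaluates      = λ M → suc (suc (M + r) * 2) ,
      s≤s (≤-trans (m≤n⇒m≤1+n (m≤m+n M r)) (m≤m*n (suc (M + r)) 2)) ,
      λ q → trans (cong (q *_) (eval-spread (suc (M + r)) (even r) q)) (w-even r (suc (M + r)) q (s≤s (m≤n+m r M)))
  ; paired         = even r
  ; paired-≡       = λ j → trans (cong₂ _+_ (spread-even (even r) j) (spread-odd (even r) j)) (+-identityʳ _)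
  ; paired-concave = ≼-shift⇒logConcave {even r} (Interlaced.e≼shift-e (interlaced r))
  }
-- Since w k = q² o_r(q²) has even powers only, each pair keeps its second coefficient.
... | r , inj₂ refl = record
  { coeff          = shift (shift (spread (odd r)))
  ; evaluates      = λ M → suc (suc (suc (M + r) * 2)) ,
      s≤s (m≤n⇒m≤1+n (≤-trans (m≤n⇒m≤1+n (m≤m+n M r)) (m≤m*n (suc (M + r)) 2))) ,
      λ q → trans (cong (λ z → q * (q * z)) (eval-spread (suc (M + r)) (odd r) q))
        (trans (sym (*-assoc q q _)) (w-odd r (suc (M + r)) q (s≤s (m≤n+m r M))))
  ; paired         = odd r
  ; paired-≡       = λ j → cong₂ _+_ (shift-spread-even (odd r) j) (spread-even (odd r) j)
  ; paired-concave = ≼-shift⇒logConcave {odd r} (Interlaced.o≼shift-o (interlaced r))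
  }

-- Two polynomials agree at every q. Their coefficients are compared under a common cut-off N, which
-- exceeds every possible number of cycles and the index `c`.
cycleCoeff-coefficients : {π : Map (suc m)} → Injective π → Transpositions k π →
  ∀ c → suc k ! * cycleCoeff π c ≡ length (fullCycles m) * Coefficients.coeff (coefficients k) c
cycleCoeff-coefficients {m} {k} {π} inj T c with N , big , e ← Coefficients.evaluates (coefficients k) (suc m + c) =
  eval-injective N 0 _ _ (λ q _ → begin
    eval N (λ c → suc k ! * cycleCoeff π c) q   ≡⟨ eval-scale N (suc k !) (cycleCoeff π) q ⟩
    suc k ! * eval N (cycleCoeff π) q           ≡⟨ cong (suc k ! *_) (eval-cycleCoeff π inj N (≤-<-trans (m≤m+n (suc m) c) big) q) ⟩
    suc k ! * tourCount π q                     ≡⟨ tourCount-w T q ⟩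
    K * w k q                                   ≡⟨ cong (K *_) (e q) ⟨
    K * eval N coeff q                          ≡⟨ eval-scale N K coeff q ⟨
    eval N (λ c → K * coeff c) q                ∎) c (≤-<-trans (m≤n+m c (suc m)) big)
  where
  K = length (fullCycles m)
  open Coefficients (coefficients k) using (coeff)

theorem2p3 : (m : ℕ) (π : Fin (suc m) → Fin (suc m)) →
    (∀ x → π (π x) ≡ x) →
    LogConcave (F-coeff π)
theorem2p3 m π inv with k , T ← transpositions π inv =
  logConcave-scale {F-coeff π} {paired} (suc k !) K {{suc k !≢0}} (λ j → begin
    suc k ! * F-coeff π j
      ≡⟨ cong (suc k ! *_) (F-coeff-cycleCoeff π j) ⟩
    suc k ! * (cycleCoeff π (suc (j * 2)) + cycleCoeff π (suc (suc (j * 2))))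
      ≡⟨ *-distribˡ-+ (suc k !) (cycleCoeff π (suc (j * 2))) _ ⟩
    suc k ! * cycleCoeff π (suc (j * 2)) + suc k ! * cycleCoeff π (suc (suc (j * 2)))
      ≡⟨ cong₂ _+_ (scaled (suc (j * 2))) (scaled (suc (suc (j * 2)))) ⟩
    K * coeff (suc (j * 2)) + K * coeff (suc (suc (j * 2)))
      ≡⟨ *-distribˡ-+ K (coeff (suc (j * 2))) _ ⟨
    K * (coeff (suc (j * 2)) + coeff (suc (suc (j * 2))))
      ≡⟨ cong (K *_) (paired-≡ j) ⟩
    K * paired j ∎) paired-concave
  where
  K = length (fullCycles m)
  open Coefficients (coefficients k)
  scaled : ∀ c → suc k ! * cycleCoeff π c ≡ K * coeff c
  scaled = cycleCoeff-coefficients (involutive⇒injective inv) T
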